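{- Let $t\ge3$ be odd and let $a,b$ be positive integers with $a$ even and $2a+2\le b$. Then the rooted graph $T_t^2(a,b)$ is balanced.
   Context: Rooted graph $(F,R)$: graph $F$ with root set $R\subseteq V(F)$. For nonempty $S\subseteq V(F)\setminus R$, $d(S)=e(S)/|S|$ with $e(S)$ the number of edges having at least one endpoint in $S$; balanced means $d(S)\ge d(V(F)\setminus R)$ for every nonempty $S\subseteq V(F)\setminus R$. Bukh–Conlon tree $T_2(a,b)$ ($b>a\ge1$): a path $x_1,\dots,x_a$ of non-root vertices with a new root leaf attached to $x_i$ once for each time $i$ appears in $\lfloor1+j\frac{a}{b-a}\rfloor$ ($j=0,\dots,b-a-1$) followed by $a$. $T_3(a,b)$ for $a$ even and $2a+2\le b\le 3a+1$: in $T_2(a,b)$ each $x_i$, $1<i<a$, has one or two root neighbours and $x_1,x_a$ have two or three. For $1<i<a$ label a single root neighbour $y_i$, or two as $\ell_i,r_i$. For $i\in\{1,a\}$ label two root neighbours $\ell_i,r_i$, or three as $z_i,w_i$ and the third $r_1$ (if $i=1$) or $\ell_a$ (if $i=a$). Let $i_1<\dots<i_m$ be the indices with at least two root neighbours. Add edge $z_iw_i$ (three-neighbour case) or $\ell_ir_i$ (two-neighbour case) for $i\in\{1,a\}$; then for each $1\le j<m$ identify $r_{i_j}$, $\ell_{i_{j+1}}$ and all $y_i$ with $i_j<i<i_{j+1}$. Root status is preserved. For $b\ge3a+2$, $T_3(a,b)$ is $T_3(a,b-a)$ plus $a/2$ new root vertices $v_1,\dots,v_{a/2}$ with edges $x_{2i-1}v_i$,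 $v_ix_{2i}$. $T_t^2(a,b)$ ($t$ odd): replace each non-root vertex of $T_3(a,b)$, and also the vertex $\ell_1$ (or $z_1$ if $x_1$ had three root neighbours) and the vertex $r_a$ (or $w_a$ if $x_a$ had three root neighbours), by a clique on $\frac{t-1}{2}$ vertices; each edge of $T_3(a,b)$ is replaced by a complete bipartite graph between the (cliques or single vertices at its) endpoints. The root set consists of the vertices coming from root vertices of $T_3(a,b)$ (including the cliques replacing $\ell_1/z_1$ and $r_a/w_a$); the vertices in cliques replacing $x_1,\dots,x_a$ are the non-roots. -}

module Defs where

open import Data.Nat using (ℕ; zero; suc; _+_; _*_; _∸_; _≤_; _≡ᵇ_; _<ᵇ_; _≤ᵇ_)
open import Data.Nat.DivMod using (_/_)
open import Data.Bool using (Bool; true; false; _∧_; _∨_; not; if_then_else_)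
open import Data.List using (List; []; _∷_; [_]; _++_; map; concatMap; upTo; length; cartesianProduct; allFin; lookup)
open import Data.Product using (_×_; _,_; proj₁; proj₂)
open import Data.Fin using (Fin; toℕ)
open import Data.Fin.Subset using (Subset; Nonempty; _⊆_; ∣_∣)
import Data.Vec as Vec
open import Data.Bool.ListAction using (any)

record RootedGraph : Set where
  field
    n      : ℕ
    adj    : Fin n → Fin n → Bool
    isRoot : Fin n → Bool

countB : {A : Set} → (A → Bool) → List A → ℕ
countB p []       = 0
countB p (y ∷ ys) = if p y then suc (countB p ys) else countB p ys

module _ (G : RootedGraph) where
  open RootedGraph G

  NonRoots : Subset n
  NonRoots = Vec.tabulate (λ u → not (isRoot u))

  e : Subset n → ℕ
  e S = countB (λ (u , w) → (toℕ u <ᵇ toℕ w) ∧ (adj u w ∨ adj w u)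
                             ∧ (Vec.lookup S u ∨ Vec.lookup S w))
               (cartesianProduct (allFin n) (allFin n))

  -- balanced: d(S) ≥ d(V(F)∖R) for all nonempty S ⊆ V(F)∖R, where
  -- d(S) = e(S)/|S|; the inequality of fractions is cross-multiplied.
  Balanced : Set
  Balanced = ∀ (S : Subset n) → Nonempty S → S ⊆ NonRoots →
             e NonRoots * ∣ S ∣ ≤ e S * ∣ NonRoots ∣

fromLabelled : {A : Set} → (vs : List A) → (A → A → Bool) → (A → Bool) → RootedGraph
fromLabelled vs adjA rootA = record
  { n      = length vs
  ; adj    = λ i j → adjA (lookup vs i) (lookup vs j)
  ; isRoot = λ i → rootA (lookup vs i) }

-- floor division, m // 0 = 0 (never used with divisor 0 below)
_//_ : ℕ → ℕ → ℕ
m // zero    = 0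
m // (suc d) = m / suc d

range1 : ℕ → List ℕ
range1 n = map suc (upTo n)

-- The Bukh–Conlon tree T₂(a,b): path x₁ … x_a; a root leaf is attached
-- to x_i once for each occurrence of i in the list
-- ⌊1 + j·a/(b−a)⌋ (j = 0 … b−a−1) followed by a.

leafIndices : ℕ → ℕ → List ℕ
leafIndices a b = map (λ j → 1 + (j * a) // (b ∸ a)) (upTo (b ∸ a)) ++ [ a ]

-- c a b i = number of root neighbours of x_i in T₂(a,b)
rootDeg : ℕ → ℕ → ℕ → ℕ
rootDeg a b i = countB (λ j → j ≡ᵇ i) (leafIndices a b)

data V3 : Set where
  x   : ℕ → V3        -- x i, 1 ≤ i ≤ a (non-root)
  cls : ℕ → V3        -- cls j : class C_j of identified root vertices
  z₁ w₁ zₐ wₐ : V3    -- the roots z₁, w₁, z_a, w_a (three-neighbour case)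
  v   : ℕ → ℕ → V3    -- v r i : root v_i added when passing from T₃(a,r−a) to T₃(a,r)

_==_ : V3 → V3 → Bool
x i     == x j     = i ≡ᵇ j
cls i   == cls j   = i ≡ᵇ j
z₁      == z₁      = true
w₁      == w₁      = true
zₐ      == zₐ      = true
wₐ      == wₐ      = true
v r i   == v s j   = (r ≡ᵇ s) ∧ (i ≡ᵇ j)
_       == _       = false

isX : V3 → Bool
isX (x _) = true
isX _     = false

-- T₃(a,b) as vertex list, edge list and the two special roots
-- (ℓ₁ or z₁, and r_a or w_a) that get blown up in T_t^2.
record T3Data : Set where
  field
    verts : List V3
    edges : List (V3 × V3)
    spec₁ : V3
    specₐ : V3

-- Base case 2a+2 ≤ b ≤ 3a+1.
-- With i₁ < … < i_m the indices having at least two root neighbours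
-- (so i₁ = 1, i_m = a), after the identifications the root vertices are
--   C_0 = {ℓ₁} (if x₁ has two root neighbours),
--   C_j = {r_{i_j}, ℓ_{i_{j+1}}} ∪ {y_i : i_j < i < i_{j+1}}  (1 ≤ j < m),
--   C_m = {r_a} (if x_a has two root neighbours),
--   z₁, w₁ (resp. z_a, w_a) if x₁ (resp. x_a) has three root neighbours.
-- With p(i) = #{i' ≤ i : x_{i'} has ≥ 2 root neighbours}, one has
--   y_i ∈ C_{p(i)},  ℓ_i ∈ C_{p(i)−1},  r_i ∈ C_{p(i)}.
module T3Base (a b : ℕ) where
  c : ℕ → ℕ
  c = rootDeg a b

  p : ℕ → ℕ
  p i = countB (λ i' → 2 ≤ᵇ c i') (range1 i)

  m : ℕ
  m = p a

  three₁ threeₐ : Bool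
  three₁ = c 1 ≡ᵇ 3
  threeₐ = c a ≡ᵇ 3

  nbrs : ℕ → List V3
  nbrs i =
    if i ≡ᵇ 1 then (if three₁ then z₁ ∷ w₁ ∷ cls 1 ∷ [] else cls 0 ∷ cls 1 ∷ [])
    else if i ≡ᵇ a then (if threeₐ then zₐ ∷ wₐ ∷ cls (m ∸ 1) ∷ [] else cls (m ∸ 1) ∷ cls m ∷ [])
    else (if c i ≡ᵇ 1 then cls (p i) ∷ [] else cls (p i ∸ 1) ∷ cls (p i) ∷ [])

  data3 : T3Data
  data3 = record
    { verts = map x (range1 a)
              ++ (if three₁ then z₁ ∷ w₁ ∷ [] else cls 0 ∷ [])
              ++ map cls (range1 (m ∸ 1))
              ++ (if threeₐ then zₐ ∷ wₐ ∷ [] else cls m ∷ [])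
    ; edges = map (λ i → (x i , x (suc i))) (range1 (a ∸ 1))
              ++ concatMap (λ i → map (λ u → (x i , u)) (nbrs i)) (range1 a)
              ++ [ (if three₁ then (z₁ , w₁) else (cls 0 , cls 1)) ]
              ++ [ (if threeₐ then (zₐ , wₐ) else (cls (m ∸ 1) , cls m)) ]
    ; spec₁ = if three₁ then z₁ else cls 0
    ; specₐ = if threeₐ then wₐ else cls m }

-- T₃ with a fuel argument for the recursion b ↦ b − a (fuel b suffices).
T3aux : ℕ → ℕ → ℕ → T3Data
T3aux zero    a b = T3Base.data3 a b
T3aux (suc f) a b =
  if b ≤ᵇ 3 * a + 1 then T3Base.data3 a b
  else record
    { verts = T3Data.verts D ++ map (v b) (range1 (a / 2))
    ; edges = T3Data.edges D
              ++ concatMap (λ i → (x (2 * i ∸ 1) , v b i) ∷ (v b i , x (2 * i)) ∷ [])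
                           (range1 (a / 2))
    ; spec₁ = T3Data.spec₁ D
    ; specₐ = T3Data.specₐ D }
  where D = T3aux f a (b ∸ a)

T3 : ℕ → ℕ → T3Data
T3 a b = T3aux b a b

-- T_t^2(a,b): blow up x₁,…,x_a and the two special roots into cliques on
-- (t−1)/2 vertices, edges into complete bipartite graphs.
-- Vertices are pairs (u , copy index).

module Tt2Con (t a b : ℕ) where
  D : T3Data
  D = T3 a b
  open T3Data D

  k : ℕ
  k = (t ∸ 1) / 2

  size : V3 → ℕ
  size u = if isX u ∨ (u == spec₁) ∨ (u == specₐ) then k else 1

  adj3 : V3 → V3 → Bool
  adj3 u w = any (λ (q , r) → (q == u ∧ r == w) ∨ (q == w ∧ r == u)) edges

  vs : List (V3 × ℕ)
  vs = concatMap (λ u → map (λ i → (u , i)) (upTo (size u))) verts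

  adjT : V3 × ℕ → V3 × ℕ → Bool
  adjT (u , i) (w , j) = ((u == w) ∧ not (i ≡ᵇ j)) ∨ adj3 u w

  rootT : V3 × ℕ → Bool
  rootT (u , _) = not (isX u)

  graph : RootedGraph
  graph = fromLabelled vs adjT rootT

Tt2 : ℕ → ℕ → ℕ → RootedGraph
Tt2 = Tt2Con.graph

-- Let k = ⌊(t − 1)/2⌋ and, for a set S of non-roots of T_t^2(a,b), let s_i be
-- the number of vertices of S in the clique X_i replacing x_i.  Every vertex of
-- X_i has degree k − 1 + w_i, where w_i is the degree of x_i in T₃(a,b) with the
-- neighbours that are blown up into cliques counted k times; the edges inside S join
-- two vertices of one clique or of consecutive cliques.  Double counting thus
-- gives 2 e(S) ≥ Σ s_i (2(k − 1 + w_i) + 1) − Σ s_i² − 2 Σ s_i s_{i+1}, with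
-- equality for S = V ∖ R.
--
-- Unwinding the recursion b ↦ b − a, T₃(a,b) is the base tree T₃(a,b′),
-- 2a + 2 ≤ b′ ≤ 3a + 1, plus L layers of roots, each layer adding one root
-- neighbour to every x_i.  In the base tree w_i is 2k + c_i − [i ∈ {1, a}],
-- where c_i is the number of leaves at x_i in the Bukh–Conlon tree T₂(a,b′).
-- Balancedness then becomes an inequality between sums over the path
-- x_1, …, x_a; it follows by Abel summation from 0 ≤ s_i ≤ k and the even
-- spread of the leaves of T₂: n(b′ − a) ≤ a (c_1 + … + c_n) < n(b′ − a) + a.

module Submission where

module DoubleCounting where

  open import Data.Nat
  open import Data.Nat.Properties
  open import Data.Bool using (Bool; true; false; _∧_; _∨_; not)
  open import Data.Bool.Properties using (∨-comm)
  open import Data.List using (List; []; _∷_; _++_; map; concatMap; length; lookup; tabulate; allFin; cartesianProduct)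
  open import Data.Fin using (Fin; zero; suc; toℕ)
  open import Data.Fin.Subset using (Subset)
  open import Data.Product using (_×_; _,_)
  import Data.Vec as Vec
  open import Relation.Binary.PropositionalEquality
  open import Data.Nat.Tactic.RingSolver using (solve-∀)
  open import Defs

  ind : Bool → ℕ
  ind true = 1
  ind false = 0

  ΣF : (n : ℕ) → (Fin n → ℕ) → ℕ
  ΣF zero f = 0
  ΣF (suc n) f = f zero + ΣF n (λ i → f (suc i))

  ΣL : {A : Set} → (A → ℕ) → List A → ℕ
  ΣL f [] = 0
  ΣL f (y ∷ ys) = f y + ΣL f ys

  ΣΣ : (n : ℕ) → (Fin n → Fin n → ℕ) → ℕ
  ΣΣ n F = ΣF n (λ u → ΣF n (λ w → F u w))

  ind-∧ : ∀ p q → ind (p ∧ q) ≡ ind p * ind q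
  ind-∧ true q = sym (+-identityʳ (ind q))
  ind-∧ false q = refl

  ind-∨ : ∀ p q → ind (p ∨ q) + ind p * ind q ≡ ind p + ind q
  ind-∨ true true = refl
  ind-∨ true false = refl
  ind-∨ false q = +-identityʳ (ind q)

  ind-∨-≤ : ∀ p q → ind (p ∨ q) ≤ ind p + ind q
  ind-∨-≤ true q = s≤s z≤n
  ind-∨-≤ false q = ≤-refl

  ind-∧-≤ : ∀ p q → ind (p ∧ q) ≤ ind p
  ind-∧-≤ true true = ≤-refl
  ind-∧-≤ true false = z≤n
  ind-∧-≤ false q = z≤n

  ind≤1 : ∀ p → ind p ≤ 1
  ind≤1 true = s≤s z≤n
  ind≤1 false = z≤n

  ind-not : ∀ p → ind (not p) + ind p ≡ 1
  ind-not true = refl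
  ind-not false = refl

  ind-idem : ∀ p → ind p * ind p ≡ ind p
  ind-idem true = refl
  ind-idem false = refl

  ind≡1⇒true : ∀ {p} → ind p ≡ 1 → p ≡ true
  ind≡1⇒true {true} _ = refl

  +-interchange : ∀ m n o p → (m + n) + (o + p) ≡ (m + o) + (n + p)
  +-interchange = solve-∀

  countB≡ΣL : {A : Set} (p : A → Bool) (xs : List A) → countB p xs ≡ ΣL (λ y → ind (p y)) xs
  countB≡ΣL p [] = refl
  countB≡ΣL p (y ∷ ys) with p y
  ... | true = cong suc (countB≡ΣL p ys)
  ... | false = countB≡ΣL p ys

  ΣL-++ : {A : Set} (f : A → ℕ) (xs ys : List A) → ΣL f (xs ++ ys) ≡ ΣL f xs + ΣL f ys
  ΣL-++ f [] ys = refl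
  ΣL-++ f (q ∷ xs) ys = trans (cong (f q +_) (ΣL-++ f xs ys)) (sym (+-assoc (f q) _ _))

  ΣL-map : {A B : Set} (f : B → ℕ) (g : A → B) (xs : List A) → ΣL f (map g xs) ≡ ΣL (λ y → f (g y)) xs
  ΣL-map f g [] = refl
  ΣL-map f g (q ∷ xs) = cong (f (g q) +_) (ΣL-map f g xs)

  ΣL-concatMap : {A B : Set} (f : B → ℕ) (g : A → List B) (xs : List A) →
    ΣL f (concatMap g xs) ≡ ΣL (λ y → ΣL f (g y)) xs
  ΣL-concatMap f g [] = refl
  ΣL-concatMap f g (q ∷ xs) = trans (ΣL-++ f (g q) (concatMap g xs)) (cong (ΣL f (g q) +_) (ΣL-concatMap f g xs))

  ΣL-cong : {A : Set} {f g : A → ℕ} (xs : List A) → (∀ y → f y ≡ g y) → ΣL f xs ≡ ΣL g xs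
  ΣL-cong [] h = refl
  ΣL-cong (q ∷ xs) h = cong₂ _+_ (h q) (ΣL-cong xs h)

  ΣL-+ : {A : Set} (f g : A → ℕ) (xs : List A) → ΣL (λ y → f y + g y) xs ≡ ΣL f xs + ΣL g xs
  ΣL-+ f g [] = refl
  ΣL-+ f g (q ∷ xs) rewrite ΣL-+ f g xs = +-interchange (f q) (g q) _ _

  ΣL-* : {A : Set} (c : ℕ) (f : A → ℕ) (xs : List A) → ΣL (λ y → c * f y) xs ≡ c * ΣL f xs
  ΣL-* c f [] = sym (*-zeroʳ c)
  ΣL-* c f (q ∷ xs) rewrite ΣL-* c f xs = sym (*-distribˡ-+ c (f q) _)

  ΣL-*ʳ : {A : Set} (c : ℕ) (f : A → ℕ) (xs : List A) → ΣL (λ y → f y * c) xs ≡ ΣL f xs * c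
  ΣL-*ʳ c f xs = trans (ΣL-cong xs (λ y → *-comm (f y) c)) (trans (ΣL-* c f xs) (*-comm c _))

  ΣL-const : {A : Set} (c : ℕ) (xs : List A) → ΣL (λ _ → c) xs ≡ c * length xs
  ΣL-const c [] = sym (*-zeroʳ c)
  ΣL-const c (q ∷ xs) rewrite ΣL-const c xs = sym (*-suc c (length xs))

  ΣL-zero : {A : Set} (xs : List A) → ΣL (λ _ → 0) xs ≡ 0
  ΣL-zero [] = refl
  ΣL-zero (_ ∷ xs) = ΣL-zero xs

  ΣL-tabulate : {A : Set} (f : A → ℕ) (n : ℕ) (g : Fin n → A) → ΣL f (tabulate g) ≡ ΣF n (λ i → f (g i))
  ΣL-tabulate f zero g = refl
  ΣL-tabulate f (suc n) g = cong (f (g zero) +_) (ΣL-tabulate f n (λ i → g (suc i)))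

  ΣF-lookup : {A : Set} (f : A → ℕ) (xs : List A) → ΣF (length xs) (λ i → f (lookup xs i)) ≡ ΣL f xs
  ΣF-lookup f [] = refl
  ΣF-lookup f (q ∷ xs) = cong (f q +_) (ΣF-lookup f xs)

  ΣL-cartesianProduct : {A B : Set} (f : A × B → ℕ) (xs : List A) (ys : List B) →
    ΣL f (cartesianProduct xs ys) ≡ ΣL (λ q → ΣL (λ y → f (q , y)) ys) xs
  ΣL-cartesianProduct f [] ys = refl
  ΣL-cartesianProduct f (q ∷ xs) ys = trans (ΣL-++ f (map (q ,_) ys) _)
    (cong₂ _+_ (ΣL-map f (q ,_) ys) (ΣL-cartesianProduct f xs ys))

  ΣF-cong : (n : ℕ) {f g : Fin n → ℕ} → (∀ i → f i ≡ g i) → ΣF n f ≡ ΣF n g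
  ΣF-cong zero h = refl
  ΣF-cong (suc n) h = cong₂ _+_ (h zero) (ΣF-cong n (λ i → h (suc i)))

  ΣF-+ : (n : ℕ) (f g : Fin n → ℕ) → ΣF n (λ i → f i + g i) ≡ ΣF n f + ΣF n g
  ΣF-+ zero f g = refl
  ΣF-+ (suc n) f g rewrite ΣF-+ n (λ i → f (suc i)) (λ i → g (suc i)) = +-interchange (f zero) (g zero) _ _

  ΣF-* : (n : ℕ) (c : ℕ) (f : Fin n → ℕ) → ΣF n (λ i → c * f i) ≡ c * ΣF n f
  ΣF-* zero c f = sym (*-zeroʳ c)
  ΣF-* (suc n) c f rewrite ΣF-* n c (λ i → f (suc i)) = sym (*-distribˡ-+ c (f zero) _)

  ΣF-*ʳ : (n c : ℕ) (f : Fin n → ℕ) → ΣF n (λ u → f u * c) ≡ ΣF n f * c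
  ΣF-*ʳ n c f = trans (ΣF-cong n (λ u → *-comm (f u) c)) (trans (ΣF-* n c f) (*-comm c _))

  ΣF-zero : (n : ℕ) → ΣF n (λ _ → 0) ≡ 0
  ΣF-zero zero = refl
  ΣF-zero (suc n) = ΣF-zero n

  ΣF-mono : (n : ℕ) {f g : Fin n → ℕ} → (∀ i → f i ≤ g i) → ΣF n f ≤ ΣF n g
  ΣF-mono zero h = z≤n
  ΣF-mono (suc n) h = +-mono-≤ (h zero) (ΣF-mono n (λ i → h (suc i)))

  ΣF-ΣL : (n : ℕ) {B : Set} (L : List B) (F : Fin n → B → ℕ) →
    ΣF n (λ u → ΣL (λ y → F u y) L) ≡ ΣL (λ y → ΣF n (λ u → F u y)) L
  ΣF-ΣL n [] F = ΣF-zero n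
  ΣF-ΣL n (y ∷ L) F = trans (ΣF-+ n _ _) (cong (ΣF n (λ u → F u y) +_) (ΣF-ΣL n L F))

  ΣF-comm : (m n : ℕ) (F : Fin m → Fin n → ℕ) →
    ΣF m (λ i → ΣF n (λ j → F i j)) ≡ ΣF n (λ j → ΣF m (λ i → F i j))
  ΣF-comm zero n F = sym (ΣF-zero n)
  ΣF-comm (suc m) n F = trans (cong (ΣF n (F zero) +_) (ΣF-comm m n (λ i → F (suc i))))
    (sym (ΣF-+ n (F zero) (λ j → ΣF m (λ i → F (suc i) j))))

  ΣF-delta : (n : ℕ) (f : Fin n → ℕ) (u : Fin n) → ΣF n (λ w → ind (toℕ u ≡ᵇ toℕ w) * f w) ≡ f u
  ΣF-delta (suc n) f zero = trans (cong₂ _+_ (+-identityʳ (f zero)) (ΣF-zero n)) (+-identityʳ (f zero))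
  ΣF-delta (suc n) f (suc u) = ΣF-delta n (λ i → f (suc i)) u

  ΣΣ-cong : (n : ℕ) {F G : Fin n → Fin n → ℕ} → (∀ u w → F u w ≡ G u w) → ΣΣ n F ≡ ΣΣ n G
  ΣΣ-cong n h = ΣF-cong n (λ u → ΣF-cong n (λ w → h u w))

  ΣΣ-+ : (n : ℕ) (F G : Fin n → Fin n → ℕ) → ΣΣ n (λ u w → F u w + G u w) ≡ ΣΣ n F + ΣΣ n G
  ΣΣ-+ n F G = trans (ΣF-cong n (λ u → ΣF-+ n (F u) (G u))) (ΣF-+ n _ _)

  ΣΣ-swap : (n : ℕ) (F : Fin n → Fin n → ℕ) → ΣΣ n F ≡ ΣΣ n (λ u w → F w u)
  ΣΣ-swap n F = ΣF-comm n n F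

  ind-<ᵇ-∨ : ∀ m n → ind ((m <ᵇ n) ∨ (n <ᵇ m)) ≡ ind (m <ᵇ n) + ind (n <ᵇ m)
  ind-<ᵇ-∨ zero zero = refl
  ind-<ᵇ-∨ zero (suc n) = refl
  ind-<ᵇ-∨ (suc m) zero = refl
  ind-<ᵇ-∨ (suc m) (suc n) = ind-<ᵇ-∨ m n

  trichotomyᵇ : ∀ m n → ind ((m <ᵇ n) ∨ (n <ᵇ m)) + ind (m ≡ᵇ n) ≡ 1
  trichotomyᵇ zero zero = refl
  trichotomyᵇ zero (suc n) = refl
  trichotomyᵇ (suc m) zero = refl
  trichotomyᵇ (suc m) (suc n) = trichotomyᵇ m n

  -- The handshake lemma 2 e(S) + 2 e(G[S]) = 2 Σ_{u ∈ S} deg u, with all three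
  -- terms written as sums over ordered pairs of vertices.
  module EdgeCount (G : RootedGraph) (S : Subset (RootedGraph.n G)) where
    open RootedGraph G

    Adjacent : Fin n → Fin n → Bool
    Adjacent u w = adj u w ∨ adj w u
    Before : Fin n → Fin n → Bool
    Before u w = toℕ u <ᵇ toℕ w
    Distinct : Fin n → Fin n → Bool
    Distinct u w = Before u w ∨ Before w u
    InS : Fin n → Bool
    InS u = Vec.lookup S u

    adjacent distinct : Fin n → Fin n → ℕ
    adjacent u w = ind (Adjacent u w)
    distinct u w = ind (Distinct u w)
    inS : Fin n → ℕ
    inS u = ind (InS u)
    meetsS : Fin n → Fin n → ℕ
    meetsS u w = ind (InS u ∨ InS w)

    adjacent-sym : ∀ u w → adjacent w u ≡ adjacent u w
    adjacent-sym u w = cong ind (∨-comm (adj w u) (adj u w))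
    distinct-sym : ∀ u w → distinct w u ≡ distinct u w
    distinct-sym u w = cong ind (∨-comm (Before w u) (Before u w))
    meetsS-sym : ∀ u w → meetsS w u ≡ meetsS u w
    meetsS-sym u w = cong ind (∨-comm (InS w) (InS u))

    e≡ΣΣ : e G S ≡ ΣΣ n (λ u w → ind (Before u w) * (adjacent u w * meetsS u w))
    e≡ΣΣ = trans (countB≡ΣL _ (cartesianProduct (allFin n) (allFin n)))
          (trans (ΣL-cartesianProduct _ (allFin n) (allFin n))
          (trans (ΣL-tabulate _ n (λ i → i))
          (ΣF-cong n (λ u → trans (ΣL-tabulate _ n (λ i → i))
            (ΣF-cong n (λ w → trans (ind-∧ (Before u w) _) (cong (ind (Before u w) *_) (ind-∧ (Adjacent u w) _))))))))

    2e≡ΣΣ : 2 * e G S ≡ ΣΣ n (λ u w → distinct u w * adjacent u w * meetsS u w)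
    2e≡ΣΣ = begin
        2 * e G S
      ≡⟨ cong (2 *_) e≡ΣΣ ⟩
        2 * E
      ≡⟨ cong (E +_) (+-identityʳ E) ⟩
        E + E
      ≡⟨ cong (E +_) (trans (ΣΣ-swap n _) (ΣΣ-cong n (λ u w → cong₂ (λ p q → ind (Before w u) * (p * q)) (adjacent-sym u w) (meetsS-sym u w)))) ⟩
        E + ΣΣ n (λ u w → ind (Before w u) * (adjacent u w * meetsS u w))
      ≡⟨ sym (ΣΣ-+ n _ _) ⟩
        ΣΣ n (λ u w → ind (Before u w) * (adjacent u w * meetsS u w) + ind (Before w u) * (adjacent u w * meetsS u w))
      ≡⟨ ΣΣ-cong n (λ u w → trans (sym (*-distribʳ-+ (adjacent u w * meetsS u w) (ind (Before u w)) _))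
            (trans (cong (_* (adjacent u w * meetsS u w)) (sym (ind-<ᵇ-∨ (toℕ u) (toℕ w)))) (sym (*-assoc (distinct u w) _ _)))) ⟩
        ΣΣ n (λ u w → distinct u w * adjacent u w * meetsS u w)
      ∎
      where
      open ≡-Reasoning
      E = ΣΣ n (λ u w → ind (Before u w) * (adjacent u w * meetsS u w))

    handshake : 2 * e G S + ΣΣ n (λ u w → distinct u w * adjacent u w * (inS u * inS w))
              ≡ 2 * ΣΣ n (λ u w → distinct u w * adjacent u w * inS u)
    handshake = begin
        2 * e G S + ΣΣ n (λ u w → distinct u w * adjacent u w * (inS u * inS w))
      ≡⟨ cong (_+ ΣΣ n (λ u w → distinct u w * adjacent u w * (inS u * inS w))) 2e≡ΣΣ ⟩
        ΣΣ n (λ u w → distinct u w * adjacent u w * meetsS u w) + ΣΣ n (λ u w → distinct u w * adjacent u w * (inS u * inS w))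
      ≡⟨ sym (ΣΣ-+ n _ _) ⟩
        ΣΣ n (λ u w → distinct u w * adjacent u w * meetsS u w + distinct u w * adjacent u w * (inS u * inS w))
      ≡⟨ ΣΣ-cong n (λ u w → trans (sym (*-distribˡ-+ (distinct u w * adjacent u w) _ _))
           (trans (cong (distinct u w * adjacent u w *_) (ind-∨ (InS u) (InS w))) (*-distribˡ-+ (distinct u w * adjacent u w) _ _))) ⟩
        ΣΣ n (λ u w → distinct u w * adjacent u w * inS u + distinct u w * adjacent u w * inS w)
      ≡⟨ ΣΣ-+ n _ _ ⟩
        D + ΣΣ n (λ u w → distinct u w * adjacent u w * inS w)
      ≡⟨ cong (D +_) (trans (ΣΣ-swap n _) (ΣΣ-cong n (λ u w → cong₂ (λ p q → p * q * inS u) (distinct-sym u w) (adjacent-sym u w)))) ⟩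
        D + D
      ≡⟨ cong (D +_) (sym (+-identityʳ D)) ⟩
        2 * D
      ∎
      where
      open ≡-Reasoning
      D = ΣΣ n (λ u w → distinct u w * adjacent u w * inS u)

module Vertices where

  open import Data.Nat
  open import Data.Nat.Properties
  open import Data.Bool using (Bool; true; false; _∧_; _∨_; if_then_else_; T)
  open import Data.Bool.Properties using (∨-assoc; ∨-identityʳ; ∨-zeroʳ)
  open import Data.List using (List; []; _∷_; _++_; map; concatMap; upTo)
  open import Data.List.Properties using (map-++; upTo-∷ʳ)
  open import Data.List.Relation.Unary.All using (All; []; _∷_)
  open import Data.Bool.ListAction using (any)
  open import Data.Unit using (⊤; tt)
  open import Data.Empty using (⊥; ⊥-elim)
  open import Data.Product using (_×_; _,_; proj₁; proj₂)
  open import Relation.Nullary using (¬_; yes; no)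
  open import Relation.Binary.PropositionalEquality
  open import Defs
  open DoubleCounting

  true≢false : true ≢ false
  true≢false ()

  ≡ᵇ-refl : ∀ m → (m ≡ᵇ m) ≡ true
  ≡ᵇ-refl zero = refl
  ≡ᵇ-refl (suc m) = ≡ᵇ-refl m

  ≡ᵇ-sound : ∀ m n → (m ≡ᵇ n) ≡ true → m ≡ n
  ≡ᵇ-sound zero zero _ = refl
  ≡ᵇ-sound (suc m) (suc n) h = cong suc (≡ᵇ-sound m n h)

  ≡ᵇ-false : ∀ m n → m ≢ n → (m ≡ᵇ n) ≡ false
  ≡ᵇ-false zero zero h = ⊥-elim (h refl)
  ≡ᵇ-false zero (suc n) h = refl
  ≡ᵇ-false (suc m) zero h = refl
  ≡ᵇ-false (suc m) (suc n) h = ≡ᵇ-false m n (λ e → h (cong suc e))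

  ≡ᵇ-sym : ∀ m n → (m ≡ᵇ n) ≡ (n ≡ᵇ m)
  ≡ᵇ-sym zero zero = refl
  ≡ᵇ-sym zero (suc n) = refl
  ≡ᵇ-sym (suc m) zero = refl
  ≡ᵇ-sym (suc m) (suc n) = ≡ᵇ-sym m n

  ≤ᵇ-true : ∀ {m n} → m ≤ n → (m ≤ᵇ n) ≡ true
  ≤ᵇ-true {m} {n} h with m ≤ᵇ n | ≤⇒≤ᵇ h
  ... | true | _ = refl

  ≤ᵇ-false : ∀ {m n} → ¬ (m ≤ n) → (m ≤ᵇ n) ≡ false
  ≤ᵇ-false {m} {n} h with m ≤ᵇ n in eq
  ... | true = ⊥-elim (h (≤ᵇ⇒≤ m n (subst T (sym eq) tt)))
  ... | false = refl

  ≤ᵇ-sound : ∀ m n → (m ≤ᵇ n) ≡ true → m ≤ n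
  ≤ᵇ-sound m n h = ≤ᵇ⇒≤ m n (subst T (sym h) tt)

  <ᵇ-true : ∀ {m n} → m < n → (m <ᵇ n) ≡ true
  <ᵇ-true {m} {n} h with m <ᵇ n | <⇒<ᵇ h
  ... | true | _ = refl

  <ᵇ-false : ∀ {m n} → ¬ (m < n) → (m <ᵇ n) ≡ false
  <ᵇ-false {m} {n} h with m <ᵇ n in eq
  ... | true = ⊥-elim (h (<ᵇ⇒< m n (subst T (sym eq) tt)))
  ... | false = refl

  ==-refl : ∀ u → (u == u) ≡ true
  ==-refl (x i) = ≡ᵇ-refl i
  ==-refl (cls i) = ≡ᵇ-refl i
  ==-refl z₁ = refl
  ==-refl w₁ = refl
  ==-refl zₐ = refl
  ==-refl wₐ = refl
  ==-refl (v r i) rewrite ≡ᵇ-refl r = ≡ᵇ-refl i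

  ∧-true⁻ : ∀ {p q} → (p ∧ q) ≡ true → (p ≡ true) × (q ≡ true)
  ∧-true⁻ {true} {true} _ = refl , refl

  ==-sound : ∀ u w → (u == w) ≡ true → u ≡ w
  ==-sound (x i) (x j) h = cong x (≡ᵇ-sound i j h)
  ==-sound (cls i) (cls j) h = cong cls (≡ᵇ-sound i j h)
  ==-sound z₁ z₁ h = refl
  ==-sound w₁ w₁ h = refl
  ==-sound zₐ zₐ h = refl
  ==-sound wₐ wₐ h = refl
  ==-sound (v r i) (v s j) h = cong₂ v (≡ᵇ-sound r s (proj₁ (∧-true⁻ h))) (≡ᵇ-sound i j (proj₂ (∧-true⁻ h)))
  ==-sound (x _) (cls _) ()
  ==-sound (x _) z₁ ()
  ==-sound (x _) w₁ ()
  ==-sound (x _) zₐ ()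
  ==-sound (x _) wₐ ()
  ==-sound (x _) (v _ _) ()
  ==-sound (cls _) (x _) ()
  ==-sound (cls _) z₁ ()
  ==-sound (cls _) w₁ ()
  ==-sound (cls _) zₐ ()
  ==-sound (cls _) wₐ ()
  ==-sound (cls _) (v _ _) ()
  ==-sound z₁ (x _) ()
  ==-sound z₁ (cls _) ()
  ==-sound z₁ w₁ ()
  ==-sound z₁ zₐ ()
  ==-sound z₁ wₐ ()
  ==-sound z₁ (v _ _) ()
  ==-sound w₁ (x _) ()
  ==-sound w₁ (cls _) ()
  ==-sound w₁ z₁ ()
  ==-sound w₁ zₐ ()
  ==-sound w₁ wₐ ()
  ==-sound w₁ (v _ _) ()
  ==-sound zₐ (x _) ()
  ==-sound zₐ (cls _) ()
  ==-sound zₐ z₁ ()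
  ==-sound zₐ w₁ ()
  ==-sound zₐ wₐ ()
  ==-sound zₐ (v _ _) ()
  ==-sound wₐ (x _) ()
  ==-sound wₐ (cls _) ()
  ==-sound wₐ z₁ ()
  ==-sound wₐ w₁ ()
  ==-sound wₐ zₐ ()
  ==-sound wₐ (v _ _) ()
  ==-sound (v _ _) (x _) ()
  ==-sound (v _ _) (cls _) ()
  ==-sound (v _ _) z₁ ()
  ==-sound (v _ _) w₁ ()
  ==-sound (v _ _) zₐ ()
  ==-sound (v _ _) wₐ ()

  ==-sym : ∀ u w → (u == w) ≡ (w == u)
  ==-sym u w with u == w in e1 | w == u in e2
  ... | true | true = refl
  ... | false | false = refl
  ... | true | false = trans (sym e2') e2
    where
    e2' : (w == u) ≡ true
    e2' = subst (λ z → (w == z) ≡ true) (sym (==-sound u w e1)) (==-refl w)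
  ... | false | true = trans (sym e1) (subst (λ z → (u == z) ≡ true) (sym (==-sound w u e2)) (==-refl u))

  any-++ : {A : Set} (P : A → Bool) (xs ys : List A) → any P (xs ++ ys) ≡ any P xs ∨ any P ys
  any-++ P [] ys = refl
  any-++ P (q ∷ xs) ys = trans (cong (P q ∨_) (any-++ P xs ys)) (sym (∨-assoc (P q) _ _))

  any-map : {A B : Set} (P : B → Bool) (f : A → B) (xs : List A) → any P (map f xs) ≡ any (λ y → P (f y)) xs
  any-map P f [] = refl
  any-map P f (q ∷ xs) = cong (P (f q) ∨_) (any-map P f xs)

  any-concatMap : {A B : Set} (P : B → Bool) (f : A → List B) (xs : List A) →
    any P (concatMap f xs) ≡ any (λ y → any P (f y)) xs
  any-concatMap P f [] = refl
  any-concatMap P f (q ∷ xs) = trans (any-++ P (f q) (concatMap f xs)) (cong (any P (f q) ∨_) (any-concatMap P f xs))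

  any-cong : {A : Set} {P Q : A → Bool} (xs : List A) → (∀ y → P y ≡ Q y) → any P xs ≡ any Q xs
  any-cong [] h = refl
  any-cong (q ∷ xs) h = cong₂ _∨_ (h q) (any-cong xs h)

  any-false : {A : Set} {P : A → Bool} (xs : List A) → (∀ y → P y ≡ false) → any P xs ≡ false
  any-false [] h = refl
  any-false (q ∷ xs) h rewrite h q = any-false xs h

  ∨-interchange : ∀ p q r s → (p ∨ q) ∨ (r ∨ s) ≡ (p ∨ r) ∨ (q ∨ s)
  ∨-interchange true q r s = refl
  ∨-interchange false true r s = sym (∨-zeroʳ r)
  ∨-interchange false false r s = refl

  any-∨ : {A : Set} (P Q : A → Bool) (xs : List A) → any (λ y → P y ∨ Q y) xs ≡ any P xs ∨ any Q xs
  any-∨ P Q [] = refl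
  any-∨ P Q (q ∷ xs) = trans (cong ((P q ∨ Q q) ∨_) (any-∨ P Q xs)) (∨-interchange (P q) (Q q) _ _)

  range1-suc : ∀ n → range1 (suc n) ≡ range1 n ++ (suc n ∷ [])
  range1-suc n = trans (cong (map suc) (sym (upTo-∷ʳ n))) (map-++ suc (upTo n) (n ∷ []))

  ΣL-range1-suc : (f : ℕ → ℕ) (n : ℕ) → ΣL f (range1 (suc n)) ≡ ΣL f (range1 n) + f (suc n)
  ΣL-range1-suc f n = trans (cong (ΣL f) (range1-suc n)) (trans (ΣL-++ f (range1 n) _) (cong (ΣL f (range1 n) +_) (+-identityʳ _)))

  any-range1-suc : (F : ℕ → Bool) (n : ℕ) → any F (range1 (suc n)) ≡ any F (range1 n) ∨ F (suc n)
  any-range1-suc F n = trans (cong (any F) (range1-suc n)) (trans (any-++ F (range1 n) _) (cong (any F (range1 n) ∨_) (∨-identityʳ _)))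

  inRange : ℕ → ℕ → Bool
  inRange t n = (1 ≤ᵇ t) ∧ (t ≤ᵇ n)

  ≤ᵇ-suc : ∀ t n → t ≢ suc n → (t ≤ᵇ suc n) ≡ (t ≤ᵇ n)
  ≤ᵇ-suc t n h with t ≤? n
  ... | yes p = trans (≤ᵇ-true (≤-trans p (n≤1+n n))) (sym (≤ᵇ-true p))
  ... | no p = trans (≤ᵇ-false (λ q → h (≤-antisym q (≰⇒> p)))) (sym (≤ᵇ-false p))

  inRange-suc : ∀ t n → t ≢ suc n → inRange t (suc n) ≡ inRange t n
  inRange-suc t n h = cong ((1 ≤ᵇ t) ∧_) (≤ᵇ-suc t n h)

  inRange-intro : ∀ {j n} → 1 ≤ j → j ≤ n → inRange j n ≡ true
  inRange-intro h1 h2 = cong₂ _∧_ (≤ᵇ-true h1) (≤ᵇ-true h2)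

  inRange-zero : ∀ t → inRange t 0 ≡ false
  inRange-zero zero = refl
  inRange-zero (suc t) = refl

  inRange-self : ∀ n → inRange (suc n) (suc n) ≡ true
  inRange-self n = ≤ᵇ-true {suc n} {suc n} ≤-refl

  inRange-beyond : ∀ n → inRange (suc n) n ≡ false
  inRange-beyond n = cong ((1 ≤ᵇ suc n) ∧_) (≤ᵇ-false {suc n} {n} (λ q → <-irrefl refl q))

  any-range1-single : (F : ℕ → Bool) (t : ℕ) → (∀ j → j ≢ t → F j ≡ false) → ∀ n → any F (range1 n) ≡ inRange t n ∧ F t
  any-range1-single F t h zero = sym (cong (_∧ F t) (inRange-zero t))
  any-range1-single F t h (suc n) with t ≟ suc n
  ... | yes refl = trans (any-range1-suc F n) (trans (cong (_∨ F (suc n)) (trans (any-range1-single F (suc n) h n) (cong (_∧ F (suc n)) (inRange-beyond n))))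
                     (sym (cong (_∧ F (suc n)) (inRange-self n))))
  ... | no ne = trans (any-range1-suc F n) (trans (cong₂ _∨_ (any-range1-single F t h n) (h (suc n) (λ e → ne (sym e))))
                     (trans (∨-identityʳ _) (cong (_∧ F t) (sym (inRange-suc t n ne)))))

  ΣL-range1-single : (g : ℕ → ℕ) (t : ℕ) → (∀ j → j ≢ t → g j ≡ 0) → ∀ n → ΣL g (range1 n) ≡ ind (inRange t n) * g t
  ΣL-range1-single g t h zero = cong (λ z → ind z * g t) (sym (inRange-zero t))
  ΣL-range1-single g t h (suc n) with t ≟ suc n
  ... | yes refl = trans (ΣL-range1-suc g n) (trans (cong (_+ g (suc n)) (trans (ΣL-range1-single g (suc n) h n) (cong (λ z → ind z * g (suc n)) (inRange-beyond n))))
                     (trans (sym (+-identityʳ (g (suc n)))) (cong (λ z → ind z * g (suc n)) (sym (inRange-self n)))))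
  ... | no ne = trans (ΣL-range1-suc g n) (trans (cong₂ _+_ (ΣL-range1-single g t h n) (h (suc n) (λ e → ne (sym e))))
                     (trans (+-identityʳ _) (cong (λ z → ind z * g t) (sym (inRange-suc t n ne)))))

  member : V3 → List V3 → Bool
  member u L = any (λ w → w == u) L

  count : V3 → List V3 → ℕ
  count w V = ΣL (λ u → ind (w == u)) V

  Fresh : V3 → List V3 → Set
  Fresh w L = member w L ≡ false

  AllDistinct : List V3 → Set
  AllDistinct [] = ⊤
  AllDistinct (w ∷ L) = Fresh w L × AllDistinct L

  ΣL-==-weight : (w : V3) (g : V3 → ℕ) (V : List V3) → ΣL (λ u → ind (w == u) * g u) V ≡ count w V * g w
  ΣL-==-weight w g [] = refl
  ΣL-==-weight w g (u ∷ V) with w == u in e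
  ... | true rewrite ==-sound w u e | ΣL-==-weight u g V = cong (_+ count u V * g u) (+-identityʳ (g u))
  ... | false = ΣL-==-weight w g V

  ΣL-member : (V NB : List V3) (g : V3 → ℕ) → AllDistinct NB →
    ΣL (λ u → ind (member u NB) * g u) V ≡ ΣL (λ w → count w V * g w) NB
  ΣL-member V [] g _ = ΣL-zero V
  ΣL-member V (w ∷ NB) g (fr , dist) =
    trans (ΣL-cong V pt) (trans (ΣL-+ _ _ V) (cong₂ _+_ (ΣL-==-weight w g V) (ΣL-member V NB g dist)))
    where
    pt : ∀ u → ind ((w == u) ∨ member u NB) * g u ≡ ind (w == u) * g u + ind (member u NB) * g u
    pt u with w == u in e
    ... | false = refl
    ... | true rewrite sym (==-sound w u e) | fr = sym (+-identityʳ _)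

  any-congAll : {A : Set} {P Q : A → Bool} {xs : List A} → All (λ y → P y ≡ Q y) xs → any P xs ≡ any Q xs
  any-congAll [] = refl
  any-congAll (h ∷ hs) = cong₂ _∨_ h (any-congAll hs)

  any-∧ : {A : Set} (b : Bool) (Q : A → Bool) (xs : List A) → any (λ y → b ∧ Q y) xs ≡ b ∧ any Q xs
  any-∧ true Q xs = refl
  any-∧ false Q xs = any-false xs (λ _ → refl)

  notX : V3 → Set
  notX u = isX u ≡ false

  notX-==-x : ∀ w i → notX w → (w == x i) ≡ false
  notX-==-x (x _) i ()
  notX-==-x (cls _) i _ = refl
  notX-==-x z₁ i _ = refl
  notX-==-x w₁ i _ = refl
  notX-==-x zₐ i _ = refl
  notX-==-x wₐ i _ = refl
  notX-==-x (v _ _) i _ = refl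

  member-if : ∀ (b : Bool) w u → member u (if b then w ∷ [] else []) ≡ b ∧ (w == u)
  member-if true w u = ∨-identityʳ _
  member-if false w u = refl

  adjacentIn : List (V3 × V3) → V3 → V3 → Bool
  adjacentIn es u w = any (λ (q , r) → (q == u ∧ r == w) ∨ (q == w ∧ r == u)) es

  adjacentIn-++ : ∀ es fs u w → adjacentIn (es ++ fs) u w ≡ adjacentIn es u w ∨ adjacentIn fs u w
  adjacentIn-++ es fs u w = any-++ _ es fs

  count-xs : ∀ j n → count (x j) (map x (range1 n)) ≡ ind (inRange j n)
  count-xs j n = trans (ΣL-map _ x (range1 n)) (trans (ΣL-range1-single (λ i → ind (j ≡ᵇ i)) j h n)
     (trans (cong (λ z → ind (inRange j n) * ind z) (≡ᵇ-refl j)) (*-identityʳ _)))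
    where
    h : ∀ i → i ≢ j → ind (j ≡ᵇ i) ≡ 0
    h i ne rewrite ≡ᵇ-false j i (λ e → ne (sym e)) = refl

  count-clss : ∀ j n → count (cls j) (map cls (range1 n)) ≡ ind (inRange j n)
  count-clss j n = trans (ΣL-map _ cls (range1 n)) (trans (ΣL-range1-single (λ i → ind (j ≡ᵇ i)) j h n)
     (trans (cong (λ z → ind (inRange j n) * ind z) (≡ᵇ-refl j)) (*-identityʳ _)))
    where
    h : ∀ i → i ≢ j → ind (j ≡ᵇ i) ≡ 0
    h i ne rewrite ≡ᵇ-false j i (λ e → ne (sym e)) = refl

  count-notX-xs : ∀ w L → notX w → count w (map x L) ≡ 0
  count-notX-xs w L nw = trans (ΣL-map _ x L) (trans (ΣL-cong L (λ i → cong ind (trans (==-sym w (x i)) (nx==x' w i nw)))) (ΣL-zero L))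
    where
    nx==x' : ∀ w i → notX w → (x i == w) ≡ false
    nx==x' (x _) i ()
    nx==x' (cls _) i _ = refl
    nx==x' z₁ i _ = refl
    nx==x' w₁ i _ = refl
    nx==x' zₐ i _ = refl
    nx==x' wₐ i _ = refl
    nx==x' (v _ _) i _ = refl

  notCls : V3 → Set
  notCls (cls _) = ⊥
  notCls _ = ⊤

  count-notCls-clss : ∀ w L → notCls w → count w (map cls L) ≡ 0
  count-notCls-clss w L nw = trans (ΣL-map _ cls L) (trans (ΣL-cong L (λ i → cong ind (f w i nw))) (ΣL-zero L))
    where
    f : ∀ w i → notCls w → (w == cls i) ≡ false
    f (x _) i _ = refl
    f z₁ i _ = refl
    f w₁ i _ = refl
    f zₐ i _ = refl
    f wₐ i _ = refl
    f (v _ _) i _ = refl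

  fresh-x-notX : ∀ j L → All notX L → Fresh (x j) L
  fresh-x-notX j [] [] = refl
  fresh-x-notX j (w ∷ L) (nw ∷ ns) rewrite notX-==-x w j nw = fresh-x-notX j L ns

  weightedDegree : T3Data → (V3 → ℕ) → ℕ → ℕ
  weightedDegree D g i = ΣL (λ u → ind (adjacentIn (T3Data.edges D) (x i) u) * g u) (T3Data.verts D)

module LeafDistribution where

  open import Data.Nat
  open import Data.Nat.Properties
  open import Data.Nat.DivMod using (_/_; _%_; m≡m%n+[m/n]*n; m%n<n; m<n*o⇒m/o<n)
  open import Data.Bool using (Bool; true; false; _∧_; _∨_; T)
  open import Data.Bool.Properties using (∧-zeroʳ)
  open import Data.List using (List; []; _∷_; _++_; map; upTo)
  open import Data.List.Properties using (upTo-∷ʳ)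
  open import Data.Empty using (⊥-elim)
  open import Data.Product using (_×_; _,_)
  open import Data.Sum using (_⊎_; inj₁; inj₂)
  open import Relation.Nullary using (yes; no)
  open import Relation.Binary.PropositionalEquality
  open import Relation.Binary.Definitions using (tri<; tri≈; tri>)
  open import Data.Nat.Tactic.RingSolver using (solve-∀)
  open import Defs
  open DoubleCounting
  open Vertices

  countB-++ : {A : Set} (p : A → Bool) (xs ys : List A) → countB p (xs ++ ys) ≡ countB p xs + countB p ys
  countB-++ p xs ys = trans (countB≡ΣL p (xs ++ ys)) (trans (ΣL-++ _ xs ys) (sym (cong₂ _+_ (countB≡ΣL p xs) (countB≡ΣL p ys))))

  countB-map : {A B : Set} (p : B → Bool) (f : A → B) (xs : List A) → countB p (map f xs) ≡ countB (λ y → p (f y)) xs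
  countB-map p f xs = trans (countB≡ΣL p (map f xs)) (trans (ΣL-map _ f xs) (sym (countB≡ΣL _ xs)))

  countB-cong : {A : Set} {p q : A → Bool} (xs : List A) → (∀ y → p y ≡ q y) → countB p xs ≡ countB q xs
  countB-cong xs h = trans (countB≡ΣL _ xs) (trans (ΣL-cong xs (λ y → cong ind (h y))) (sym (countB≡ΣL _ xs)))

  countB-add : {A : Set} (P Q R : A → Bool) (xs : List A) → (∀ y → ind (P y) + ind (Q y) ≡ ind (R y)) →
    countB P xs + countB Q xs ≡ countB R xs
  countB-add P Q R xs h = trans (cong₂ _+_ (countB≡ΣL P xs) (countB≡ΣL Q xs))
    (trans (sym (ΣL-+ _ _ xs)) (trans (ΣL-cong xs h) (sym (countB≡ΣL R xs))))

  countB-upTo-suc : (Q : ℕ → Bool) (N : ℕ) → countB Q (upTo (suc N)) ≡ countB Q (upTo N) + ind (Q N)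
  countB-upTo-suc Q N = trans (cong (countB Q) (sym (upTo-∷ʳ N)))
    (trans (countB-++ Q (upTo N) (N ∷ [])) (cong (countB Q (upTo N) +_) (trans (countB≡ΣL Q (N ∷ [])) (+-identityʳ _))))

  Threshold : (Q : ℕ → Bool) → ℕ → ℕ → Set
  Threshold Q N C = (C ≤ N) × (∀ j → j < C → Q j ≡ true) × (C < N → Q C ≡ false)

  countB-threshold : (Q : ℕ → Bool) → (∀ i j → i ≤ j → Q j ≡ true → Q i ≡ true) → ∀ N → Threshold Q N (countB Q (upTo N))
  countB-threshold Q dc zero = z≤n , (λ j ()) , (λ ())
  countB-threshold Q dc (suc N) with countB-threshold Q dc N | Q N in eQ
  ... | (cle , call , cnext) | true =
    subst (Threshold Q (suc N)) (sym (trans (countB-upTo-suc Q N) (cong (λ z → countB Q (upTo N) + ind z) eQ)))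
      (subst (λ C → Threshold Q (suc N) (C + 1)) (sym CN) ((≤-reflexive (+-comm N 1)) ,
        (λ j j< → dc j N (≤-pred (subst (j <_) (+-comm N 1) j<)) eQ) ,
        (λ h → ⊥-elim (<-irrefl (+-comm N 1) h))))
    where
    CN : countB Q (upTo N) ≡ N
    CN with m≤n⇒m<n∨m≡n cle
    ... | inj₂ e = e
    ... | inj₁ lt = ⊥-elim (true≢false (trans (sym (dc _ N cle eQ)) (cnext lt)))
  ... | (cle , call , cnext) | false =
    subst (Threshold Q (suc N)) (sym (trans (countB-upTo-suc Q N) (trans (cong (λ z → countB Q (upTo N) + ind z) eQ) (+-identityʳ _))))
      (≤-trans cle (n≤1+n N) , call , nx)
    where
    nx : countB Q (upTo N) < suc N → Q (countB Q (upTo N)) ≡ false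
    nx h with m≤n⇒m<n∨m≡n (≤-pred h)
    ... | inj₁ lt = cnext lt
    ... | inj₂ e = trans (cong Q e) eQ

  +-swapʳ : ∀ m n o → m + n + o ≡ m + o + n
  +-swapʳ = solve-∀

  step-lower : ∀ X D z y a → z < X + a → X + D ≤ z + y → D < y + a
  step-lower X D z y a h1 h2 = +-cancelˡ-< z D (y + a) (begin-strict
      z + D <⟨ +-monoˡ-< D h1 ⟩
      X + a + D ≡⟨ +-swapʳ X a D ⟩
      X + D + a ≤⟨ +-monoˡ-≤ a h2 ⟩
      z + y + a ≡⟨ +-assoc z y a ⟩
      z + (y + a) ∎)
    where open ≤-Reasoning

  step-upper : ∀ X D z y a → X ≤ z → z + y < X + D + a → y < D + a
  step-upper X D z y a h1 h2 = +-cancelˡ-< z y (D + a) (begin-strict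
      z + y <⟨ h2 ⟩
      X + D + a ≤⟨ +-monoˡ-≤ a (+-monoˡ-≤ D h1) ⟩
      z + D + a ≡⟨ +-assoc z D a ⟩
      z + (D + a) ∎)
    where open ≤-Reasoning

  bracket-unique : ∀ a X P Q → 0 < a → X ≤ a * P → a * P < X + a → X ≤ a * Q → a * Q < X + a → P ≡ Q
  bracket-unique a X P Q a0 h1 h2 h3 h4 with <-cmp P Q
  ... | tri≈ _ e _ = e
  ... | tri< lt _ _ = ⊥-elim (<-irrefl refl (≤-<-trans (≤-trans (+-monoˡ-≤ a h1) (≤-trans (≤-reflexive (trans (+-comm (a * P) a) (sym (*-suc a P)))) (*-monoʳ-≤ a lt))) h4))
  ... | tri> _ _ gt = ⊥-elim (<-irrefl refl (≤-<-trans (≤-trans (+-monoˡ-≤ a h3) (≤-trans (≤-reflexive (trans (+-comm (a * Q) a) (sym (*-suc a Q)))) (*-monoʳ-≤ a gt))) h2))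

  /-<ᵇ : ∀ m n d → ((m / suc d) <ᵇ n) ≡ (m <ᵇ n * suc d)
  /-<ᵇ m n d with m <? n * suc d
  ... | yes lt = trans (<ᵇ-true (m<n*o⇒m/o<n {m} {n} {suc d} lt)) (sym (<ᵇ-true lt))
  ... | no nlt = trans (<ᵇ-false (λ q → nlt (back q))) (sym (<ᵇ-false nlt))
    where
    back : m / suc d < n → m < n * suc d
    back q = begin-strict
        m ≡⟨ m≡m%n+[m/n]*n m (suc d) ⟩
        m % suc d + (m / suc d) * suc d <⟨ +-monoˡ-< _ (m%n<n m (suc d)) ⟩
        suc d + (m / suc d) * suc d ≡⟨ refl ⟩
        suc (m / suc d) * suc d ≤⟨ *-monoˡ-≤ (suc d) q ⟩
        n * suc d ∎
      where open ≤-Reasoning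

  inRange-step : ∀ j n → ind (inRange j n) + ind (j ≡ᵇ suc n) ≡ ind (inRange j (suc n))
  inRange-step j n with j ≟ suc n
  ... | yes refl rewrite inRange-beyond n | inRange-self n | ≡ᵇ-refl n = refl
  ... | no ne rewrite ≡ᵇ-false j (suc n) ne | inRange-suc j n ne = +-identityʳ _

  module LeafCounts (a b' : ℕ) where
    c : ℕ → ℕ
    c = rootDeg a b'
    leavesUpTo : ℕ → ℕ
    leavesUpTo n = ΣL c (range1 n)

    leavesUpTo-suc : ∀ n → leavesUpTo (suc n) ≡ leavesUpTo n + c (suc n)
    leavesUpTo-suc n = ΣL-range1-suc c n

    leavesUpTo-count : ∀ n → leavesUpTo n ≡ countB (λ j → inRange j n) (leafIndices a b')
    leavesUpTo-count zero = sym (trans (countB-cong (leafIndices a b') (λ j → inRange-zero j)) (z (leafIndices a b')))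
      where
      z : (xs : List ℕ) → countB (λ _ → false) xs ≡ 0
      z [] = refl
      z (_ ∷ xs) = z xs
    leavesUpTo-count (suc n) = trans (leavesUpTo-suc n) (trans (cong (_+ c (suc n)) (leavesUpTo-count n))
      (countB-add (λ j → inRange j n) (λ j → j ≡ᵇ suc n) (λ j → inRange j (suc n)) (leafIndices a b') (λ j → inRange-step j n)))

    module WithGap (d : ℕ) (eD : b' ∸ a ≡ suc d) where
      D : ℕ
      D = suc d
      Below : ℕ → ℕ → Bool
      Below n j = j * a <ᵇ n * D
      slotsBelow : ℕ → ℕ
      slotsBelow n = countB (Below n) (upTo D)

      count-leafIndices : ∀ n → countB (λ j → inRange j n) (map (λ j → 1 + (j * a) // (b' ∸ a)) (upTo (b' ∸ a)) ++ (a ∷ []))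
                    ≡ slotsBelow n + ind (inRange a n)
      count-leafIndices n rewrite eD = trans (countB-++ (λ j → inRange j n) (map (λ j → 1 + (j * a) / suc d) (upTo (suc d))) (a ∷ []))
        (cong₂ _+_ (trans (countB-map (λ j → inRange j n) (λ j → 1 + (j * a) / suc d) (upTo (suc d))) (countB-cong (upTo (suc d)) (λ j → /-<ᵇ (j * a) n d)))
                   (trans (countB≡ΣL (λ j → inRange j n) (a ∷ [])) (+-identityʳ _)))

      leavesUpTo≡slots : ∀ n → leavesUpTo n ≡ slotsBelow n + ind (inRange a n)
      leavesUpTo≡slots n = trans (leavesUpTo-count n) (count-leafIndices n)

      Below-downward : ∀ n i j → i ≤ j → Below n j ≡ true → Below n i ≡ true
      Below-downward n i j le h = <ᵇ-true {i * a} {n * D} (≤-<-trans (*-monoˡ-≤ a le) (<ᵇ⇒< (j * a) (n * D) (subst T (sym h) _)))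

      slotsBelow-bounds : ∀ n → 1 ≤ n → n ≤ a → (n * D ≤ slotsBelow n * a) × (slotsBelow n * a < n * D + a)
      slotsBelow-bounds n n1 na with countB-threshold (Below n) (Below-downward n) D
      ... | (cle , call , cnext) = lower , upper
        where
        lower : n * D ≤ slotsBelow n * a
        lower with m≤n⇒m<n∨m≡n cle
        ... | inj₁ lt = ≮⇒≥ (λ q → true≢false (trans (sym (<ᵇ-true q)) (cnext lt)))
        ... | inj₂ e = subst (λ z → n * D ≤ z * a) (sym e) (≤-trans (*-monoˡ-≤ D na) (≤-reflexive (*-comm a D)))
        upper : slotsBelow n * a < n * D + a
        upper with slotsBelow n in ePP
        ... | zero = ⊥-elim (true≢false (trans (sym q0) (cnext (s≤s z≤n))))
          where
          q0 : Below n 0 ≡ true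
          q0 = <ᵇ-true (≤-trans (s≤s z≤n) (*-mono-≤ n1 (s≤s z≤n)))
        ... | suc r = begin-strict
            suc r * a ≡⟨ +-comm a (r * a) ⟩
            r * a + a <⟨ +-monoˡ-< a (<ᵇ⇒< _ _ (subst T (sym (call r ≤-refl)) _)) ⟩
            n * D + a ∎
          where
          open ≤-Reasoning

      leavesUpTo-bounds : ∀ n → 1 ≤ n → n < a → (n * D ≤ a * leavesUpTo n) × (a * leavesUpTo n < n * D + a)
      leavesUpTo-bounds n n1 na rewrite leavesUpTo≡slots n | ≤ᵇ-false {a} {n} (<⇒≱ na) | ∧-zeroʳ (1 ≤ᵇ a) | +-identityʳ (slotsBelow n) | *-comm a (slotsBelow n) =
        slotsBelow-bounds n n1 (<⇒≤ na)

      leavesUpTo-a : 1 ≤ a → leavesUpTo a ≡ D + 1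
      leavesUpTo-a a1 rewrite leavesUpTo≡slots a | ≤ᵇ-true {a} {a} ≤-refl | ≤ᵇ-true {1} {a} a1 with slotsBelow-bounds a a1 ≤-refl
      ... | (lo , up) = cong (_+ 1) (bracket-unique a (a * D) (slotsBelow a) D a1
                         (≤-trans lo (≤-reflexive (*-comm (slotsBelow a) a)))
                         (subst (_< a * D + a) (*-comm (slotsBelow a) a) up')
                         (≤-refl) (m<m+n (a * D) a1))
        where
        up' : slotsBelow a * a < a * D + a
        up' = up

      module Degrees (a2 : 2 ≤ a) (lo : a + 2 ≤ D) (hi : D ≤ 2 * a + 1) where
        a1 : 1 ≤ a
        a1 = ≤-trans (s≤s z≤n) a2

        cancel-a-< : ∀ t cc → t * a < a * cc → t < cc
        cancel-a-< t cc h = *-cancelˡ-< a t cc (subst (_< a * cc) (*-comm t a) h)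
        cancel-a-> : ∀ t cc → a * cc < t * a → cc < t
        cancel-a-> t cc h = *-cancelˡ-< a cc t (subst (a * cc <_) (*-comm t a) h)

        D+a<4a : D + a < 4 * a
        D+a<4a = begin-strict
            D + a ≤⟨ +-monoˡ-≤ a hi ⟩
            2 * a + 1 + a ≡⟨ 2a+1+a a ⟩
            3 * a + 1 <⟨ +-monoʳ-< (3 * a) a2 ⟩
            3 * a + a ≡⟨ 3a+a a ⟩
            4 * a ∎
          where
          open ≤-Reasoning
          2a+1+a : ∀ a → 2 * a + 1 + a ≡ 3 * a + 1
          2a+1+a = solve-∀
          3a+a : ∀ a → 3 * a + a ≡ 4 * a
          3a+a = solve-∀

        a<D : a < D
        a<D = <-≤-trans (m<m+n a {2} (s≤s z≤n)) lo

        2-or-3 : ∀ cc → 1 < cc → cc < 4 → (cc ≡ 2) ⊎ (cc ≡ 3)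
        2-or-3 zero () _
        2-or-3 (suc zero) (s≤s ()) _
        2-or-3 (suc (suc zero)) _ _ = inj₁ refl
        2-or-3 (suc (suc (suc zero))) _ _ = inj₂ refl
        2-or-3 (suc (suc (suc (suc cc)))) _ (s≤s (s≤s (s≤s (s≤s ()))))

        rootDeg-first : (c 1 ≡ 2) ⊎ (c 1 ≡ 3)
        rootDeg-first with leavesUpTo-bounds 1 ≤-refl a2
        ... | (l , u) = 2-or-3 (c 1)
            (cancel-a-< 1 (c 1) (subst (_< a * c 1) (sym (*-identityˡ a)) (<-≤-trans a<D (≤-trans (≤-reflexive (sym (+-identityʳ D))) (≤-trans l (≤-reflexive (cong (a *_) (+-identityʳ (c 1)))))))))
            (cancel-a-> 4 (c 1) (≤-<-trans (≤-reflexive (cong (a *_) (sym (+-identityʳ (c 1))))) (<-trans (subst (λ z → a * leavesUpTo 1 < z + a) (+-identityʳ D) u) D+a<4a)))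

        last-step-lower : ∀ X D' z y a' → z < X + a' → z + y ≡ X + D' + a' → D' < y
        last-step-lower X D' z y a' h e = +-cancelˡ-< (X + a') D' y (begin-strict
            X + a' + D' ≡⟨ +-swapʳ X a' D' ⟩
            X + D' + a' ≡⟨ sym e ⟩
            z + y <⟨ +-monoˡ-< y h ⟩
            X + a' + y ∎)
          where open ≤-Reasoning

        last-step-upper : ∀ X D' z y a' → X ≤ z → z + y ≡ X + D' + a' → y ≤ D' + a'
        last-step-upper X D' z y a' h e = +-cancelˡ-≤ X y (D' + a') (begin
            X + y ≤⟨ +-monoˡ-≤ y h ⟩
            z + y ≡⟨ e ⟩
            X + D' + a' ≡⟨ +-assoc X D' a' ⟩
            X + (D' + a') ∎)
          where open ≤-Reasoning

        rootDeg-last : (c a ≡ 2) ⊎ (c a ≡ 3)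
        rootDeg-last = go a a2 refl
          where
          go : ∀ n → 2 ≤ n → n ≡ a → (c n ≡ 2) ⊎ (c n ≡ 3)
          go (suc a') (s≤s a'1) refl with leavesUpTo-bounds a' a'1 ≤-refl
          ... | (l , u) = 2-or-3 (c (suc a'))
              (cancel-a-< 1 (c (suc a')) (subst (_< a * c (suc a')) (sym (*-identityˡ a)) (<-trans a<D (last-step-lower (a' * D) D (a * leavesUpTo a') (a * c (suc a')) a u eqn))))
              (cancel-a-> 4 (c (suc a')) (≤-<-trans (last-step-upper (a' * D) D (a * leavesUpTo a') (a * c (suc a')) a l eqn) D+a<4a))
            where
            eqn : a * leavesUpTo a' + a * c (suc a') ≡ a' * D + D + a
            eqn = trans (sym (*-distribˡ-+ a (leavesUpTo a') (c (suc a')))) (trans (cong (a *_) (trans (sym (leavesUpTo-suc a')) (leavesUpTo-a a1)))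
                    (lem a' D))
              where
              lem : ∀ a' D → suc a' * (D + 1) ≡ a' * D + D + suc a'
              lem = solve-∀

        leavesUpTo-D≡2a+1 : D ≡ 2 * a + 1 → ∀ n → 1 ≤ n → n < a → leavesUpTo n ≡ 2 * n + 1
        leavesUpTo-D≡2a+1 eD2 n n1 na with leavesUpTo-bounds n n1 na
        ... | (l , u) = bracket-unique a (n * D) (leavesUpTo n) (2 * n + 1) a1 l u
            (subst (_≤ a * (2 * n + 1)) (sym e1) (≤-trans (+-monoʳ-≤ (2 * n * a) (<⇒≤ na)) (≤-reflexive (sym (e3 n a)))))
            (subst (a * (2 * n + 1) <_) (sym (cong (_+ a) e1))
               (≤-trans (≤-reflexive (cong suc (trans (e3 n a) (+-comm (2 * n * a) a))))
                 (≤-trans (+-monoˡ-≤ (2 * n * a) (+-monoˡ-≤ a n1)) (≤-reflexive (lem5 n a (2 * n * a))))))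
          where
          lem5 : ∀ n a z → n + a + z ≡ z + n + a
          lem5 = solve-∀
          lem : ∀ n a → n * (2 * a + 1) ≡ 2 * n * a + n
          lem = solve-∀
          e1 : n * D ≡ 2 * n * a + n
          e1 = trans (cong (n *_) eD2) (lem n a)
          e3 : ∀ n a → a * (2 * n + 1) ≡ 2 * n * a + a
          e3 = solve-∀

        rootDeg-middle : ∀ q → 1 < q → q < a → (c q ≡ 1) ⊎ (c q ≡ 2)
        rootDeg-middle (suc q') (s≤s q'1) qa with leavesUpTo-bounds q' q'1 (<-trans (n<1+n q') qa) | leavesUpTo-bounds (suc q') (s≤s z≤n) qa
        ... | (l' , u') | (l , u) = result
          where
          eqz : a * leavesUpTo q' + a * c (suc q') ≡ a * leavesUpTo (suc q')
          eqz = trans (sym (*-distribˡ-+ a (leavesUpTo q') (c (suc q')))) (cong (a *_) (sym (leavesUpTo-suc q')))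
          low : D < a * c (suc q') + a
          low = step-lower (q' * D) D (a * leavesUpTo q') (a * c (suc q')) a u' (subst (q' * D + D ≤_) (sym eqz) (≤-trans (≤-reflexive (+-comm (q' * D) D)) l))
          up : a * c (suc q') < D + a
          up = step-upper (q' * D) D (a * leavesUpTo q') (a * c (suc q')) a l' (subst (_< q' * D + D + a) (sym eqz) (subst (a * leavesUpTo (suc q') <_) (cong (_+ a) (+-comm D (q' * D))) u))
          c≥1 : 1 ≤ c (suc q')
          c≥1 with c (suc q') in ec
          ... | zero = ⊥-elim (<-irrefl refl (<-trans a<D (subst (λ z → D < z + a) (*-zeroʳ a) (subst (λ z → D < a * z + a) ec low))))
          ... | suc _ = s≤s z≤n
          result : (c (suc q') ≡ 1) ⊎ (c (suc q') ≡ 2)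
          result with m≤n⇒m<n∨m≡n hi
          ... | inj₁ D≤2a = f (c (suc q')) c≥1 (cancel-a-> 3 (c (suc q')) (<-≤-trans up (≤-trans (+-monoˡ-≤ a (≤-pred (subst (D <_) (+-comm (2 * a) 1) D≤2a))) (≤-reflexive (lem3 a)))))
            where
            lem3 : ∀ a → 2 * a + a ≡ 3 * a
            lem3 = solve-∀
            f : ∀ cc → 1 ≤ cc → cc < 3 → (cc ≡ 1) ⊎ (cc ≡ 2)
            f (suc zero) _ _ = inj₁ refl
            f (suc (suc zero)) _ _ = inj₂ refl
            f (suc (suc (suc _))) _ (s≤s (s≤s (s≤s ())))
          ... | inj₂ D≡ = inj₂ (+-cancelˡ-≡ (leavesUpTo q') (c (suc q')) 2 (trans (sym (leavesUpTo-suc q'))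
               (trans (leavesUpTo-D≡2a+1 D≡ (suc q') (s≤s z≤n) qa) (trans (lem4 q') (cong (_+ 2) (sym (leavesUpTo-D≡2a+1 D≡ q' q'1 (<-trans (n<1+n q') qa))))))))
            where
            lem4 : ∀ q' → 2 * suc q' + 1 ≡ 2 * q' + 1 + 2
            lem4 = solve-∀

module BaseTree where

  open import Data.Nat
  open import Data.Nat.Properties
  open import Data.Bool using (Bool; true; false; _∧_; _∨_; if_then_else_)
  open import Data.Bool.Properties using (∨-identityʳ; ∧-zeroʳ; ∧-identityʳ)
  open import Data.List using (List; []; _∷_; _++_; map; concatMap)
  open import Data.List.Relation.Unary.All using (All; []; _∷_)
  open import Data.Bool.ListAction using (any)
  open import Data.Product using (_×_; _,_)
  open import Data.Sum using (inj₁; inj₂)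
  open import Relation.Binary.PropositionalEquality
  open import Defs
  open DoubleCounting
  open Vertices

  module BaseIndices (a b' : ℕ) where
    open T3Base a b' public

    p-suc : ∀ n → p (suc n) ≡ p n + ind (2 ≤ᵇ c (suc n))
    p-suc n = trans (countB≡ΣL _ (range1 (suc n))) (trans (ΣL-range1-suc _ n) (cong (_+ ind (2 ≤ᵇ c (suc n))) (sym (countB≡ΣL _ (range1 n)))))

    p-mono : ∀ n n' → n ≤ n' → p n ≤ p n'
    p-mono n n' le with m≤n⇒m<n∨m≡n le
    ... | inj₂ refl = ≤-refl
    ... | inj₁ lt = go n' n lt
      where
      go : ∀ n' n → n < n' → p n ≤ p n'
      go (suc n') n (s≤s le') = ≤-trans (p-mono n n' le') (≤-trans (m≤m+n (p n') _) (≤-reflexive (sym (p-suc n'))))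

    module EndClasses (c1≥2 : 2 ≤ c 1) (ca≥2 : 2 ≤ c a) (a≥2 : 2 ≤ a) where
      p1 : p 1 ≡ 1
      p1 = trans (p-suc 0) (cong ind (≤ᵇ-true c1≥2))

      p≥1 : ∀ n → 1 ≤ n → 1 ≤ p n
      p≥1 n n1 = ≤-trans (≤-reflexive (sym p1)) (p-mono 1 n n1)

      a' : ℕ
      a' = a ∸ 1
      a≡' : suc a' ≡ a
      a≡' = m+[n∸m]≡n {1} {a} (≤-trans (s≤s z≤n) a≥2)

      m≡ : m ≡ p a' + 1
      m≡ = trans (cong p (sym a≡')) (trans (p-suc a') (cong (p a' +_) (cong ind (≤ᵇ-true (subst (λ z → 2 ≤ c z) (sym a≡') ca≥2)))))

      a'≥1 : 1 ≤ a'
      a'≥1 = ≤-pred (subst (2 ≤_) (sym a≡') a≥2)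

      m≥2 : 2 ≤ m
      m≥2 = subst (2 ≤_) (sym m≡) (≤-trans (s≤s (p≥1 a' a'≥1)) (≤-reflexive (+-comm 1 (p a'))))

      p<m : ∀ q → q < a → p q < m
      p<m q qa = subst (p q <_) (sym m≡) (≤-trans (s≤s (p-mono q a' (≤-pred (subst (q <_) (sym a≡') qa)))) (≤-reflexive (+-comm 1 (p a'))))

      p≥2 : ∀ q → 1 < q → 2 ≤ c q → 2 ≤ p q
      p≥2 (suc q') (s≤s q'1) cq = subst (2 ≤_) (sym (p-suc q'))
        (≤-trans (+-mono-≤ (p≥1 q' q'1) (≤-reflexive (sym (cong ind (≤ᵇ-true cq))))) ≤-refl)

  module BaseAdjacency (a b' : ℕ) where
    open BaseIndices a b'

    pathEdges : List (V3 × V3)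
    pathEdges = map (λ i → (x i , x (suc i))) (range1 (a ∸ 1))
    rootEdges : List (V3 × V3)
    rootEdges = concatMap (λ i → map (λ u → (x i , u)) (nbrs i)) (range1 a)
    endEdge₁ endEdgeₐ : V3 × V3
    endEdge₁ = if three₁ then (z₁ , w₁) else (cls 0 , cls 1)
    endEdgeₐ = if threeₐ then (zₐ , wₐ) else (cls (m ∸ 1) , cls m)

    pathNbrs : ℕ → List V3
    pathNbrs i = (if inRange i (a ∸ 1) then x (suc i) ∷ [] else []) ++ (if inRange (i ∸ 1) (a ∸ 1) then x (i ∸ 1) ∷ [] else [])

    nbrs-notX : ∀ i → All notX (nbrs i)
    nbrs-notX i with i ≡ᵇ 1 | i ≡ᵇ a | three₁ | threeₐ | c i ≡ᵇ 1
    ... | true | _ | true | _ | _ = refl ∷ refl ∷ refl ∷ []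
    ... | true | _ | false | _ | _ = refl ∷ refl ∷ []
    ... | false | true | _ | true | _ = refl ∷ refl ∷ refl ∷ []
    ... | false | true | _ | false | _ = refl ∷ refl ∷ []
    ... | false | false | _ | _ | true = refl ∷ []
    ... | false | false | _ | _ | false = refl ∷ refl ∷ []

    adjacent-path : ∀ i' u → adjacentIn pathEdges (x (suc i')) u ≡ member u (pathNbrs (suc i'))
    adjacent-path i' u = begin
        adjacentIn pathEdges (x (suc i')) u
      ≡⟨ any-map _ (λ i → (x i , x (suc i))) (range1 (a ∸ 1)) ⟩
        any (λ j → F1 j ∨ F2 j) (range1 (a ∸ 1))
      ≡⟨ any-∨ F1 F2 (range1 (a ∸ 1)) ⟩
        any F1 (range1 (a ∸ 1)) ∨ any F2 (range1 (a ∸ 1))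
      ≡⟨ cong₂ _∨_ (any-range1-single F1 (suc i') h1 (a ∸ 1)) (any-range1-single F2 i' h2 (a ∸ 1)) ⟩
        (inRange (suc i') (a ∸ 1) ∧ F1 (suc i')) ∨ (inRange i' (a ∸ 1) ∧ F2 i')
      ≡⟨ cong₂ (λ z1 z2 → (inRange (suc i') (a ∸ 1) ∧ z1) ∨ (inRange i' (a ∸ 1) ∧ z2))
           (cong (_∧ (x (suc (suc i')) == u)) (≡ᵇ-refl i'))
           (trans (cong ((x i' == u) ∧_) (≡ᵇ-refl i')) (∧-identityʳ _)) ⟩
        (inRange (suc i') (a ∸ 1) ∧ (x (suc (suc i')) == u)) ∨ (inRange i' (a ∸ 1) ∧ (x i' == u))
      ≡⟨ sym (trans (any-++ _ (if inRange (suc i') (a ∸ 1) then x (suc (suc i')) ∷ [] else []) _)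
           (cong₂ _∨_ (member-if (inRange (suc i') (a ∸ 1)) (x (suc (suc i'))) u) (member-if (inRange i' (a ∸ 1)) (x i') u))) ⟩
        member u (pathNbrs (suc i'))
      ∎
      where
      open ≡-Reasoning
      F1 F2 : ℕ → Bool
      F1 j = (j ≡ᵇ suc i') ∧ (x (suc j) == u)
      F2 j = (x j == u) ∧ (j ≡ᵇ i')
      h1 : ∀ j → j ≢ suc i' → F1 j ≡ false
      h1 j ne rewrite ≡ᵇ-false j (suc i') ne = refl
      h2 : ∀ j → j ≢ i' → F2 j ≡ false
      h2 j ne rewrite ≡ᵇ-false j i' ne = ∧-zeroʳ _

    adjacent-roots : ∀ i u → inRange i a ≡ true → adjacentIn rootEdges (x i) u ≡ member u (nbrs i)
    adjacent-roots i u hi = begin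
        adjacentIn rootEdges (x i) u
      ≡⟨ any-concatMap _ (λ j → map (λ w → (x j , w)) (nbrs j)) (range1 a) ⟩
        any (λ j → any P (map (λ w → (x j , w)) (nbrs j))) (range1 a)
      ≡⟨ any-cong (range1 a) inner ⟩
        any F (range1 a)
      ≡⟨ any-range1-single F i hF a ⟩
        inRange i a ∧ ((i ≡ᵇ i) ∧ member u (nbrs i))
      ≡⟨ cong₂ (λ z1 z2 → z1 ∧ (z2 ∧ member u (nbrs i))) hi (≡ᵇ-refl i) ⟩
        member u (nbrs i)
      ∎
      where
      open ≡-Reasoning
      P : V3 × V3 → Bool
      P = λ (q , r) → (q == x i ∧ r == u) ∨ (q == u ∧ r == x i)
      F : ℕ → Bool
      F j = (j ≡ᵇ i) ∧ member u (nbrs j)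
      inner : ∀ j → any P (map (λ w → (x j , w)) (nbrs j)) ≡ F j
      inner j = trans (any-map P (λ w → (x j , w)) (nbrs j))
        (trans (any-congAll (allmap (nbrs j) (nbrs-notX j))) (any-∧ (j ≡ᵇ i) (λ w → w == u) (nbrs j)))
        where
        allmap : (L : List V3) → All notX L → All (λ w → P (x j , w) ≡ ((j ≡ᵇ i) ∧ (w == u))) L
        allmap [] [] = []
        allmap (w ∷ L) (nw ∷ ns) = (trans (cong (λ z → ((j ≡ᵇ i) ∧ (w == u)) ∨ ((x j == u) ∧ z)) (notX-==-x w i nw))
                                    (trans (cong (((j ≡ᵇ i) ∧ (w == u)) ∨_) (∧-zeroʳ _)) (∨-identityʳ _))) ∷ allmap L ns
      hF : ∀ j → j ≢ i → F j ≡ false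
      hF j ne rewrite ≡ᵇ-false j i ne = refl

    adjacent-endEdge₁ : ∀ i u → adjacentIn (endEdge₁ ∷ []) (x i) u ≡ false
    adjacent-endEdge₁ i u with three₁
    ... | true = trans (∨-identityʳ _) (∧-zeroʳ _)
    ... | false = trans (∨-identityʳ _) (∧-zeroʳ _)
    adjacent-endEdgeₐ : ∀ i u → adjacentIn (endEdgeₐ ∷ []) (x i) u ≡ false
    adjacent-endEdgeₐ i u with threeₐ
    ... | true = trans (∨-identityʳ _) (∧-zeroʳ _)
    ... | false = trans (∨-identityʳ _) (∧-zeroʳ _)

    nbrsOf : ℕ → List V3
    nbrsOf i = pathNbrs i ++ nbrs i

    adjacent-x-nbrsOf : ∀ i' u → inRange (suc i') a ≡ true → adjacentIn (T3Data.edges data3) (x (suc i')) u ≡ member u (nbrsOf (suc i'))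
    adjacent-x-nbrsOf i' u hi = begin
        adjacentIn (pathEdges ++ rootEdges ++ (endEdge₁ ∷ []) ++ (endEdgeₐ ∷ [])) (x (suc i')) u
      ≡⟨ adjacentIn-++ pathEdges _ _ u ⟩
        adjacentIn pathEdges (x (suc i')) u ∨ adjacentIn (rootEdges ++ (endEdge₁ ∷ []) ++ (endEdgeₐ ∷ [])) (x (suc i')) u
      ≡⟨ cong (adjacentIn pathEdges (x (suc i')) u ∨_) (trans (adjacentIn-++ rootEdges _ _ u) (cong (adjacentIn rootEdges (x (suc i')) u ∨_) (adjacentIn-++ (endEdge₁ ∷ []) (endEdgeₐ ∷ []) _ u))) ⟩
        adjacentIn pathEdges (x (suc i')) u ∨ (adjacentIn rootEdges (x (suc i')) u ∨ (adjacentIn (endEdge₁ ∷ []) (x (suc i')) u ∨ adjacentIn (endEdgeₐ ∷ []) (x (suc i')) u))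
      ≡⟨ cong₂ (λ z1 z2 → z1 ∨ z2) (adjacent-path i' u) (cong₂ _∨_ (adjacent-roots (suc i') u hi) (cong₂ _∨_ (adjacent-endEdge₁ (suc i') u) (adjacent-endEdgeₐ (suc i') u))) ⟩
        member u (pathNbrs (suc i')) ∨ (member u (nbrs (suc i')) ∨ false)
      ≡⟨ cong (member u (pathNbrs (suc i')) ∨_) (∨-identityʳ _) ⟩
        member u (pathNbrs (suc i')) ∨ member u (nbrs (suc i'))
      ≡⟨ sym (any-++ _ (pathNbrs (suc i')) (nbrs (suc i'))) ⟩
        member u (nbrsOf (suc i'))
      ∎
      where open ≡-Reasoning

module BaseNeighbourhoods where

  open import Data.Nat
  open import Data.Nat.Properties
  open import Data.Bool using (Bool; true; false; _∧_; _∨_; if_then_else_)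
  open import Data.Bool.Properties using (∨-identityʳ)
  open import Data.List using (List; []; _∷_; _++_; map)
  open import Data.List.Relation.Unary.All using (All; []; _∷_)
  open import Data.Unit using (tt)
  open import Data.Product using (_×_; _,_)
  open import Relation.Binary.PropositionalEquality
  open import Data.Nat.Tactic.RingSolver using (solve-∀)
  open import Defs
  open DoubleCounting
  open Vertices
  open BaseTree

  -- Tt2Con.size, with the two blown-up roots as parameters.
  blowUpSize : V3 → V3 → ℕ → V3 → ℕ
  blowUpSize s₁ sₐ k u = if isX u ∨ (u == s₁) ∨ (u == sₐ) then k else 1

  special₁ : Bool → V3
  special₁ b = if b then z₁ else cls 0
  specialₐ : Bool → ℕ → V3
  specialₐ b m = if b then wₐ else cls m
  ends₁ : Bool → List V3
  ends₁ b = if b then z₁ ∷ w₁ ∷ [] else cls 0 ∷ []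
  endsₐ : Bool → ℕ → List V3
  endsₐ b m = if b then zₐ ∷ wₐ ∷ [] else cls m ∷ []

  ∸1< : ∀ m → 1 ≤ m → m ∸ 1 < m
  ∸1< (suc m) _ = n<1+n m

  module Neighbourhoods (a k m : ℕ) (a≥2 : 2 ≤ a) (m≥2 : 2 ≤ m) where
    baseVerts : Bool → Bool → List V3
    baseVerts b₁ bₐ = map x (range1 a) ++ ends₁ b₁ ++ map cls (range1 (m ∸ 1)) ++ endsₐ bₐ m
    weight : Bool → Bool → V3 → ℕ
    weight b₁ bₐ = blowUpSize (special₁ b₁) (specialₐ bₐ m) k

    count-baseVerts : ∀ w b₁ bₐ → count w (baseVerts b₁ bₐ) ≡ count w (map x (range1 a)) + (count w (ends₁ b₁) + (count w (map cls (range1 (m ∸ 1))) + count w (endsₐ bₐ m)))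
    count-baseVerts w b₁ bₐ = trans (ΣL-++ _ (map x (range1 a)) _) (cong (count w (map x (range1 a)) +_)
      (trans (ΣL-++ _ (ends₁ b₁) _) (cong (count w (ends₁ b₁) +_) (ΣL-++ _ (map cls (range1 (m ∸ 1))) (endsₐ bₐ m)))))

    m≢0 : m ≢ 0
    m≢0 e = <-irrefl (sym e) (≤-trans (s≤s z≤n) m≥2)

    count-x : ∀ b₁ bₐ j → inRange j a ≡ true → count (x j) (baseVerts b₁ bₐ) ≡ 1
    count-x b₁ bₐ j h = trans (count-baseVerts (x j) b₁ bₐ) (cong₂ _+_ (trans (count-xs j a) (cong ind h))
      (cong₂ _+_ (r1 b₁) (cong₂ _+_ (count-notCls-clss (x j) (range1 (m ∸ 1)) tt) (r2 bₐ))))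
      where
      r1 : ∀ b → count (x j) (ends₁ b) ≡ 0
      r1 true = refl
      r1 false = refl
      r2 : ∀ b → count (x j) (endsₐ b m) ≡ 0
      r2 true = refl
      r2 false = refl

    count-cls-middle : ∀ b₁ bₐ j → 1 ≤ j → j < m → (count (cls j) (baseVerts b₁ bₐ) ≡ 1) × (weight b₁ bₐ (cls j) ≡ 1)
    count-cls-middle b₁ bₐ j j1 jm = trans (count-baseVerts (cls j) b₁ bₐ) (cong₂ _+_ (count-notX-xs (cls j) (range1 a) refl)
        (cong₂ _+_ (r1 b₁) (cong₂ _+_ (trans (count-clss j (m ∸ 1)) (cong ind inr)) (r2 bₐ)))) ,
      trans (cong (λ z → if z then k else 1) (cong₂ _∨_ (s1 b₁) (s2 bₐ))) refl
      where
      j≢0 : (j ≡ᵇ 0) ≡ false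
      j≢0 = ≡ᵇ-false j 0 (λ e → <-irrefl (sym e) j1)
      j≢m : (j ≡ᵇ m) ≡ false
      j≢m = ≡ᵇ-false j m (λ e → <-irrefl e jm)
      r1 : ∀ b → count (cls j) (ends₁ b) ≡ 0
      r1 true = refl
      r1 false rewrite j≢0 = refl
      r2 : ∀ b → count (cls j) (endsₐ b m) ≡ 0
      r2 true = refl
      r2 false rewrite j≢m = refl
      inr : inRange j (m ∸ 1) ≡ true
      inr = cong₂ _∧_ (≤ᵇ-true j1) (≤ᵇ-true (≤-pred (≤-trans jm (≤-reflexive (sym (m+[n∸m]≡n {1} {m} (≤-trans (s≤s z≤n) m≥2)))))))
        where open import Data.Bool.Properties using (∧-idem)
      s1 : ∀ b → (cls j == special₁ b) ≡ false
      s1 true = refl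
      s1 false = j≢0
      s2 : ∀ b → (cls j == specialₐ b m) ≡ false
      s2 true = refl
      s2 false = j≢m

    count-cls-0 : ∀ bₐ → (count (cls 0) (baseVerts false bₐ) ≡ 1) × (weight false bₐ (cls 0) ≡ k)
    count-cls-0 bₐ = trans (count-baseVerts (cls 0) false bₐ) (cong₂ _+_ (count-notX-xs (cls 0) (range1 a) refl)
        (cong (1 +_) (cong₂ _+_ (count-clss 0 (m ∸ 1)) (r2 bₐ)))) , refl
      where
      r2 : ∀ b → count (cls 0) (endsₐ b m) ≡ 0
      r2 true = refl
      r2 false rewrite ≡ᵇ-false 0 m (λ e → m≢0 (sym e)) = refl

    count-cls-m : ∀ b₁ → (count (cls m) (baseVerts b₁ false) ≡ 1) × (weight b₁ false (cls m) ≡ k)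
    count-cls-m b₁ = trans (count-baseVerts (cls m) b₁ false) (cong₂ _+_ (count-notX-xs (cls m) (range1 a) refl)
        (trans (cong₂ _+_ (r1 b₁) (cong₂ _+_ (trans (count-clss m (m ∸ 1)) (cong ind inr)) (cong (λ z → ind z + 0) (≡ᵇ-refl m)))) refl)) ,
      trans (cong (λ z → if z then k else 1) (cong (_∨ (m ≡ᵇ m)) (s1 b₁))) (cong (λ z → if z then k else 1) (≡ᵇ-refl m))
      where
      r1 : ∀ b → count (cls m) (ends₁ b) ≡ 0
      r1 true = refl
      r1 false rewrite ≡ᵇ-false m 0 m≢0 = refl
      inr : inRange m (m ∸ 1) ≡ false
      inr = trans (cong (_∧ (m ≤ᵇ m ∸ 1)) (≤ᵇ-true (≤-trans (s≤s z≤n) m≥2))) (≤ᵇ-false (λ q → <-irrefl refl (≤-<-trans q (∸1< m (≤-trans (s≤s z≤n) m≥2)))))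
      s1 : ∀ b → (cls m == special₁ b) ≡ false
      s1 true = refl
      s1 false = ≡ᵇ-false m 0 m≢0

    count-z₁ : ∀ bₐ → (count z₁ (baseVerts true bₐ) ≡ 1) × (weight true bₐ z₁ ≡ k)
    count-z₁ bₐ = trans (count-baseVerts z₁ true bₐ) (cong₂ _+_ (count-notX-xs z₁ (range1 a) refl) (cong (1 +_) (cong₂ _+_ (count-notCls-clss z₁ (range1 (m ∸ 1)) tt) (r2 bₐ)))) , refl
      where
      r2 : ∀ b → count z₁ (endsₐ b m) ≡ 0
      r2 true = refl
      r2 false = refl

    count-w₁ : ∀ bₐ → (count w₁ (baseVerts true bₐ) ≡ 1) × (weight true bₐ w₁ ≡ 1)
    count-w₁ bₐ = trans (count-baseVerts w₁ true bₐ) (cong₂ _+_ (count-notX-xs w₁ (range1 a) refl) (cong (1 +_) (cong₂ _+_ (count-notCls-clss w₁ (range1 (m ∸ 1)) tt) (r2 bₐ)))) , s bₐ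
      where
      r2 : ∀ b → count w₁ (endsₐ b m) ≡ 0
      r2 true = refl
      r2 false = refl
      s : ∀ b → weight true b w₁ ≡ 1
      s true = refl
      s false = refl

    count-zₐ : ∀ b₁ → (count zₐ (baseVerts b₁ true) ≡ 1) × (weight b₁ true zₐ ≡ 1)
    count-zₐ b₁ = trans (count-baseVerts zₐ b₁ true) (cong₂ _+_ (count-notX-xs zₐ (range1 a) refl) (trans (cong₂ _+_ (r1 b₁) (cong₂ _+_ (count-notCls-clss zₐ (range1 (m ∸ 1)) tt) refl)) refl)) , s b₁
      where
      r1 : ∀ b → count zₐ (ends₁ b) ≡ 0
      r1 true = refl
      r1 false = refl
      s : ∀ b → weight b true zₐ ≡ 1
      s true = refl
      s false = refl

    count-wₐ : ∀ b₁ → (count wₐ (baseVerts b₁ true) ≡ 1) × (weight b₁ true wₐ ≡ k)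
    count-wₐ b₁ = trans (count-baseVerts wₐ b₁ true) (cong₂ _+_ (count-notX-xs wₐ (range1 a) refl) (trans (cong₂ _+_ (r1 b₁) (cong₂ _+_ (count-notCls-clss wₐ (range1 (m ∸ 1)) tt) refl)) refl)) , s b₁
      where
      r1 : ∀ b → count wₐ (ends₁ b) ≡ 0
      r1 true = refl
      r1 false = refl
      s : ∀ b → weight b true wₐ ≡ k
      s true = refl
      s false = refl

    weighted : Bool → Bool → List V3 → ℕ
    weighted b₁ bₐ L = ΣL (λ w → count w (baseVerts b₁ bₐ) * weight b₁ bₐ w) L

    count×weight : ∀ b₁ bₐ w s → (count w (baseVerts b₁ bₐ) ≡ 1) × (weight b₁ bₐ w ≡ s) → count w (baseVerts b₁ bₐ) * weight b₁ bₐ w ≡ s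
    count×weight b₁ bₐ w s (h1 , h2) rewrite h1 | h2 = +-identityʳ s

    count×weight-x : ∀ b₁ bₐ j → inRange j a ≡ true → count (x j) (baseVerts b₁ bₐ) * weight b₁ bₐ (x j) ≡ k
    count×weight-x b₁ bₐ j h = count×weight b₁ bₐ (x j) k (count-x b₁ bₐ j h , refl)

    weighted-nbrs₁ : ∀ b₁ bₐ → weighted b₁ bₐ (x 2 ∷ (if b₁ then z₁ ∷ w₁ ∷ cls 1 ∷ [] else cls 0 ∷ cls 1 ∷ [])) + 1 ≡ 2 * k + (if b₁ then 3 else 2)
    weighted-nbrs₁ true bₐ = trans (cong (_+ 1) (cong₂ _+_ (count×weight-x true bₐ 2 (inRange-intro (s≤s z≤n) a≥2))
        (cong₂ _+_ (count×weight true bₐ z₁ k (count-z₁ bₐ)) (cong₂ _+_ (count×weight true bₐ w₁ 1 (count-w₁ bₐ))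
          (cong₂ _+_ (count×weight true bₐ (cls 1) 1 (count-cls-middle true bₐ 1 ≤-refl m≥2)) refl))))) (l k)
      where
      l : ∀ k → k + (k + (1 + (1 + 0))) + 1 ≡ 2 * k + 3
      l = solve-∀
    weighted-nbrs₁ false bₐ = trans (cong (_+ 1) (cong₂ _+_ (count×weight-x false bₐ 2 (inRange-intro (s≤s z≤n) a≥2))
        (cong₂ _+_ (count×weight false bₐ (cls 0) k (count-cls-0 bₐ))
          (cong₂ _+_ (count×weight false bₐ (cls 1) 1 (count-cls-middle false bₐ 1 ≤-refl m≥2)) refl)))) (l k)
      where
      l : ∀ k → k + (k + (1 + 0)) + 1 ≡ 2 * k + 2
      l = solve-∀

    m-1≥1 : 1 ≤ m ∸ 1
    m-1≥1 = ≤-pred (≤-trans m≥2 (≤-reflexive (sym (m+[n∸m]≡n {1} {m} (≤-trans (s≤s z≤n) m≥2)))))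
    m-m≥2 : m ∸ 1 < m
    m-m≥2 = ∸1< m (≤-trans (s≤s z≤n) m≥2)
    a-1-inRange : inRange (a ∸ 1) a ≡ true
    a-1-inRange = inRange-intro (≤-pred (≤-trans a≥2 (≤-reflexive (sym (m+[n∸m]≡n {1} {a} (≤-trans (s≤s z≤n) a≥2)))))) (m∸n≤m a 1)

    weighted-nbrsₐ : ∀ b₁ bₐ → weighted b₁ bₐ (x (a ∸ 1) ∷ (if bₐ then zₐ ∷ wₐ ∷ cls (m ∸ 1) ∷ [] else cls (m ∸ 1) ∷ cls m ∷ [])) + 1 ≡ 2 * k + (if bₐ then 3 else 2)
    weighted-nbrsₐ b₁ true = trans (cong (_+ 1) (cong₂ _+_ (count×weight-x b₁ true (a ∸ 1) a-1-inRange)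
        (cong₂ _+_ (count×weight b₁ true zₐ 1 (count-zₐ b₁)) (cong₂ _+_ (count×weight b₁ true wₐ k (count-wₐ b₁))
          (cong₂ _+_ (count×weight b₁ true (cls (m ∸ 1)) 1 (count-cls-middle b₁ true (m ∸ 1) m-1≥1 m-m≥2)) refl))))) (l k)
      where
      l : ∀ k → k + (1 + (k + (1 + 0))) + 1 ≡ 2 * k + 3
      l = solve-∀
    weighted-nbrsₐ b₁ false = trans (cong (_+ 1) (cong₂ _+_ (count×weight-x b₁ false (a ∸ 1) a-1-inRange)
        (cong₂ _+_ (count×weight b₁ false (cls (m ∸ 1)) 1 (count-cls-middle b₁ false (m ∸ 1) m-1≥1 m-m≥2))
          (cong₂ _+_ (count×weight b₁ false (cls m) k (count-cls-m b₁)) refl)))) (l k)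
      where
      l : ∀ k → k + (1 + (k + 0)) + 1 ≡ 2 * k + 2
      l = solve-∀

    weighted-nbrs-middle : ∀ b₁ bₐ i q (cc : Bool) → 2 ≤ i → i < a → 1 ≤ q → q < m → (cc ≡ false → 2 ≤ q) →
       weighted b₁ bₐ (x (suc i) ∷ x (i ∸ 1) ∷ (if cc then cls q ∷ [] else cls (q ∸ 1) ∷ cls q ∷ [])) ≡ 2 * k + (if cc then 1 else 2)
    weighted-nbrs-middle b₁ bₐ i q true i2 ia q1 qm _ = trans (cong₂ _+_ (count×weight-x b₁ bₐ (suc i) (inRange-intro (s≤s z≤n) ia))
        (cong₂ _+_ (count×weight-x b₁ bₐ (i ∸ 1) ii1) (cong₂ _+_ (count×weight b₁ bₐ (cls q) 1 (count-cls-middle b₁ bₐ q q1 qm)) refl))) (l k)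
      where
      ii1 : inRange (i ∸ 1) a ≡ true
      ii1 = inRange-intro (≤-pred (≤-trans i2 (≤-reflexive (sym (m+[n∸m]≡n {1} {i} (≤-trans (s≤s z≤n) i2)))))) (≤-trans (m∸n≤m i 1) (<⇒≤ ia))
      l : ∀ k → k + (k + (1 + 0)) ≡ 2 * k + 1
      l = solve-∀
    weighted-nbrs-middle b₁ bₐ i q false i2 ia q1 qm h = trans (cong₂ _+_ (count×weight-x b₁ bₐ (suc i) (inRange-intro (s≤s z≤n) ia))
        (cong₂ _+_ (count×weight-x b₁ bₐ (i ∸ 1) ii1) (cong₂ _+_ (count×weight b₁ bₐ (cls (q ∸ 1)) 1 (count-cls-middle b₁ bₐ (q ∸ 1) q-1 (≤-trans (s≤s (m∸n≤m q 1)) qm)))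
          (cong₂ _+_ (count×weight b₁ bₐ (cls q) 1 (count-cls-middle b₁ bₐ q q1 qm)) refl)))) (l k)
      where
      ii1 : inRange (i ∸ 1) a ≡ true
      ii1 = inRange-intro (≤-pred (≤-trans i2 (≤-reflexive (sym (m+[n∸m]≡n {1} {i} (≤-trans (s≤s z≤n) i2)))))) (≤-trans (m∸n≤m i 1) (<⇒≤ ia))
      q-1 : 1 ≤ q ∸ 1
      q-1 = ≤-pred (≤-trans (h refl) (≤-reflexive (sym (m+[n∸m]≡n {1} {q} q1))))
      l : ∀ k → k + (k + (1 + (1 + 0))) ≡ 2 * k + 2
      l = solve-∀

    rootNbrs₁ : Bool → List V3
    rootNbrs₁ b₁ = if b₁ then z₁ ∷ w₁ ∷ cls 1 ∷ [] else cls 0 ∷ cls 1 ∷ []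
    rootNbrsₐ : Bool → List V3
    rootNbrsₐ bₐ = if bₐ then zₐ ∷ wₐ ∷ cls (m ∸ 1) ∷ [] else cls (m ∸ 1) ∷ cls m ∷ []
    rootNbrs-middle : ℕ → Bool → List V3
    rootNbrs-middle q cc = if cc then cls q ∷ [] else cls (q ∸ 1) ∷ cls q ∷ []

    rootNbrs₁-notX : ∀ b → All notX (rootNbrs₁ b)
    rootNbrs₁-notX true = refl ∷ refl ∷ refl ∷ []
    rootNbrs₁-notX false = refl ∷ refl ∷ []
    rootNbrsₐ-notX : ∀ b → All notX (rootNbrsₐ b)
    rootNbrsₐ-notX true = refl ∷ refl ∷ refl ∷ []
    rootNbrsₐ-notX false = refl ∷ refl ∷ []
    rootNbrs-middle-notX : ∀ q b → All notX (rootNbrs-middle q b)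
    rootNbrs-middle-notX q true = refl ∷ []
    rootNbrs-middle-notX q false = refl ∷ refl ∷ []

    pathCount : List V3 → ℕ
    pathCount L = ΣL (λ w → count w (map x (range1 a)) * 1) L

    pathCount-notX : ∀ L → All notX L → pathCount L ≡ 0
    pathCount-notX [] [] = refl
    pathCount-notX (w ∷ L) (nw ∷ ns) = cong₂ _+_ (cong (_* 1) (count-notX-xs w (range1 a) nw)) (pathCount-notX L ns)

    pathCount-x : ∀ j → inRange j a ≡ true → count (x j) (map x (range1 a)) * 1 ≡ 1
    pathCount-x j h = trans (*-identityʳ _) (trans (count-xs j a) (cong ind h))

    pathCount-nbrs₁ : ∀ b₁ → pathCount (x 2 ∷ rootNbrs₁ b₁) ≡ 1
    pathCount-nbrs₁ b₁ = cong₂ _+_ (pathCount-x 2 (inRange-intro (s≤s z≤n) a≥2)) (pathCount-notX (rootNbrs₁ b₁) (rootNbrs₁-notX b₁))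
    pathCount-nbrsₐ : ∀ bₐ → pathCount (x (a ∸ 1) ∷ rootNbrsₐ bₐ) ≡ 1
    pathCount-nbrsₐ bₐ = cong₂ _+_ (pathCount-x (a ∸ 1) a-1-inRange) (pathCount-notX (rootNbrsₐ bₐ) (rootNbrsₐ-notX bₐ))
    pathCount-nbrs-middle : ∀ i q cc → 2 ≤ i → i < a → pathCount (x (suc i) ∷ x (i ∸ 1) ∷ rootNbrs-middle q cc) ≡ 2
    pathCount-nbrs-middle i q cc i2 ia = cong₂ _+_ (pathCount-x (suc i) (inRange-intro (s≤s z≤n) ia)) (cong₂ _+_ (pathCount-x (i ∸ 1) ii1) (pathCount-notX (rootNbrs-middle q cc) (rootNbrs-middle-notX q cc)))
      where
      ii1 : inRange (i ∸ 1) a ≡ true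
      ii1 = inRange-intro (≤-pred (≤-trans i2 (≤-reflexive (sym (m+[n∸m]≡n {1} {i} (≤-trans (s≤s z≤n) i2)))))) (≤-trans (m∸n≤m i 1) (<⇒≤ ia))

    nbrs₁-distinct : ∀ b₁ → AllDistinct (x 2 ∷ rootNbrs₁ b₁)
    nbrs₁-distinct true = fresh-x-notX 2 _ (rootNbrs₁-notX true) , (refl , (refl , (refl , tt)))
    nbrs₁-distinct false = fresh-x-notX 2 _ (rootNbrs₁-notX false) , (refl , (refl , tt))
    nbrsₐ-distinct : ∀ bₐ → AllDistinct (x (a ∸ 1) ∷ rootNbrsₐ bₐ)
    nbrsₐ-distinct true = fresh-x-notX (a ∸ 1) _ (rootNbrsₐ-notX true) , (refl , (refl , (refl , tt)))
    nbrsₐ-distinct false = fresh-x-notX (a ∸ 1) _ (rootNbrsₐ-notX false) , (trans (∨-identityʳ _) (≡ᵇ-false m (m ∸ 1) (λ e → <-irrefl (sym e) m-m≥2)) , (refl , tt))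
    nbrs-middle-distinct : ∀ i q cc → 1 ≤ q → AllDistinct (x (suc i) ∷ x (i ∸ 1) ∷ rootNbrs-middle q cc)
    nbrs-middle-distinct i q cc q1 = trans (cong (_∨ member (x (suc i)) (rootNbrs-middle q cc)) (≡ᵇ-false (i ∸ 1) (suc i) (λ e → <-irrefl e (s≤s (m∸n≤m i 1)))))
                        (fresh-x-notX (suc i) _ (rootNbrs-middle-notX q cc)) ,
                      (fresh-x-notX (i ∸ 1) _ (rootNbrs-middle-notX q cc) , d cc)
      where
      d : ∀ cc → AllDistinct (rootNbrs-middle q cc)
      d true = refl , tt
      d false = trans (∨-identityʳ _) (≡ᵇ-false q (q ∸ 1) (λ e → <-irrefl (sym e) (∸1< q q1))) , (refl , tt)

    nbrs₁-irrefl : ∀ b₁ → member (x 1) (x 2 ∷ rootNbrs₁ b₁) ≡ false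
    nbrs₁-irrefl b₁ = fresh-x-notX 1 (rootNbrs₁ b₁) (rootNbrs₁-notX b₁)
    nbrsₐ-irrefl : ∀ bₐ → member (x a) (x (a ∸ 1) ∷ rootNbrsₐ bₐ) ≡ false
    nbrsₐ-irrefl bₐ = trans (cong (_∨ member (x a) (rootNbrsₐ bₐ)) (≡ᵇ-false (a ∸ 1) a (λ e → <-irrefl e (∸1< a (≤-trans (s≤s z≤n) a≥2)))))
                (fresh-x-notX a (rootNbrsₐ bₐ) (rootNbrsₐ-notX bₐ))
    nbrs-middle-irrefl : ∀ i q cc → 1 ≤ i → member (x i) (x (suc i) ∷ x (i ∸ 1) ∷ rootNbrs-middle q cc) ≡ false
    nbrs-middle-irrefl i q cc i1 = trans (cong (_∨ ((i ∸ 1 ≡ᵇ i) ∨ member (x i) (rootNbrs-middle q cc))) (≡ᵇ-false (suc i) i (λ e → <-irrefl (sym e) ≤-refl)))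
      (trans (cong (_∨ member (x i) (rootNbrs-middle q cc)) (≡ᵇ-false (i ∸ 1) i (λ e → <-irrefl e (∸1< i i1))))
        (fresh-x-notX i (rootNbrs-middle q cc) (rootNbrs-middle-notX q cc)))

    next-index : ∀ i j → ind (suc i ≡ᵇ j) ≤ ind (j ≡ᵇ suc i)
    next-index i j = ≤-reflexive (cong ind (≡ᵇ-sym (suc i) j))
    prev-index : ∀ i j → 1 ≤ i → ind (i ∸ 1 ≡ᵇ j) ≤ ind (i ≡ᵇ suc j)
    prev-index (suc i) j _ = ≤-reflexive (cong ind (refl {x = i ≡ᵇ j}))

    nbrs₁-path-bound : ∀ b₁ j → ind (member (x j) (x 2 ∷ rootNbrs₁ b₁)) ≤ ind (j ≡ᵇ 2) + ind (1 ≡ᵇ suc j)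
    nbrs₁-path-bound b₁ j rewrite fresh-x-notX j (rootNbrs₁ b₁) (rootNbrs₁-notX b₁) | ∨-identityʳ (2 ≡ᵇ j) = ≤-trans (next-index 1 j) (m≤m+n _ _)
    nbrsₐ-path-bound : ∀ bₐ j → ind (member (x j) (x (a ∸ 1) ∷ rootNbrsₐ bₐ)) ≤ ind (j ≡ᵇ suc a) + ind (a ≡ᵇ suc j)
    nbrsₐ-path-bound bₐ j rewrite fresh-x-notX j (rootNbrsₐ bₐ) (rootNbrsₐ-notX bₐ) | ∨-identityʳ (a ∸ 1 ≡ᵇ j) = ≤-trans (prev-index a j (≤-trans (s≤s z≤n) a≥2)) (m≤n+m _ _)
    nbrs-middle-path-bound : ∀ i q cc j → 1 ≤ i → ind (member (x j) (x (suc i) ∷ x (i ∸ 1) ∷ rootNbrs-middle q cc)) ≤ ind (j ≡ᵇ suc i) + ind (i ≡ᵇ suc j)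
    nbrs-middle-path-bound i q cc j i1 rewrite fresh-x-notX j (rootNbrs-middle q cc) (rootNbrs-middle-notX q cc) | ∨-identityʳ (i ∸ 1 ≡ᵇ j) =
      ≤-trans (ind-∨-≤ (suc i ≡ᵇ j) (i ∸ 1 ≡ᵇ j)) (+-mono-≤ (next-index i j) (prev-index i j i1))

module BaseDegrees where

  open import Data.Nat
  open import Data.Nat.Properties
  open import Data.Bool using (Bool; true; false; _∧_; _∨_; if_then_else_)
  open import Data.Bool.Properties using (∧-zeroʳ)
  open import Data.List using (List; []; _∷_; _++_; map)
  open import Data.Empty using (⊥-elim)
  open import Data.Product using (_×_; _,_)
  open import Data.Sum using (_⊎_; inj₁; inj₂)
  open import Relation.Binary.PropositionalEquality
  open import Defs
  open DoubleCounting
  open Vertices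
  open BaseTree
  open BaseNeighbourhoods

  if-true-++ : {A : Set} (β : Bool) (L R : List A) → β ≡ true → (if β then L else []) ++ R ≡ L ++ R
  if-true-++ true L R _ = refl
  if-true : {A : Set} (β : Bool) (L : List A) → β ≡ true → (if β then L else []) ≡ L
  if-true true L _ = refl

  if-false-++ : {A : Set} (β : Bool) (L R : List A) → β ≡ false → (if β then L else []) ++ R ≡ R
  if-false-++ false L R _ = refl

  module Degrees (a b' k : ℕ) (a≥2 : 2 ≤ a)
    (rootDeg-first : (rootDeg a b' 1 ≡ 2) ⊎ (rootDeg a b' 1 ≡ 3))
    (rootDeg-last : (rootDeg a b' a ≡ 2) ⊎ (rootDeg a b' a ≡ 3))
    (rootDeg-middle : ∀ q → 1 < q → q < a → (rootDeg a b' q ≡ 1) ⊎ (rootDeg a b' q ≡ 2)) where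

    open BaseIndices a b'
    open BaseAdjacency a b'

    2⊎3⇒2≤ : ∀ {cc} → (cc ≡ 2) ⊎ (cc ≡ 3) → 2 ≤ cc
    2⊎3⇒2≤ (inj₁ refl) = ≤-refl
    2⊎3⇒2≤ (inj₂ refl) = s≤s (s≤s z≤n)

    open EndClasses (2⊎3⇒2≤ rootDeg-first) (2⊎3⇒2≤ rootDeg-last) a≥2

    open Neighbourhoods a k m a≥2 m≥2

    baseVerts′ : List V3
    baseVerts′ = T3Data.verts data3
    baseEdges : List (V3 × V3)
    baseEdges = T3Data.edges data3
    baseWeight : V3 → ℕ
    baseWeight = weight three₁ threeₐ

    baseDegree : ℕ → ℕ
    baseDegree = weightedDegree data3 baseWeight
    basePathDegree : ℕ → ℕ
    basePathDegree i = ΣL (λ i' → ind (adjacentIn baseEdges (x i) (x i'))) (range1 a)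

    a-1≥1 : 1 ≤ a ∸ 1
    a-1≥1 = ≤-pred (≤-trans a≥2 (≤-reflexive (sym (m+[n∸m]≡n {1} {a} (≤-trans (s≤s z≤n) a≥2)))))

    nbrsOf-first : nbrsOf 1 ≡ x 2 ∷ rootNbrs₁ three₁
    nbrsOf-first = cong (_++ nbrs 1) (if-true-++ (inRange 1 (a ∸ 1)) (x 2 ∷ []) [] (inRange-intro ≤-refl a-1≥1))

    nbrsOf-last : nbrsOf a ≡ x (a ∸ 1) ∷ rootNbrsₐ threeₐ
    nbrsOf-last = trans (cong (_++ nbrs a) (trans (if-false-++ (inRange a (a ∸ 1)) (x (suc a) ∷ []) _ ina)
                 (if-true (inRange (a ∸ 1) (a ∸ 1)) (x (a ∸ 1) ∷ []) (inRange-intro a-1≥1 ≤-refl))))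
                (cong (x (a ∸ 1) ∷_) nbrsA)
      where
      ina : inRange a (a ∸ 1) ≡ false
      ina = trans (cong ((1 ≤ᵇ a) ∧_) (≤ᵇ-false (λ q → <-irrefl refl (≤-<-trans q (∸1< a (≤-trans (s≤s z≤n) a≥2)))))) (∧-zeroʳ _)
      nbrsA : nbrs a ≡ rootNbrsₐ threeₐ
      nbrsA rewrite ≡ᵇ-false a 1 (λ e → <-irrefl (sym e) a≥2) | ≡ᵇ-refl a = refl

    nbrsOf-middle : ∀ i → 1 < i → i < a → nbrsOf i ≡ x (suc i) ∷ x (i ∸ 1) ∷ rootNbrs-middle (p i) (c i ≡ᵇ 1)
    nbrsOf-middle i i1 ia = trans (cong (_++ nbrs i) (trans (if-true-++ (inRange i (a ∸ 1)) (x (suc i) ∷ []) _ (inRange-intro (≤-trans (s≤s z≤n) i1) (≤-pred (≤-trans ia (≤-reflexive (sym (m+[n∸m]≡n {1} {a} (≤-trans (s≤s z≤n) a≥2))))))))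
                     (cong (x (suc i) ∷_) (trans (if-true (inRange (i ∸ 1) (a ∸ 1)) (x (i ∸ 1) ∷ []) (inRange-intro (≤-pred (≤-trans i1 (≤-reflexive (sym (m+[n∸m]≡n {1} {i} (≤-trans (s≤s z≤n) (<⇒≤ i1))))))) (∸-monoˡ-≤ 1 (<⇒≤ ia)))) refl))))
                  (cong (λ z → x (suc i) ∷ x (i ∸ 1) ∷ z) nbrsM)
      where
      nbrsM : nbrs i ≡ rootNbrs-middle (p i) (c i ≡ᵇ 1)
      nbrsM rewrite ≡ᵇ-false i 1 (λ e → <-irrefl (sym e) i1) | ≡ᵇ-false i a (λ e → <-irrefl e ia) = refl

    first-last-or-middle : ∀ i → 1 ≤ i → i ≤ a → (i ≡ 1) ⊎ ((i ≡ a) ⊎ ((1 < i) × (i < a)))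
    first-last-or-middle i i1 ia with m≤n⇒m<n∨m≡n i1 | m≤n⇒m<n∨m≡n ia
    ... | inj₂ e | _ = inj₁ (sym e)
    ... | inj₁ _ | inj₂ e = inj₂ (inj₁ e)
    ... | inj₁ l1 | inj₁ l2 = inj₂ (inj₂ (l1 , l2))

    adjacent-x : ∀ i → 1 ≤ i → i ≤ a → ∀ u → adjacentIn baseEdges (x i) u ≡ member u (nbrsOf i)
    adjacent-x (suc i') _ ia u = adjacent-x-nbrsOf i' u (inRange-intro (s≤s z≤n) ia)

    nbrsOf-distinct : ∀ i → 1 ≤ i → i ≤ a → AllDistinct (nbrsOf i)
    nbrsOf-distinct i i1 ia with first-last-or-middle i i1 ia
    ... | inj₁ refl = subst AllDistinct (sym nbrsOf-first) (nbrs₁-distinct three₁)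
    ... | inj₂ (inj₁ refl) = subst AllDistinct (sym nbrsOf-last) (nbrsₐ-distinct threeₐ)
    ... | inj₂ (inj₂ (l1 , l2)) = subst AllDistinct (sym (nbrsOf-middle i l1 l2)) (nbrs-middle-distinct i (p i) (c i ≡ᵇ 1) (p≥1 i i1))

    baseDegree-nbrs : ∀ i → 1 ≤ i → i ≤ a → baseDegree i ≡ weighted three₁ threeₐ (nbrsOf i)
    baseDegree-nbrs i i1 ia = trans (ΣL-cong baseVerts′ (λ u → cong (λ z → ind z * baseWeight u) (adjacent-x i i1 ia u)))
                          (ΣL-member baseVerts′ (nbrsOf i) baseWeight (nbrsOf-distinct i i1 ia))

    if-≡ᵇ3 : ∀ n → (n ≡ 2) ⊎ (n ≡ 3) → (if (n ≡ᵇ 3) then 3 else 2) ≡ n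
    if-≡ᵇ3 .2 (inj₁ refl) = refl
    if-≡ᵇ3 .3 (inj₂ refl) = refl

    baseDegree-first : baseDegree 1 + 1 ≡ 2 * k + c 1
    baseDegree-first = trans (cong (_+ 1) (trans (baseDegree-nbrs 1 ≤-refl (≤-trans (s≤s z≤n) a≥2)) (cong (weighted three₁ threeₐ) nbrsOf-first)))
            (trans (weighted-nbrs₁ three₁ threeₐ) (cong (2 * k +_) (if-≡ᵇ3 (c 1) rootDeg-first)))

    baseDegree-last : baseDegree a + 1 ≡ 2 * k + c a
    baseDegree-last = trans (cong (_+ 1) (trans (baseDegree-nbrs a (≤-trans (s≤s z≤n) a≥2) ≤-refl) (cong (weighted three₁ threeₐ) nbrsOf-last)))
            (trans (weighted-nbrsₐ three₁ threeₐ) (cong (2 * k +_) (if-≡ᵇ3 (c a) rootDeg-last)))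

    if-≡ᵇ1 : ∀ n → (n ≡ 1) ⊎ (n ≡ 2) → (if (n ≡ᵇ 1) then 1 else 2) ≡ n
    if-≡ᵇ1 .1 (inj₁ refl) = refl
    if-≡ᵇ1 .2 (inj₂ refl) = refl

    baseDegree-middle : ∀ i → 1 < i → i < a → baseDegree i ≡ 2 * k + c i
    baseDegree-middle i i1 ia = trans (trans (baseDegree-nbrs i (≤-trans (s≤s z≤n) (<⇒≤ i1)) (<⇒≤ ia)) (cong (weighted three₁ threeₐ) (nbrsOf-middle i i1 ia)))
      (trans (weighted-nbrs-middle three₁ threeₐ i (p i) (c i ≡ᵇ 1) i1 ia (p≥1 i (≤-trans (s≤s z≤n) (<⇒≤ i1))) (p<m i ia) h2)
        (cong (2 * k +_) (if-≡ᵇ1 (c i) (rootDeg-middle i i1 ia))))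
      where
      h2 : (c i ≡ᵇ 1) ≡ false → 2 ≤ p i
      h2 e = p≥2 i i1 (f (rootDeg-middle i i1 ia))
        where
        f : (c i ≡ 1) ⊎ (c i ≡ 2) → 2 ≤ c i
        f (inj₁ endEdge₁) = ⊥-elim (true≢false (trans (sym (cong (_≡ᵇ 1) endEdge₁)) e))
        f (inj₂ endEdgeₐ) = ≤-reflexive (sym endEdgeₐ)

    basePathDegree-nbrs : ∀ i → 1 ≤ i → i ≤ a → basePathDegree i ≡ pathCount (nbrsOf i)
    basePathDegree-nbrs i i1 ia = trans (ΣL-cong (range1 a) (λ i' → trans (cong ind (adjacent-x i i1 ia (x i'))) (sym (*-identityʳ _))))
      (trans (sym (ΣL-map (λ u → ind (member u (nbrsOf i)) * 1) x (range1 a))) (ΣL-member (map x (range1 a)) (nbrsOf i) (λ _ → 1) (nbrsOf-distinct i i1 ia)))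

    basePathDegree-first : basePathDegree 1 ≡ 1
    basePathDegree-first = trans (basePathDegree-nbrs 1 ≤-refl (≤-trans (s≤s z≤n) a≥2)) (trans (cong pathCount nbrsOf-first) (pathCount-nbrs₁ three₁))
    basePathDegree-last : basePathDegree a ≡ 1
    basePathDegree-last = trans (basePathDegree-nbrs a (≤-trans (s≤s z≤n) a≥2) ≤-refl) (trans (cong pathCount nbrsOf-last) (pathCount-nbrsₐ threeₐ))
    basePathDegree-middle : ∀ i → 1 < i → i < a → basePathDegree i ≡ 2
    basePathDegree-middle i i1 ia = trans (basePathDegree-nbrs i (≤-trans (s≤s z≤n) (<⇒≤ i1)) (<⇒≤ ia)) (trans (cong pathCount (nbrsOf-middle i i1 ia)) (pathCount-nbrs-middle i (p i) (c i ≡ᵇ 1) i1 ia))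

    base-irrefl : ∀ i → 1 ≤ i → i ≤ a → adjacentIn baseEdges (x i) (x i) ≡ false
    base-irrefl i i1 ia with first-last-or-middle i i1 ia
    ... | inj₁ refl = trans (adjacent-x 1 i1 ia (x 1)) (trans (cong (member (x 1)) nbrsOf-first) (nbrs₁-irrefl three₁))
    ... | inj₂ (inj₁ refl) = trans (adjacent-x a i1 ia (x a)) (trans (cong (member (x a)) nbrsOf-last) (nbrsₐ-irrefl threeₐ))
    ... | inj₂ (inj₂ (l1 , l2)) = trans (adjacent-x i i1 ia (x i)) (trans (cong (member (x i)) (nbrsOf-middle i l1 l2)) (nbrs-middle-irrefl i (p i) (c i ≡ᵇ 1) i1))

    base-path-bound : ∀ i i' → 1 ≤ i → i ≤ a → ind (adjacentIn baseEdges (x i) (x i')) ≤ ind (i' ≡ᵇ suc i) + ind (i ≡ᵇ suc i')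
    base-path-bound i i' i1 ia with first-last-or-middle i i1 ia
    ... | inj₁ refl = subst (_≤ _) (sym (cong ind (trans (adjacent-x 1 i1 ia (x i')) (cong (member (x i')) nbrsOf-first)))) (nbrs₁-path-bound three₁ i')
    ... | inj₂ (inj₁ refl) = subst (_≤ _) (sym (cong ind (trans (adjacent-x a i1 ia (x i')) (cong (member (x i')) nbrsOf-last)))) (nbrsₐ-path-bound threeₐ i')
    ... | inj₂ (inj₂ (l1 , l2)) = subst (_≤ _) (sym (cong ind (trans (adjacent-x i i1 ia (x i')) (cong (member (x i')) (nbrsOf-middle i l1 l2))))) (nbrs-middle-path-bound i (p i) (c i ≡ᵇ 1) i' i1)

module Recursion where

  open import Data.Nat
  open import Data.Nat.Properties
  open import Data.Nat.DivMod using (_/_)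
  open import Data.Bool using (Bool; true; false; _∧_; _∨_; if_then_else_)
  open import Data.Bool.Properties using (∨-identityʳ; ∨-zeroʳ; ∧-zeroʳ)
  open import Data.List using (List; []; _∷_; _++_; map; concatMap)
  open import Data.List.Properties using (++-assoc)
  open import Data.List.Relation.Unary.All as All using (All; []; _∷_; universal)
  open import Data.List.Relation.Unary.All.Properties using (++⁺; map⁺; concat⁺)
  open import Data.Bool.ListAction using (any)
  open import Data.Product using (_×_; _,_; proj₁; proj₂; Σ)
  open import Data.Sum using (_⊎_; inj₁; inj₂)
  open import Relation.Binary.PropositionalEquality
  open import Data.Nat.Tactic.RingSolver using (solve-∀)
  open import Defs
  open DoubleCounting
  open Vertices
  open BaseTree

  -- The vertices v r j are created at the step of the recursion handling
  -- parameter r; all other vertices belong to the base tree, level 0.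
  level : V3 → ℕ
  level (v r _) = r
  level _ = 0

  LevelAtMost : ℕ → V3 → Set
  LevelAtMost b u = level u ≤ b

  EdgeLevelAtMost : ℕ → V3 × V3 → Set
  EdgeLevelAtMost b (q , r) = LevelAtMost b q × LevelAtMost b r

  ΣL-congAll : {A : Set} {f g : A → ℕ} {L : List A} {P : A → Set} → All P L → (∀ y → P y → f y ≡ g y) → ΣL f L ≡ ΣL g L
  ΣL-congAll [] h = refl
  ΣL-congAll (p ∷ ps) h = cong₂ _+_ (h _ p) (ΣL-congAll ps h)

  any-falseAll : {A : Set} {P : A → Bool} {L : List A} {Q : A → Set} → All Q L → (∀ y → Q y → P y ≡ false) → any P L ≡ false
  any-falseAll [] h = refl
  any-falseAll (p ∷ ps) h rewrite h _ p = any-falseAll ps h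

  module BaseLevels (a b′ : ℕ) where
    open BaseIndices a b′

    nbrs-level : ∀ i → All (LevelAtMost 0) (nbrs i)
    nbrs-level i with i ≡ᵇ 1 | i ≡ᵇ a | three₁ | threeₐ | c i ≡ᵇ 1
    ... | true | _ | true | _ | _ = z≤n ∷ z≤n ∷ z≤n ∷ []
    ... | true | _ | false | _ | _ = z≤n ∷ z≤n ∷ []
    ... | false | true | _ | true | _ = z≤n ∷ z≤n ∷ z≤n ∷ []
    ... | false | true | _ | false | _ = z≤n ∷ z≤n ∷ []
    ... | false | false | _ | _ | true = z≤n ∷ []
    ... | false | false | _ | _ | false = z≤n ∷ z≤n ∷ []

    verts-level : All (LevelAtMost 0) (T3Data.verts data3)
    verts-level = ++⁺ (map⁺ (universal (λ _ → z≤n) (range1 a)))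
      (++⁺ ends₁ (++⁺ (map⁺ (universal (λ _ → z≤n) (range1 (m ∸ 1)))) endsₐ))
      where
      ends₁ : All (LevelAtMost 0) (if three₁ then z₁ ∷ w₁ ∷ [] else cls 0 ∷ [])
      ends₁ with three₁
      ... | true = z≤n ∷ z≤n ∷ []
      ... | false = z≤n ∷ []
      endsₐ : All (LevelAtMost 0) (if threeₐ then zₐ ∷ wₐ ∷ [] else cls m ∷ [])
      endsₐ with threeₐ
      ... | true = z≤n ∷ z≤n ∷ []
      ... | false = z≤n ∷ []

    edges-level : All (EdgeLevelAtMost 0) (T3Data.edges data3)
    edges-level = ++⁺ (map⁺ (universal (λ _ → z≤n , z≤n) (range1 (a ∸ 1))))
      (++⁺ (concat⁺ (map⁺ (universal (λ i → map⁺ (All.map (z≤n ,_) (nbrs-level i))) (range1 a))))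
        (++⁺ edge₁ edgeₐ))
      where
      edge₁ : All (EdgeLevelAtMost 0) ((if three₁ then (z₁ , w₁) else (cls 0 , cls 1)) ∷ [])
      edge₁ with three₁
      ... | true = (z≤n , z≤n) ∷ []
      ... | false = (z≤n , z≤n) ∷ []
      edgeₐ : All (EdgeLevelAtMost 0) ((if threeₐ then (zₐ , wₐ) else (cls (m ∸ 1) , cls m)) ∷ [])
      edgeₐ with threeₐ
      ... | true = (z≤n , z≤n) ∷ []
      ... | false = (z≤n , z≤n) ∷ []

  odd≢even : ∀ p q → suc (p + p) ≢ q + q
  odd≢even p zero ()
  odd≢even zero (suc q) e with trans (suc-injective e) (+-suc q q)
  ... | ()
  odd≢even (suc p) (suc q) e = odd≢even p q (suc-injective
    (trans (sym (cong suc (+-suc p p))) (trans (suc-injective e) (+-suc q q))))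

  2*≡+ : ∀ n → 2 * n ≡ n + n
  2*≡+ n = cong (n +_) (+-identityʳ n)

  -- x i is joined to v_t for t = ⌈i/2⌉.
  ceilHalf : ∀ i → 1 ≤ i → Σ ℕ (λ t → (1 ≤ t) × ((i ≡ 2 * t ∸ 1) ⊎ (i ≡ 2 * t)))
  ceilHalf (suc zero) _ = 1 , (s≤s z≤n , inj₁ refl)
  ceilHalf (suc (suc zero)) _ = 1 , (s≤s z≤n , inj₂ refl)
  ceilHalf (suc (suc (suc i))) _ with ceilHalf (suc i) (s≤s z≤n)
  ... | t , (t1 , inj₁ e) = suc t , (s≤s z≤n , inj₁ (trans (cong (λ z → suc (suc z)) e) (lem t t1)))
    where
    lem : ∀ t → 1 ≤ t → suc (suc (2 * t ∸ 1)) ≡ 2 * suc t ∸ 1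
    lem (suc t) _ = cong suc (sym (+-suc t (suc t + 0)))
  ... | t , (t1 , inj₂ e) = suc t , (s≤s z≤n , inj₂ (trans (cong (λ z → suc (suc z)) e) (lem t)))
    where
    lem : ∀ t → suc (suc (2 * t)) ≡ 2 * suc t
    lem t = cong suc (sym (+-suc t (t + 0)))

  2*∸1-injective : ∀ j t → 1 ≤ t → 2 * j ∸ 1 ≡ 2 * t ∸ 1 → j ≡ t
  2*∸1-injective zero (suc t) _ e rewrite +-identityʳ t | +-suc t t with e
  ... | ()
  2*∸1-injective (suc j) (suc t) _ e rewrite +-identityʳ j | +-identityʳ t | +-suc j j | +-suc t t =
    cong suc (*-cancelˡ-≡ j t 2 (trans (2*≡+ j) (trans (suc-injective e) (sym (2*≡+ t)))))

  2*≢2*∸1 : ∀ j t → 1 ≤ t → 2 * j ≢ 2 * t ∸ 1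
  2*≢2*∸1 j (suc t) _ e rewrite +-identityʳ t | +-suc t t | 2*≡+ j = odd≢even t j (sym e)

  2*∸1≢2* : ∀ j t → 1 ≤ t → 2 * j ∸ 1 ≢ 2 * t
  2*∸1≢2* zero (suc t) _ ()
  2*∸1≢2* (suc j) t _ e rewrite +-identityʳ j | +-suc j j | 2*≡+ t = odd≢even j t e

  layer-∨-edges : ∀ A J B → ((A ∧ (true ∧ J)) ∨ false) ∨ (((true ∧ J) ∧ B) ∨ false) ≡ J ∧ (A ∨ B)
  layer-∨-edges true true true = refl
  layer-∨-edges true true false = refl
  layer-∨-edges true false B = refl
  layer-∨-edges false true true = refl
  layer-∨-edges false true false = refl
  layer-∨-edges false false B = refl

  layer-≢-older : ∀ b u r j → LevelAtMost r u → r < b → (v b j == u) ≡ false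
  layer-≢-older b (x _) r j _ _ = refl
  layer-≢-older b (cls _) r j _ _ = refl
  layer-≢-older b z₁ r j _ _ = refl
  layer-≢-older b w₁ r j _ _ = refl
  layer-≢-older b zₐ r j _ _ = refl
  layer-≢-older b wₐ r j _ _ = refl
  layer-≢-older b (v r′ j′) r j le lt rewrite ≡ᵇ-false b r′ (λ e → <-irrefl (sym e) (≤-<-trans le lt)) = refl

  -- One step b ↦ b − a of the recursion defining T₃(a,b): the layer of new
  -- roots v_1, …, v_{a/2}, v_j joined to x_{2j−1} and x_{2j}.
  module Layers (a : ℕ) (1≤a : 1 ≤ a) (a≡2*h : a ≡ 2 * (a / 2)) where
    layerVerts : ℕ → List V3
    layerVerts b = map (v b) (range1 (a / 2))
    layerEdges : ℕ → List (V3 × V3)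
    layerEdges b = concatMap (λ i → (x (2 * i ∸ 1) , v b i) ∷ (v b i , x (2 * i)) ∷ []) (range1 (a / 2))

    addLayer : T3Data → ℕ → T3Data
    addLayer D b = record { verts = T3Data.verts D ++ layerVerts b ; edges = T3Data.edges D ++ layerEdges b
                          ; spec₁ = T3Data.spec₁ D ; specₐ = T3Data.specₐ D }

    layerEdges-older : ∀ b i u r → LevelAtMost r u → r < b → adjacentIn (layerEdges b) (x i) u ≡ false
    layerEdges-older b i u r lu lt = trans (any-concatMap _ _ (range1 (a / 2))) (any-false (range1 (a / 2)) pt)
      where
      pt : ∀ j → adjacentIn ((x (2 * j ∸ 1) , v b j) ∷ (v b j , x (2 * j)) ∷ []) (x i) u ≡ false
      pt j rewrite layer-≢-older b u r j lu lt | ∧-zeroʳ (2 * j ∸ 1 ≡ᵇ i) | ∧-zeroʳ (x (2 * j ∸ 1) == u) = refl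

    olderEdges-layer : ∀ (E : List (V3 × V3)) r b i j → All (EdgeLevelAtMost r) E → r < b → adjacentIn E (x i) (v b j) ≡ false
    olderEdges-layer E r b i j al lt = any-falseAll al pt
      where
      pt : ∀ e → EdgeLevelAtMost r e → ((proj₁ e == x i) ∧ (proj₂ e == v b j)) ∨ ((proj₁ e == v b j) ∧ (proj₂ e == x i)) ≡ false
      pt (q , q′) (lq , lq′) rewrite trans (==-sym q′ (v b j)) (layer-≢-older b q′ r j lq′ lt)
                                   | trans (==-sym q (v b j)) (layer-≢-older b q r j lq lt)
                                   | ∧-zeroʳ (q == x i) = refl

    layerEdges-x-v : ∀ b i j → adjacentIn (layerEdges b) (x i) (v b j) ≡ inRange j (a / 2) ∧ ((2 * j ∸ 1 ≡ᵇ i) ∨ (2 * j ≡ᵇ i))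
    layerEdges-x-v b i j = trans (any-concatMap _ _ (range1 (a / 2)))
      (trans (any-cong (range1 (a / 2)) (λ j′ → trans (cong (λ z → ((((2 * j′ ∸ 1) ≡ᵇ i) ∧ (z ∧ (j′ ≡ᵇ j))) ∨ false) ∨ (((z ∧ (j′ ≡ᵇ j)) ∧ (2 * j′ ≡ᵇ i)) ∨ false)) (≡ᵇ-refl b))
                                                   (layer-∨-edges (2 * j′ ∸ 1 ≡ᵇ i) (j′ ≡ᵇ j) (2 * j′ ≡ᵇ i))))
      (trans (any-range1-single (λ j′ → (j′ ≡ᵇ j) ∧ G j′) j (λ j′ ne → cong (_∧ G j′) (≡ᵇ-false j′ j ne)) (a / 2))
        (cong (λ z → inRange j (a / 2) ∧ (z ∧ G j)) (≡ᵇ-refl j))))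
      where
      G : ℕ → Bool
      G j′ = (2 * j′ ∸ 1 ≡ᵇ i) ∨ (2 * j′ ≡ᵇ i)

    layer-degree : ∀ b i (g : V3 → ℕ) → (∀ r j → g (v r j) ≡ 1) → 1 ≤ i → i ≤ a →
      ΣL (λ u → ind (adjacentIn (layerEdges b) (x i) u) * g u) (layerVerts b) ≡ 1
    layer-degree b i g g1 i1 ia with ceilHalf i i1
    ... | t , (t1 , par) = trans (ΣL-map _ (v b) (range1 (a / 2)))
        (trans (ΣL-cong (range1 (a / 2)) pt) (trans (ΣL-range1-single _ t others (a / 2)) at-t))
      where
      G : ℕ → Bool
      G j = (2 * j ∸ 1 ≡ᵇ i) ∨ (2 * j ≡ᵇ i)
      pt : ∀ j → ind (adjacentIn (layerEdges b) (x i) (v b j)) * g (v b j) ≡ ind (inRange j (a / 2) ∧ G j)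
      pt j rewrite g1 b j | layerEdges-x-v b i j = *-identityʳ _
      G-other : ∀ j → j ≢ t → ((i ≡ 2 * t ∸ 1) ⊎ (i ≡ 2 * t)) → G j ≡ false
      G-other j ne (inj₁ e) = cong₂ _∨_ (≡ᵇ-false (2 * j ∸ 1) i (λ e′ → ne (2*∸1-injective j t t1 (trans e′ e))))
                                       (≡ᵇ-false (2 * j) i (λ e′ → 2*≢2*∸1 j t t1 (trans e′ e)))
      G-other j ne (inj₂ e) = cong₂ _∨_ (≡ᵇ-false (2 * j ∸ 1) i (λ e′ → 2*∸1≢2* j t t1 (trans e′ e)))
                                       (≡ᵇ-false (2 * j) i (λ e′ → ne (*-cancelˡ-≡ j t 2 (trans e′ e))))
      others : ∀ j → j ≢ t → ind (inRange j (a / 2) ∧ G j) ≡ 0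
      others j ne rewrite G-other j ne par | ∧-zeroʳ (inRange j (a / 2)) = refl
      G-t : ((i ≡ 2 * t ∸ 1) ⊎ (i ≡ 2 * t)) → G t ≡ true
      G-t (inj₁ e) rewrite e | ≡ᵇ-refl (2 * t ∸ 1) = refl
      G-t (inj₂ e) rewrite e | ≡ᵇ-refl (2 * t) = ∨-zeroʳ _
      2t≤1+i : ((i ≡ 2 * t ∸ 1) ⊎ (i ≡ 2 * t)) → 2 * t ≤ suc i
      2t≤1+i (inj₁ e) rewrite e = ≤-reflexive (sym (m+[n∸m]≡n {1} {2 * t} (≤-trans t1 (m≤m+n t (t + 0)))))
      2t≤1+i (inj₂ e) rewrite e = n≤1+n _
      t≤a/2 : t ≤ a / 2
      t≤a/2 = ≮⇒≥ (λ lt → <-irrefl refl (≤-trans (≤-reflexive (sym (lem (a / 2))))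
                 (≤-trans (*-monoʳ-≤ 2 lt) (≤-trans (2t≤1+i par) (s≤s (subst (i ≤_) a≡2*h ia))))))
        where
        lem : ∀ h → 2 * suc h ≡ suc (suc (2 * h))
        lem = solve-∀
      at-t : ind (inRange t (a / 2)) * ind (inRange t (a / 2) ∧ G t) ≡ 1
      at-t rewrite inRange-intro t1 t≤a/2 | G-t par = refl

    -- D is T₃(a,b′) with L layers added, the last one at parameter ≤ b.
    record FromBase (D : T3Data) (b′ L b : ℕ) : Set where
      field
        base-range : (2 * a + 2 ≤ b′) × (b′ ≤ 3 * a + 1)
        spec₁-base : T3Data.spec₁ D ≡ T3Data.spec₁ (T3Base.data3 a b′)
        specₐ-base : T3Data.specₐ D ≡ T3Data.specₐ (T3Base.data3 a b′)
        verts-split : Σ (List V3) (λ R → (T3Data.verts D ≡ map x (range1 a) ++ R) × All notX R)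
        verts-level : All (LevelAtMost b) (T3Data.verts D)
        edges-level : All (EdgeLevelAtMost b) (T3Data.edges D)
        path-adjacency : ∀ i j → adjacentIn (T3Data.edges D) (x i) (x j) ≡ adjacentIn (T3Data.edges (T3Base.data3 a b′)) (x i) (x j)
        weightedDegree-base : ∀ i (g : V3 → ℕ) → (∀ r j → g (v r j) ≡ 1) → 1 ≤ i → i ≤ a →
                              weightedDegree D g i ≡ weightedDegree (T3Base.data3 a b′) g i + L

    base-fromBase : ∀ b → 2 * a + 2 ≤ b → b ≤ 3 * a + 1 → FromBase (T3Base.data3 a b) b 0 b
    base-fromBase b lo hi = record
      { base-range = lo , hi
      ; spec₁-base = refl
      ; specₐ-base = refl
      ; verts-split = _ , (refl , ++⁺ ends₁ (++⁺ (map⁺ (universal (λ _ → refl) (range1 (m ∸ 1)))) endsₐ))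
      ; verts-level = All.map (λ l → ≤-trans l z≤n) (BaseLevels.verts-level a b)
      ; edges-level = All.map (λ (l , l′) → ≤-trans l z≤n , ≤-trans l′ z≤n) (BaseLevels.edges-level a b)
      ; path-adjacency = λ i j → refl
      ; weightedDegree-base = λ i g g1 i1 ia → sym (+-identityʳ _) }
      where
      open T3Base a b
      ends₁ : All notX (if three₁ then z₁ ∷ w₁ ∷ [] else cls 0 ∷ [])
      ends₁ with three₁
      ... | true = refl ∷ refl ∷ []
      ... | false = refl ∷ []
      endsₐ : All notX (if threeₐ then zₐ ∷ wₐ ∷ [] else cls m ∷ [])
      endsₐ with threeₐ
      ... | true = refl ∷ refl ∷ []
      ... | false = refl ∷ []

    b∸a<b : ∀ b → 1 ≤ b → b ∸ a < b
    b∸a<b (suc b) _ = go a 1≤a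
      where
      go : ∀ a → 1 ≤ a → suc b ∸ a < suc b
      go (suc a) _ = s≤s (m∸n≤m b a)

    addLayer-fromBase : ∀ D b′ L b → 1 ≤ b → FromBase D b′ L (b ∸ a) → FromBase (addLayer D b) b′ (suc L) b
    addLayer-fromBase D b′ L b 1≤b fb = record
      { base-range = base-range
      ; spec₁-base = spec₁-base
      ; specₐ-base = specₐ-base
      ; verts-split = proj₁ verts-split ++ layerVerts b ,
          (trans (cong (_++ layerVerts b) (proj₁ (proj₂ verts-split))) (++-assoc (map x (range1 a)) (proj₁ verts-split) (layerVerts b))
          , ++⁺ (proj₂ (proj₂ verts-split)) (map⁺ (universal (λ _ → refl) (range1 (a / 2)))))
      ; verts-level = ++⁺ (All.map (λ l → ≤-trans l (m∸n≤m b a)) verts-level) (map⁺ (universal (λ _ → ≤-refl) (range1 (a / 2))))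
      ; edges-level = ++⁺ (All.map (λ (l , l′) → ≤-trans l (m∸n≤m b a) , ≤-trans l′ (m∸n≤m b a)) edges-level)
                  (concat⁺ (map⁺ (universal (λ j → (z≤n , ≤-refl) ∷ (≤-refl , z≤n) ∷ []) (range1 (a / 2)))))
      ; path-adjacency = λ i j → trans (adjacentIn-++ (T3Data.edges D) (layerEdges b) (x i) (x j))
                       (trans (cong₂ _∨_ (path-adjacency i j) (layerEdges-older b i (x j) (b ∸ a) z≤n older)) (∨-identityʳ _))
      ; weightedDegree-base = degree }
      where
      open FromBase fb
      older : b ∸ a < b
      older = b∸a<b b 1≤b
      degree : ∀ i (g : V3 → ℕ) → (∀ r j → g (v r j) ≡ 1) → 1 ≤ i → i ≤ a →
             weightedDegree (addLayer D b) g i ≡ weightedDegree (T3Base.data3 a b′) g i + suc L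
      degree i g g1 i1 ia = trans (ΣL-++ _ (T3Data.verts D) (layerVerts b))
        (trans (cong₂ _+_ (trans (ΣL-congAll verts-level old-verts) (weightedDegree-base i g g1 i1 ia))
                          (trans (ΣL-map _ (v b) (range1 (a / 2))) (trans (ΣL-cong (range1 (a / 2)) new-verts)
                            (trans (sym (ΣL-map (λ u → ind (adjacentIn (layerEdges b) (x i) u) * g u) (v b) (range1 (a / 2))))
                              (layer-degree b i g g1 i1 ia)))))
               (+-suc-comm _ L))
        where
        +-suc-comm : ∀ B L → B + L + 1 ≡ B + suc L
        +-suc-comm = solve-∀
        old-verts : ∀ u → LevelAtMost (b ∸ a) u → ind (adjacentIn (T3Data.edges D ++ layerEdges b) (x i) u) * g u ≡ ind (adjacentIn (T3Data.edges D) (x i) u) * g u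
        old-verts u lu rewrite adjacentIn-++ (T3Data.edges D) (layerEdges b) (x i) u | layerEdges-older b i u (b ∸ a) lu older
                             | ∨-identityʳ (adjacentIn (T3Data.edges D) (x i) u) = refl
        new-verts : ∀ j → ind (adjacentIn (T3Data.edges D ++ layerEdges b) (x i) (v b j)) * g (v b j) ≡ ind (adjacentIn (layerEdges b) (x i) (v b j)) * g (v b j)
        new-verts j rewrite adjacentIn-++ (T3Data.edges D) (layerEdges b) (x i) (v b j) | olderEdges-layer (T3Data.edges D) (b ∸ a) b i j edges-level older = refl

    T3aux-fromBase : ∀ f b → 2 * a + 2 ≤ b → b ≤ f → Σ ℕ λ b′ → Σ ℕ λ L → FromBase (T3aux f a b) b′ L b
    T3aux-fromBase zero b lo b≤0 with ≤-trans (m≤n+m 2 (2 * a)) lo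
    ... | 2≤b with ≤-trans 2≤b b≤0
    ... | ()
    T3aux-fromBase (suc f) b lo b≤1+f with b ≤ᵇ 3 * a + 1 in e
    ... | true = b , 0 , base-fromBase b lo (≤ᵇ-sound _ _ e)
    ... | false with T3aux-fromBase f (b ∸ a) lo′ (≤-pred (≤-trans (b∸a<b b 1≤b) b≤1+f))
      where
      1≤b : 1 ≤ b
      1≤b = ≤-trans (s≤s z≤n) (≤-trans (m≤n+m 2 (2 * a)) lo)
      3a+2≤b : 3 * a + 2 ≤ b
      3a+2≤b = subst (_≤ b) (sym (+-suc (3 * a) 1)) (≰⇒> (λ q → true≢false (trans (sym (≤ᵇ-true q)) e)))
      lo′ : 2 * a + 2 ≤ b ∸ a
      lo′ = ≤-trans (≤-reflexive (sym (trans (cong (_∸ a) (lem a)) (m+n∸n≡m (2 * a + 2) a)))) (∸-monoˡ-≤ a 3a+2≤b)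
        where
        lem : ∀ a → 3 * a + 2 ≡ 2 * a + 2 + a
        lem = solve-∀
    ... | b′ , L , fb = b′ , suc L , addLayer-fromBase (T3aux f a (b ∸ a)) b′ L b 1≤b fb
      where
      1≤b : 1 ≤ b
      1≤b = ≤-trans (s≤s z≤n) (≤-trans (m≤n+m 2 (2 * a)) lo)

module BlowUp where

  open import Data.Nat
  open import Data.Nat.Properties
  open import Data.Bool using (Bool; true; false; _∧_; _∨_; not)
  open import Data.Bool.Properties using (∨-comm; ∨-identityʳ; ∧-zeroʳ; ∨-idem; not-involutive)
  open import Data.List using (List; []; _∷_; _++_; map; concatMap; length; upTo; lookup)
  open import Data.List.Properties using (length-upTo; length-map; upTo-∷ʳ)
  open import Data.List.Relation.Unary.All as All using (All; []; _∷_; universal)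
  open import Data.List.Relation.Unary.All.Properties using (++⁺; map⁺; concat⁺; applyUpTo⁺₁)
  open import Data.List.Membership.Propositional.Properties using (∈-lookup)
  open import Data.Fin using (Fin; zero; suc; toℕ)
  open import Data.Fin.Properties using (toℕ-injective)
  open import Data.Fin.Subset using (Subset; ∣_∣; _⊆_)
  import Data.Vec as Vec
  open import Data.Vec.Properties using (lookup∘tabulate; []=⇒lookup; lookup⇒[]=)
  open import Data.Empty using (⊥-elim)
  open import Data.Product using (_×_; _,_; proj₁; proj₂; Σ)
  open import Relation.Binary.PropositionalEquality
  open import Data.Nat.Tactic.RingSolver using (solve-∀)
  open import Defs
  open DoubleCounting
  open Vertices

  ΣL-upTo-suc : (f : ℕ → ℕ) (n : ℕ) → ΣL f (upTo (suc n)) ≡ ΣL f (upTo n) + f n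
  ΣL-upTo-suc f n = trans (cong (ΣL f) (sym (upTo-∷ʳ n))) (trans (ΣL-++ f (upTo n) (n ∷ [])) (cong (ΣL f (upTo n) +_) (+-identityʳ _)))

  <ᵇ-suc : ∀ j k → ind (j <ᵇ suc k) ≡ ind (j <ᵇ k) + ind (j ≡ᵇ k)
  <ᵇ-suc zero zero = refl
  <ᵇ-suc zero (suc k) = refl
  <ᵇ-suc (suc j) zero = refl
  <ᵇ-suc (suc j) (suc k) = <ᵇ-suc j k

  count-≡-upTo : ∀ j k → ΣL (λ j' → ind (j ≡ᵇ j')) (upTo k) ≡ ind (j <ᵇ k)
  count-≡-upTo j zero = sym (lem j)
    where
    lem : ∀ j → ind (j <ᵇ 0) ≡ 0
    lem zero = refl
    lem (suc j) = refl
  count-≡-upTo j (suc k) = trans (ΣL-upTo-suc _ k) (trans (cong (_+ ind (j ≡ᵇ k)) (count-≡-upTo j k)) (sym (<ᵇ-suc j k)))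

  count-≢-upTo : ∀ k j → j < k → ΣL (λ j' → ind (not (j ≡ᵇ j'))) (upTo k) ≡ k ∸ 1
  count-≢-upTo k j jk = +-cancelʳ-≡ 1 _ (k ∸ 1) (trans (trans (cong (ΣL (λ j' → ind (not (j ≡ᵇ j'))) (upTo k) +_) (sym e1))
     (sym (ΣL-+ _ _ (upTo k)))) (trans (ΣL-cong (upTo k) (λ j' → ind-not (j ≡ᵇ j')))
     (trans (ΣL-const 1 (upTo k)) (trans (*-identityˡ _) (trans (length-upTo k) (sym (m∸n+n≡m (≤-trans (s≤s z≤n) jk))))))))
    where
    e1 : ΣL (λ j' → ind (j ≡ᵇ j')) (upTo k) ≡ 1
    e1 = trans (count-≡-upTo j k) (cong ind (<ᵇ-true jk))

  count-x-notX : ∀ i R → All notX R → count (x i) R ≡ 0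
  count-x-notX i [] [] = refl
  count-x-notX i (w ∷ R) (nw ∷ ns) rewrite trans (==-sym (x i) w) (notX-==-x w i nw) = count-x-notX i R ns

  adjacentIn-sym : ∀ es u w → adjacentIn es u w ≡ adjacentIn es w u
  adjacentIn-sym es u w = any-cong es (λ e → ∨-comm ((proj₁ e == u) ∧ (proj₂ e == w)) _)

  module Labels (t a b : ℕ) where
    open Tt2Con t a b
    open T3Data D

    Joined : V3 × ℕ → V3 × ℕ → Bool
    Joined l l' = adjT l l' ∨ adjT l' l

    ΣL-labels : (f : V3 × ℕ → ℕ) → ΣL f vs ≡ ΣL (λ u → ΣL (λ i → f (u , i)) (upTo (size u))) verts
    ΣL-labels f = trans (ΣL-concatMap f _ verts) (ΣL-cong verts (λ u → ΣL-map f (λ i → (u , i)) (upTo (size u))))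

    Joined-x : ∀ i j u j' → Joined (x i , j) (u , j') ≡ ((x i == u) ∧ not (j ≡ᵇ j')) ∨ adj3 (x i) u
    Joined-x i j u j' rewrite ==-sym u (x i) | ≡ᵇ-sym j' j | adjacentIn-sym edges u (x i) = ∨-idem _

    module PathLabels (R : List V3) (verts≡ : verts ≡ map x (range1 a) ++ R) (rest-notX : All notX R)
             (no-self-loops : ∀ i → inRange i a ≡ true → adj3 (x i) (x i) ≡ false) where

      clique-degree : ∀ i j → inRange i a ≡ true → j < k →
        ΣL (λ j' → ind (Joined (x i , j) (x i , j'))) (upTo k) ≡ k ∸ 1
      clique-degree i j hi jk = trans (ΣL-cong (upTo k) (λ j' → cong ind (trans (Joined-x i j (x i) j')
          (trans (cong₂ (λ z1 z2 → (z1 ∧ not (j ≡ᵇ j')) ∨ z2) (≡ᵇ-refl i) (no-self-loops i hi)) (∨-identityʳ _)))))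
        (count-≢-upTo k j jk)

      degree-into : ∀ i j u → inRange i a ≡ true → j < k →
        ΣL (λ j' → ind (Joined (x i , j) (u , j'))) (upTo (size u)) ≡ ind (x i == u) * (k ∸ 1) + ind (adj3 (x i) u) * size u
      degree-into i j u hi jk = go (x i == u) refl
        where
        Goal : V3 → Set
        Goal u = ΣL (λ j' → ind (Joined (x i , j) (u , j'))) (upTo (size u)) ≡ ind (x i == u) * (k ∸ 1) + ind (adj3 (x i) u) * size u
        go : (β : Bool) → (x i == u) ≡ β → Goal u
        go true e = subst Goal (==-sound (x i) u e)
          (trans (clique-degree i j hi jk) (sym (trans (cong₂ (λ z1 z2 → ind z1 * (k ∸ 1) + ind z2 * k) (≡ᵇ-refl i) (no-self-loops i hi))
             (trans (+-identityʳ _) (*-identityˡ _)))))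
        go false e = trans (ΣL-cong (upTo (size u)) (λ j' → cong ind (trans (Joined-x i j u j') (cong (λ z → (z ∧ not (j ≡ᵇ j')) ∨ adj3 (x i) u) e))))
          (trans (ΣL-const _ (upTo (size u))) (trans (cong (ind (adj3 (x i) u) *_) (length-upTo (size u)))
            (cong (λ z → ind z * (k ∸ 1) + ind (adj3 (x i) u) * size u) (sym e))))

      count-x-verts : ∀ i → inRange i a ≡ true → count (x i) verts ≡ 1
      count-x-verts i hi rewrite verts≡ = trans (ΣL-++ _ (map x (range1 a)) R) (trans (cong₂ _+_ (trans (count-xs i a) (cong ind hi)) (count-x-notX i R rest-notX)) refl)

      label-degree : ∀ i j → inRange i a ≡ true → j < k →
        ΣL (λ l' → ind (Joined (x i , j) l')) vs ≡ (k ∸ 1) + ΣL (λ u → ind (adj3 (x i) u) * size u) verts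
      label-degree i j hi jk = trans (ΣL-labels _) (trans (ΣL-cong verts (λ u → degree-into i j u hi jk))
        (trans (ΣL-+ _ _ verts) (cong (_+ ΣL (λ u → ind (adj3 (x i) u) * size u) verts) (trans (ΣL-*ʳ (k ∸ 1) (λ u → ind (x i == u)) verts)
          (trans (cong (_* (k ∸ 1)) (count-x-verts i hi)) (*-identityˡ _))))))

      ΣL-nonRoot-labels : (h : V3 × ℕ → ℕ) → ΣL (λ l → ind (isX (proj₁ l)) * h l) vs ≡ ΣL (λ i → ΣL (λ j → h (x i , j)) (upTo k)) (range1 a)
      ΣL-nonRoot-labels h = trans (ΣL-labels _) (trans (cong (ΣL _) verts≡) (trans (ΣL-++ _ (map x (range1 a)) R)
        (trans (cong₂ _+_ (trans (ΣL-map _ x (range1 a)) (ΣL-cong (range1 a) (λ i → ΣL-cong (upTo k) (λ j → +-identityʳ _))))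
                          (r0 R rest-notX)) (+-identityʳ _))))
        where
        r0 : ∀ R → All notX R → ΣL (λ u → ΣL (λ j → ind (isX u) * h (u , j)) (upTo (size u))) R ≡ 0
        r0 [] [] = refl
        r0 (w ∷ R) (nw ∷ ns) = cong₂ _+_ (trans (ΣL-cong (upTo (size w)) (λ j → cong (λ z → ind z * h (w , j)) nw)) (ΣL-zero (upTo (size w)))) (r0 R ns)

      label-nonRoot-degree : ∀ i j → inRange i a ≡ true → j < k →
        ΣL (λ l' → ind (isX (proj₁ l')) * ind (Joined (x i , j) l')) vs ≡ (k ∸ 1) + k * ΣL (λ i' → ind (adj3 (x i) (x i'))) (range1 a)
      label-nonRoot-degree i j hi jk = trans (ΣL-nonRoot-labels _) (trans (ΣL-cong (range1 a) (λ i' → degree-into i j (x i') hi jk))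
        (trans (ΣL-+ _ _ (range1 a)) (cong₂ _+_
          (trans (ΣL-*ʳ (k ∸ 1) (λ i' → ind (x i == x i')) (range1 a)) (trans (cong (_* (k ∸ 1)) (trans (cnt-xmap' i) (cong ind hi))) (*-identityˡ _)))
          (trans (ΣL-*ʳ k (λ i' → ind (adj3 (x i) (x i'))) (range1 a)) (*-comm _ k)))))
        where
        cnt-xmap' : ∀ i → ΣL (λ i' → ind (i ≡ᵇ i')) (range1 a) ≡ ind (inRange i a)
        cnt-xmap' i = trans (sym (ΣL-map (λ u → ind (x i == u)) x (range1 a))) (count-xs i a)

      Joined-x-x-bound : ∀ i j i' j' → inRange i a ≡ true →
        ind (Joined (x i , j) (x i' , j')) ≤ ind (i ≡ᵇ i') + ind (adj3 (x i) (x i'))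
      Joined-x-x-bound i j i' j' hi rewrite Joined-x i j (x i') j' =
        ≤-trans (ind-∨-≤ ((i ≡ᵇ i') ∧ not (j ≡ᵇ j')) (adj3 (x i) (x i'))) (+-monoˡ-≤ (ind (adj3 (x i) (x i'))) (ind-∧-≤ (i ≡ᵇ i') (not (j ≡ᵇ j'))))

      Joined-irrefl : ∀ i j → inRange i a ≡ true → Joined (x i , j) (x i , j) ≡ false
      Joined-irrefl i j hi rewrite Joined-x i j (x i) j | ≡ᵇ-refl j | no-self-loops i hi = trans (∨-identityʳ _) (∧-zeroʳ _)

  countS : ∀ {n} (S : Subset n) → ∣ S ∣ ≡ ΣF n (λ u → ind (Vec.lookup S u))
  countS Vec.[] = refl
  countS (true Vec.∷ S) = cong suc (countS S)
  countS (false Vec.∷ S) = countS S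

  pathIndex : V3 × ℕ → ℕ
  pathIndex (x i , _) = i
  pathIndex _ = 0

  module BlowUpSums (t a b : ℕ) (R : List V3)
    (verts≡ : T3Data.verts (Tt2Con.D t a b) ≡ map x (range1 a) ++ R) (rest-notX : All notX R)
    (no-self-loops : ∀ i → inRange i a ≡ true → Tt2Con.adj3 t a b (x i) (x i) ≡ false)
    (path-bound : ∀ i i' → inRange i a ≡ true → ind (Tt2Con.adj3 t a b (x i) (x i')) ≤ ind (i' ≡ᵇ suc i) + ind (i ≡ᵇ suc i')) where

    open Tt2Con t a b
    open T3Data D
    open Labels t a b
    open Labels.PathLabels t a b R verts≡ rest-notX no-self-loops

    wdeg : ℕ → ℕ
    wdeg = weightedDegree D size

    pathDeg : ℕ → ℕ
    pathDeg i = ΣL (λ i′ → ind (adj3 (x i) (x i′))) (range1 a)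

    G : RootedGraph
    G = graph
    N : ℕ
    N = length vs
    label : Fin N → V3 × ℕ
    label u = lookup vs u
    IsNonRoot : Fin N → Bool
    IsNonRoot u = isX (proj₁ (label u))
    cliqueOf : Fin N → ℕ
    cliqueOf u = pathIndex (label u)

    LabelOk : V3 × ℕ → Set
    LabelOk l = isX (proj₁ l) ≡ true → Σ ℕ (λ i → Σ ℕ (λ j → (l ≡ (x i , j)) × (inRange i a ≡ true) × (j < k)))

    labels-ok : All LabelOk vs
    labels-ok = subst (λ V → All LabelOk (concatMap (λ u → map (λ i → (u , i)) (upTo (size u))) V)) (sym verts≡)
      (concat⁺ (map⁺ (++⁺ (map⁺ (map⁺ (applyUpTo⁺₁ (λ z → z) a clique-ok))) (All.map root-ok rest-notX))))
      where
      clique-ok : ∀ {j} → j < a → All LabelOk (map (λ i → (x (suc j) , i)) (upTo k))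
      clique-ok {j} j<a = map⁺ (applyUpTo⁺₁ (λ z → z) k (λ {j′} j′<k _ → suc j , j′ , refl , inRange-intro (s≤s z≤n) j<a , j′<k))
      root-ok : ∀ {w} → notX w → All LabelOk (map (λ j → (w , j)) (upTo (size w)))
      root-ok nw = map⁺ (universal (λ j e → ⊥-elim (true≢false (trans (sym e) nw))) _)

    nonRoot-label : ∀ u → IsNonRoot u ≡ true → Σ ℕ (λ i → Σ ℕ (λ j → (label u ≡ (x i , j)) × (inRange i a ≡ true) × (j < k)))
    nonRoot-label u = All.lookup labels-ok (∈-lookup u)

    cliqueOf-label : ∀ u (hu : IsNonRoot u ≡ true) → cliqueOf u ≡ proj₁ (nonRoot-label u hu)
    cliqueOf-label u hu = cong pathIndex (proj₁ (proj₂ (proj₂ (nonRoot-label u hu))))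

    cliqueOf-inRange : ∀ u → IsNonRoot u ≡ true → inRange (cliqueOf u) a ≡ true
    cliqueOf-inRange u hu = subst (λ z → inRange z a ≡ true) (sym (cliqueOf-label u hu)) (proj₁ (proj₂ (proj₂ (proj₂ (nonRoot-label u hu)))))

    cliqueCount : (Fin N → Bool) → ℕ → ℕ
    cliqueCount T i = ΣF N (λ u → ind (T u) * ind (cliqueOf u ≡ᵇ i))

    ΣF-by-clique : (T : Fin N → Bool) → (∀ u → T u ≡ true → IsNonRoot u ≡ true) → (g : ℕ → ℕ) →
      ΣF N (λ u → ind (T u) * g (cliqueOf u)) ≡ ΣL (λ i → cliqueCount T i * g i) (range1 a)
    ΣF-by-clique T hT g = trans (ΣF-cong N pt) (trans (ΣF-ΣL N (range1 a) _)
        (ΣL-cong (range1 a) (λ i → ΣF-*ʳ N (g i) (λ u → ind (T u) * ind (cliqueOf u ≡ᵇ i)))))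
      where
      pt : ∀ u → ind (T u) * g (cliqueOf u) ≡ ΣL (λ i → ind (T u) * ind (cliqueOf u ≡ᵇ i) * g i) (range1 a)
      pt u with T u in eT
      ... | false = sym (ΣL-zero (range1 a))
      ... | true = sym (trans (ΣL-range1-single (λ i → 1 * ind (cliqueOf u ≡ᵇ i) * g i) (cliqueOf u) hz a)
                     (trans (cong₂ (λ z1 z2 → ind z1 * (1 * ind z2 * g (cliqueOf u))) (cliqueOf-inRange u (hT u eT)) (≡ᵇ-refl (cliqueOf u)))
                       (cong (1 *_) (*-identityˡ (g (cliqueOf u))))))
        where
        hz : ∀ i → i ≢ cliqueOf u → 1 * ind (cliqueOf u ≡ᵇ i) * g i ≡ 0
        hz i ne rewrite ≡ᵇ-false (cliqueOf u) i (λ e → ne (sym e)) = refl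

    nonRoot-degree : ∀ u → IsNonRoot u ≡ true → ΣF N (λ w → ind (Joined (label u) (label w))) ≡ (k ∸ 1) + wdeg (cliqueOf u)
    nonRoot-degree u hu with nonRoot-label u hu | cliqueOf-label u hu
    ... | (i , j , e , hi , jk) | eI = trans (ΣF-lookup _ vs) (trans (cong (λ l → ΣL (λ l' → ind (Joined l l')) vs) e)
        (trans (label-degree i j hi jk) (cong (λ z → (k ∸ 1) + z) (cong wdeg (sym eI)))))

    nonRoot-irrefl : ∀ u → IsNonRoot u ≡ true → Joined (label u) (label u) ≡ false
    nonRoot-irrefl u hu with nonRoot-label u hu
    ... | (i , j , e , hi , jk) = trans (cong (λ l → Joined l l) e) (Joined-irrefl i j hi)

    nonRoot-nonRoot-degree : ∀ u → IsNonRoot u ≡ true → ΣF N (λ w → ind (IsNonRoot w) * ind (Joined (label u) (label w))) ≡ (k ∸ 1) + k * pathDeg (cliqueOf u)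
    nonRoot-nonRoot-degree u hu with nonRoot-label u hu | cliqueOf-label u hu
    ... | (i , j , e , hi , jk) | eI = trans (ΣF-lookup (λ l' → ind (isX (proj₁ l')) * ind (Joined (label u) l')) vs)
        (trans (cong (λ l → ΣL (λ l' → ind (isX (proj₁ l')) * ind (Joined l l')) vs) e)
        (trans (label-nonRoot-degree i j hi jk) (cong (λ z → (k ∸ 1) + k * z) (cong pathDeg (sym eI)))))

    nonRoot-pair-bound : ∀ u w → IsNonRoot u ≡ true → IsNonRoot w ≡ true →
      ind (Joined (label u) (label w)) + ind (toℕ u ≡ᵇ toℕ w) ≤ ind (cliqueOf u ≡ᵇ cliqueOf w) + ind (cliqueOf w ≡ᵇ suc (cliqueOf u)) + ind (cliqueOf u ≡ᵇ suc (cliqueOf w))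
    nonRoot-pair-bound u w hu hw with toℕ u ≡ᵇ toℕ w in ee
    ... | true rewrite toℕ-injective (≡ᵇ-sound (toℕ u) (toℕ w) ee) | nonRoot-irrefl w hw | ≡ᵇ-refl (cliqueOf w) = s≤s z≤n
    ... | false with nonRoot-label u hu | cliqueOf-label u hu | nonRoot-label w hw | cliqueOf-label w hw
    ... | (i , j , e , hi , jk) | eI | (i' , j' , e' , hi' , j'k) | eI' rewrite eI | eI' | e | e' =
      ≤-trans (≤-reflexive (+-identityʳ _)) (≤-trans (Joined-x-x-bound i j i' j' hi) (≤-trans (+-monoʳ-≤ (ind (i ≡ᵇ i')) (path-bound i i' hi)) (≤-reflexive (sym (+-assoc (ind (i ≡ᵇ i')) (ind (i' ≡ᵇ suc i)) (ind (i ≡ᵇ suc i')))))))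

    NonRoots-lookup : ∀ u → Vec.lookup (NonRoots G) u ≡ IsNonRoot u
    NonRoots-lookup u = trans (lookup∘tabulate (λ u → not (RootedGraph.isRoot G u)) u) (not-involutive (IsNonRoot u))

    pair-term-bound : ∀ su sw QA E X1 X2 X3 → (su ≡ 1 → sw ≡ 1 → QA + E ≤ X1 + X2 + X3) → su ≤ 1 → sw ≤ 1 →
      QA * (su * sw) + E * (su * sw) ≤ su * (sw * X1) + su * (sw * X2) + sw * (su * X3)
    pair-term-bound zero sw QA E X1 X2 X3 h _ _ rewrite *-zeroʳ QA | *-zeroʳ E = z≤n
    pair-term-bound (suc zero) zero QA E X1 X2 X3 h _ _ rewrite *-zeroʳ QA | *-zeroʳ E = z≤n
    pair-term-bound (suc zero) (suc zero) QA E X1 X2 X3 h _ _ = ≤-trans (≤-reflexive (lemL QA E)) (≤-trans (h refl refl) (≤-reflexive (lemR X1 X2 X3)))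
      where
      lemL : ∀ QA E → QA * (1 * 1) + E * (1 * 1) ≡ QA + E
      lemL = solve-∀
      lemR : ∀ X1 X2 X3 → X1 + X2 + X3 ≡ 1 * (1 * X1) + 1 * (1 * X2) + 1 * (1 * X3)
      lemR = solve-∀
    pair-term-bound (suc (suc _)) sw QA E X1 X2 X3 h (s≤s ()) _
    pair-term-bound (suc zero) (suc (suc _)) QA E X1 X2 X3 h _ (s≤s ())

    module InsideNonRoots (S : Subset N) (S-nonRoot : ∀ u → Vec.lookup S u ≡ true → IsNonRoot u ≡ true) where
      module GS = EdgeCount G S
      InS : Fin N → Bool
      InS u = Vec.lookup S u

      degree-distinct : ∀ u → IsNonRoot u ≡ true → ΣF N (λ w → GS.distinct u w * GS.adjacent u w) ≡ (k ∸ 1) + wdeg (cliqueOf u)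
      degree-distinct u hu = trans (sym (+-identityʳ _)) (trans (cong (ΣF N (λ w → GS.distinct u w * GS.adjacent u w) +_) (sym e0))
        (trans (sym (ΣF-+ N _ _)) (trans (ΣF-cong N pt) (nonRoot-degree u hu))))
        where
        e0 : ΣF N (λ w → ind (toℕ u ≡ᵇ toℕ w) * GS.adjacent u w) ≡ 0
        e0 = trans (ΣF-delta N (GS.adjacent u) u) (cong ind (nonRoot-irrefl u hu))
        pt : ∀ w → GS.distinct u w * GS.adjacent u w + ind (toℕ u ≡ᵇ toℕ w) * GS.adjacent u w ≡ GS.adjacent u w
        pt w = trans (sym (*-distribʳ-+ (GS.adjacent u w) (GS.distinct u w) _)) (trans (cong (_* GS.adjacent u w) (trichotomyᵇ (toℕ u) (toℕ w))) (*-identityˡ _))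

      ΣΣ-degree : ΣΣ N (λ u w → GS.distinct u w * GS.adjacent u w * GS.inS u) ≡ ΣF N (λ u → ind (InS u) * ((k ∸ 1) + wdeg (cliqueOf u)))
      ΣΣ-degree = ΣF-cong N (λ u → trans (ΣF-*ʳ N (GS.inS u) (λ w → GS.distinct u w * GS.adjacent u w)) (pt u))
        where
        pt : ∀ u → ΣF N (λ w → GS.distinct u w * GS.adjacent u w) * GS.inS u ≡ ind (InS u) * ((k ∸ 1) + wdeg (cliqueOf u))
        pt u with InS u in eS
        ... | false = *-zeroʳ (ΣF N (λ w → GS.distinct u w * GS.adjacent u w))
        ... | true = trans (*-identityʳ _) (trans (degree-distinct u (S-nonRoot u eS)) (sym (+-identityʳ _)))

      card-diagonal : ΣF N (λ u → ind (InS u)) ≡ ΣΣ N (λ u w → ind (toℕ u ≡ᵇ toℕ w) * (GS.inS u * GS.inS w))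
      card-diagonal = ΣF-cong N (λ u → sym (trans (ΣF-delta N (λ w → GS.inS u * GS.inS w) u) (ind-idem (InS u))))

      ΣΣ-inside-bound : ΣΣ N (λ u w → GS.distinct u w * GS.adjacent u w * (GS.inS u * GS.inS w)) + ΣF N (λ u → ind (InS u))
          ≤ ΣΣ N (λ u w → GS.inS u * (GS.inS w * ind (cliqueOf w ≡ᵇ cliqueOf u)) + GS.inS u * (GS.inS w * ind (cliqueOf w ≡ᵇ suc (cliqueOf u))) + GS.inS w * (GS.inS u * ind (cliqueOf u ≡ᵇ suc (cliqueOf w))))
      ΣΣ-inside-bound = ≤-trans (≤-reflexive (trans (cong (ΣΣ N (λ u w → GS.distinct u w * GS.adjacent u w * (GS.inS u * GS.inS w)) +_) card-diagonal) (sym (ΣΣ-+ N _ _))))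
        (ΣF-mono N (λ u → ΣF-mono N (λ w → pt u w)))
        where
        pt : ∀ u w → GS.distinct u w * GS.adjacent u w * (GS.inS u * GS.inS w) + ind (toℕ u ≡ᵇ toℕ w) * (GS.inS u * GS.inS w)
                   ≤ GS.inS u * (GS.inS w * ind (cliqueOf w ≡ᵇ cliqueOf u)) + GS.inS u * (GS.inS w * ind (cliqueOf w ≡ᵇ suc (cliqueOf u))) + GS.inS w * (GS.inS u * ind (cliqueOf u ≡ᵇ suc (cliqueOf w)))
        pt u w = pair-term-bound (GS.inS u) (GS.inS w) (GS.distinct u w * GS.adjacent u w) (ind (toℕ u ≡ᵇ toℕ w)) (ind (cliqueOf w ≡ᵇ cliqueOf u)) (ind (cliqueOf w ≡ᵇ suc (cliqueOf u))) (ind (cliqueOf u ≡ᵇ suc (cliqueOf w)))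
                   cond (ind≤1 (InS u)) (ind≤1 (InS w))
          where
          cond : GS.inS u ≡ 1 → GS.inS w ≡ 1 → GS.distinct u w * GS.adjacent u w + ind (toℕ u ≡ᵇ toℕ w) ≤ ind (cliqueOf w ≡ᵇ cliqueOf u) + ind (cliqueOf w ≡ᵇ suc (cliqueOf u)) + ind (cliqueOf u ≡ᵇ suc (cliqueOf w))
          cond e1 e2 = ≤-trans (+-monoˡ-≤ _ (≤-trans (*-monoˡ-≤ (GS.adjacent u w) (ind≤1 (GS.Distinct u w))) (≤-reflexive (*-identityˡ _))))
                  (subst (λ z → GS.adjacent u w + ind (toℕ u ≡ᵇ toℕ w) ≤ ind z + ind (cliqueOf w ≡ᵇ suc (cliqueOf u)) + ind (cliqueOf u ≡ᵇ suc (cliqueOf w))) (≡ᵇ-sym (cliqueOf u) (cliqueOf w))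
                    (nonRoot-pair-bound u w (S-nonRoot u (ind≡1⇒true e1)) (S-nonRoot w (ind≡1⇒true e2))))

      ΣΣ-same-clique : ΣΣ N (λ u w → GS.inS u * (GS.inS w * ind (cliqueOf w ≡ᵇ cliqueOf u))) ≡ ΣL (λ i → cliqueCount InS i * cliqueCount InS i) (range1 a)
      ΣΣ-same-clique = trans (ΣF-cong N (λ u → ΣF-* N (GS.inS u) _)) (ΣF-by-clique InS S-nonRoot (cliqueCount InS))

      ΣΣ-next-clique : ΣΣ N (λ u w → GS.inS u * (GS.inS w * ind (cliqueOf w ≡ᵇ suc (cliqueOf u)))) ≡ ΣL (λ i → cliqueCount InS i * cliqueCount InS (suc i)) (range1 a)
      ΣΣ-next-clique = trans (ΣF-cong N (λ u → ΣF-* N (GS.inS u) _)) (ΣF-by-clique InS S-nonRoot (λ i → cliqueCount InS (suc i)))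

      ΣΣ-prev-clique : ΣΣ N (λ u w → GS.inS w * (GS.inS u * ind (cliqueOf u ≡ᵇ suc (cliqueOf w)))) ≡ ΣL (λ i → cliqueCount InS i * cliqueCount InS (suc i)) (range1 a)
      ΣΣ-prev-clique = trans (ΣΣ-swap N _) ΣΣ-next-clique

      ΣΣ-clique-terms : ΣΣ N (λ u w → GS.inS u * (GS.inS w * ind (cliqueOf w ≡ᵇ cliqueOf u)) + GS.inS u * (GS.inS w * ind (cliqueOf w ≡ᵇ suc (cliqueOf u))) + GS.inS w * (GS.inS u * ind (cliqueOf u ≡ᵇ suc (cliqueOf w))))
           ≡ ΣL (λ i → cliqueCount InS i * cliqueCount InS i) (range1 a) + ΣL (λ i → cliqueCount InS i * cliqueCount InS (suc i)) (range1 a) + ΣL (λ i → cliqueCount InS i * cliqueCount InS (suc i)) (range1 a)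
      ΣΣ-clique-terms = trans (ΣΣ-+ N _ _) (cong₂ _+_ (trans (ΣΣ-+ N _ _) (cong₂ _+_ ΣΣ-same-clique ΣΣ-next-clique)) ΣΣ-prev-clique)

    ΣF-nonRoots : (F : ℕ → ℕ) → ΣF N (λ u → ind (IsNonRoot u) * F (cliqueOf u)) ≡ ΣL (λ i → F i * k) (range1 a)
    ΣF-nonRoots F = trans (ΣF-lookup (λ l → ind (isX (proj₁ l)) * F (pathIndex l)) vs) (trans (ΣL-nonRoot-labels (λ l → F (pathIndex l)))
      (ΣL-cong (range1 a) (λ i → trans (ΣL-const (F i) (upTo k)) (cong (F i *_) (length-upTo k)))))

    NonRoots-nonRoot : ∀ u → Vec.lookup (NonRoots G) u ≡ true → IsNonRoot u ≡ true
    NonRoots-nonRoot u e = trans (sym (NonRoots-lookup u)) e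

    module OnN = InsideNonRoots (NonRoots G) NonRoots-nonRoot

    card-NonRoots : ∣ NonRoots G ∣ ≡ k * a
    card-NonRoots = trans (countS (NonRoots G)) (trans (ΣF-cong N (λ u → trans (cong ind (NonRoots-lookup u)) (sym (*-identityʳ _))))
      (trans (ΣF-nonRoots (λ _ → 1)) (trans (ΣL-const (1 * k) (range1 a)) (cong₂ _*_ (*-identityˡ k) (trans (length-map suc (upTo a)) (length-upTo a))))))

    degree-sum-NonRoots : ΣΣ N (λ u w → OnN.GS.distinct u w * OnN.GS.adjacent u w * OnN.GS.inS u) ≡ ΣL (λ i → ((k ∸ 1) + wdeg i) * k) (range1 a)
    degree-sum-NonRoots = trans OnN.ΣΣ-degree (trans (ΣF-cong N (λ u → cong (λ z → ind z * ((k ∸ 1) + wdeg (cliqueOf u))) (NonRoots-lookup u))) (ΣF-nonRoots (λ i → (k ∸ 1) + wdeg i)))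

    inside-sum-NonRoots : ΣΣ N (λ u w → OnN.GS.distinct u w * OnN.GS.adjacent u w * (OnN.GS.inS u * OnN.GS.inS w)) ≡ ΣL (λ i → ((k ∸ 1) + k * pathDeg i) * k) (range1 a)
    inside-sum-NonRoots = trans (ΣF-cong N pt) (ΣF-nonRoots (λ i → (k ∸ 1) + k * pathDeg i))
      where
      pt : ∀ u → ΣF N (λ w → OnN.GS.distinct u w * OnN.GS.adjacent u w * (OnN.GS.inS u * OnN.GS.inS w)) ≡ ind (IsNonRoot u) * ((k ∸ 1) + k * pathDeg (cliqueOf u))
      pt u with IsNonRoot u in eX
      ... | false = trans (ΣF-cong N (λ w → trans (cong (λ z → OnN.GS.distinct u w * OnN.GS.adjacent u w * (ind z * OnN.GS.inS w)) (NonRoots-lookup u)) (cong (λ z → OnN.GS.distinct u w * OnN.GS.adjacent u w * (ind z * OnN.GS.inS w)) eX)))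
                      (trans (ΣF-cong N (λ w → *-zeroʳ (OnN.GS.distinct u w * OnN.GS.adjacent u w))) (ΣF-zero N))
      ... | true = trans (sym (+-identityʳ _)) (trans (cong (ΣF N (λ w → OnN.GS.distinct u w * OnN.GS.adjacent u w * (OnN.GS.inS u * OnN.GS.inS w)) +_) (sym e0))
          (trans (sym (ΣF-+ N _ _)) (trans (ΣF-cong N pt2) (trans (nonRoot-nonRoot-degree u eX) (sym (+-identityʳ _))))))
        where
        su1 : OnN.GS.inS u ≡ 1
        su1 = cong ind (trans (NonRoots-lookup u) eX)
        e0 : ΣF N (λ w → ind (toℕ u ≡ᵇ toℕ w) * (OnN.GS.adjacent u w * OnN.GS.inS w)) ≡ 0
        e0 = trans (ΣF-delta N (λ w → OnN.GS.adjacent u w * OnN.GS.inS w) u) (cong (λ z → ind z * OnN.GS.inS u) (nonRoot-irrefl u eX))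
        pt2 : ∀ w → OnN.GS.distinct u w * OnN.GS.adjacent u w * (OnN.GS.inS u * OnN.GS.inS w) + ind (toℕ u ≡ᵇ toℕ w) * (OnN.GS.adjacent u w * OnN.GS.inS w)
                  ≡ ind (IsNonRoot w) * ind (Joined (label u) (label w))
        pt2 w rewrite su1 | NonRoots-lookup w = lem (OnN.GS.distinct u w) (ind (toℕ u ≡ᵇ toℕ w)) (OnN.GS.adjacent u w) (ind (IsNonRoot w)) (trichotomyᵇ (toℕ u) (toℕ w))
          where
          lem : ∀ q e a' n' → q + e ≡ 1 → q * a' * (1 * n') + e * (a' * n') ≡ n' * a'
          lem q e a' n' h = trans (l2 q e a' n') (trans (cong (λ z → z * (a' * n')) h) (trans (*-identityˡ _) (*-comm a' n')))
            where
            l2 : ∀ q e a' n' → q * a' * (1 * n') + e * (a' * n') ≡ (q + e) * (a' * n')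
            l2 = solve-∀

    handshake-NonRoots : 2 * e G (NonRoots G) + ΣL (λ i → ((k ∸ 1) + k * pathDeg i) * k) (range1 a) ≡ 2 * ΣL (λ i → ((k ∸ 1) + wdeg i) * k) (range1 a)
    handshake-NonRoots = trans (cong (2 * e G (NonRoots G) +_) (sym inside-sum-NonRoots)) (trans OnN.GS.handshake (cong (2 *_) degree-sum-NonRoots))

    module Subgraph (S : Subset N) (sub : S ⊆ NonRoots G) where
      S-nonRoot : ∀ u → Vec.lookup S u ≡ true → IsNonRoot u ≡ true
      S-nonRoot u e = trans (sym (NonRoots-lookup u)) ([]=⇒lookup (sub (lookup⇒[]= u S e)))
      module OnS = InsideNonRoots S S-nonRoot
      cliqueSize : ℕ → ℕ
      cliqueSize = cliqueCount (λ u → Vec.lookup S u)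

      handshake-S : 2 * e G S + ΣΣ N (λ u w → OnS.GS.distinct u w * OnS.GS.adjacent u w * (OnS.GS.inS u * OnS.GS.inS w)) ≡ 2 * ΣL (λ i → cliqueSize i * ((k ∸ 1) + wdeg i)) (range1 a)
      handshake-S = trans OnS.GS.handshake (cong (2 *_) (trans OnS.ΣΣ-degree (ΣF-by-clique (λ u → Vec.lookup S u) S-nonRoot (λ i → (k ∸ 1) + wdeg i))))

      card-S : ∣ S ∣ ≡ ΣL cliqueSize (range1 a)
      card-S = trans (countS S) (trans (ΣF-cong N (λ u → sym (*-identityʳ _))) (trans (ΣF-by-clique (λ u → Vec.lookup S u) S-nonRoot (λ _ → 1)) (ΣL-cong (range1 a) (λ i → *-identityʳ _))))

      inside-bound-S : ΣΣ N (λ u w → OnS.GS.distinct u w * OnS.GS.adjacent u w * (OnS.GS.inS u * OnS.GS.inS w)) + ΣL cliqueSize (range1 a)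
           ≤ ΣL (λ i → cliqueSize i * cliqueSize i) (range1 a) + ΣL (λ i → cliqueSize i * cliqueSize (suc i)) (range1 a) + ΣL (λ i → cliqueSize i * cliqueSize (suc i)) (range1 a)
      inside-bound-S = ≤-trans (≤-reflexive (cong (ΣΣ N (λ u w → OnS.GS.distinct u w * OnS.GS.adjacent u w * (OnS.GS.inS u * OnS.GS.inS w)) +_) (sym (trans (sym (countS S)) card-S)))) (≤-trans OnS.ΣΣ-inside-bound (≤-reflexive OnS.ΣΣ-clique-terms))

      cliqueSize≤k : ∀ i → cliqueSize i ≤ ind (inRange i a) * k
      cliqueSize≤k i = ≤-trans (ΣF-mono N (λ u → *-monoˡ-≤ _ (sx u)))
        (≤-reflexive (trans (ΣF-nonRoots (λ i' → ind (i' ≡ᵇ i))) (trans (ΣL-range1-single (λ i' → ind (i' ≡ᵇ i) * k) i hz a)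
          (trans (cong (λ z → ind (inRange i a) * (ind z * k)) (≡ᵇ-refl i)) (cong (ind (inRange i a) *_) (*-identityˡ k))))))
        where
        sx : ∀ u → ind (Vec.lookup S u) ≤ ind (IsNonRoot u)
        sx u with Vec.lookup S u in e
        ... | false = z≤n
        ... | true = ≤-reflexive (cong ind (sym (S-nonRoot u e)))
        hz : ∀ i' → i' ≢ i → ind (i' ≡ᵇ i) * k ≡ 0
        hz i' ne rewrite ≡ᵇ-false i' i ne = refl

module PathInequality where

  open import Data.Integer using (ℤ; +_; _+_; _*_; _-_; -_; _≤_; 0ℤ; +≤+)
  open import Data.Integer.Properties
  open import Data.Integer.Tactic.RingSolver using (solve-∀)
  import Data.Nat as ℕ
  open ℕ using (ℕ; zero; suc)
  import Data.Nat.Properties as ℕP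
  open import Data.Product using (_×_; _,_; proj₁; proj₂)
  open import Data.Sum using (inj₁; inj₂)
  open import Relation.Binary.PropositionalEquality

  Σℤ : ℕ → (ℕ → ℤ) → ℤ
  Σℤ zero f = 0ℤ
  Σℤ (suc n) f = Σℤ n f + f (suc n)

  0≤* : ∀ {i j} → 0ℤ ≤ i → 0ℤ ≤ j → 0ℤ ≤ i * j
  0≤* {+ m} {+ n} _ _ = subst (0ℤ ≤_) (pos-* m n) (+≤+ ℕ.z≤n)

  module PathSums (a k : ℕ) (s E D : ℕ → ℤ) where
    A K : ℤ
    A = + a
    K = + k
    ΣE : ℤ
    ΣE = Σℤ a E
    Ψ : ℕ → ℤ
    Ψ n = A * Σℤ n E - (+ n) * ΣE
    Σs : ℕ → ℤ
    Σs n = Σℤ n s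

    crossTerm : ℕ → ℤ
    crossTerm n = s n * (K - s (suc n)) + (K - s n) * s (suc n)

    Zp : ℕ → ℤ
    Zp zero = 0ℤ
    Zp (suc zero) = s 1 * E 1 + s 1 * (K - s 1)
    Zp (suc (suc n)) = Zp (suc n) + (s (suc (suc n)) * E (suc (suc n)) + s (suc (suc n)) * (K - s (suc (suc n))) + crossTerm (suc n))

    -- Abel summation: Kq n ≥ 0 by induction on n, because |Ψ n| ≤ A K and
    -- crossTerm n ≥ K |s n − s (n + 1)|; at n = a one has Ψ a = 0.
    Kq : ℕ → ℤ
    Kq n = A * Zp n - ΣE * Σs n - Ψ n * s n

    Xp : ℕ → ℤ
    Xp n = Σℤ n (λ i → s i * (+ 2 * D i + + 1) - s i * s i - + 2 * s i * s (suc i))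

    module Positivity
      (s-bounds : ∀ i → 1 ℕ.≤ i → i ℕ.≤ a → (0ℤ ≤ s i) × (s i ≤ K))
      (Ψ-bounded : ∀ n → 1 ℕ.≤ n → n ℕ.< a → (- (A * K) ≤ Ψ n) × (Ψ n ≤ A * K)) where

      Kq-base : ∀ a' K' s1 E₁ SE' → a' * (s1 * E₁ + s1 * (K' - s1)) - SE' * (0ℤ + s1) - (a' * (0ℤ + E₁) - + 1 * SE') * s1
                                   ≡ a' * (s1 * (K' - s1))
      Kq-base = solve-∀

      Kq-step : ∀ a' K' Z SE' Ssm SumE N1 E2 x y →
        a' * (Z + (y * E2 + y * (K' - y) + (x * (K' - y) + (K' - x) * y))) - SE' * (Ssm + y)
          - (a' * (SumE + E2) - (+ 1 + N1) * SE') * y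
        ≡ (a' * Z - SE' * Ssm - (a' * SumE - N1 * SE') * x)
          + (a' * (y * (K' - y)) + (a' * (x * (K' - y) + (K' - x) * y) + (a' * SumE - N1 * SE') * (x - y)))
      Kq-step = solve-∀

      crossTerm-≥ : ∀ a' K' P x y → a' * (x * (K' - y) + (K' - x) * y) + P * (x - y)
                            ≡ a' * (+ 2 * (y * (K' - x))) + (a' * K' + P) * (x - y)
      crossTerm-≥ = solve-∀
      crossTerm-≤ : ∀ a' K' P x y → a' * (x * (K' - y) + (K' - x) * y) + P * (x - y)
                            ≡ a' * (+ 2 * (x * (K' - y))) + (a' * K' - P) * (y - x)
      crossTerm-≤ = solve-∀

      0≤2 : 0ℤ ≤ + 2
      0≤2 = +≤+ ℕ.z≤n
      0≤A : 0ℤ ≤ A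
      0≤A = +≤+ ℕ.z≤n

      crossTerm-nonNeg : ∀ P x y → (- (A * K) ≤ P) × (P ≤ A * K) → (0ℤ ≤ x) × (x ≤ K) → (0ℤ ≤ y) × (y ≤ K) →
                0ℤ ≤ A * (x * (K - y) + (K - x) * y) + P * (x - y)
      crossTerm-nonNeg P x y (pl , pu) (x0 , xK) (y0 , yK) with ≤-total y x
      ... | inj₁ y≤x = subst (0ℤ ≤_) (sym (crossTerm-≥ A K P x y))
             (+-mono-≤ (0≤* 0≤A (0≤* 0≤2 (0≤* y0 (i≤j⇒0≤j-i xK))))
                  (0≤* (subst (0ℤ ≤_) (lem (A * K) P) (i≤j⇒0≤j-i pl)) (i≤j⇒0≤j-i y≤x)))
        where
        lem : ∀ u P → P - - u ≡ u + P
        lem = solve-∀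
      ... | inj₂ x≤y = subst (0ℤ ≤_) (sym (crossTerm-≤ A K P x y))
             (+-mono-≤ (0≤* 0≤A (0≤* 0≤2 (0≤* x0 (i≤j⇒0≤j-i yK))))
                  (0≤* (i≤j⇒0≤j-i pu) (i≤j⇒0≤j-i x≤y)))

      Kq-nonNeg : ∀ n → 1 ℕ.≤ n → n ℕ.≤ a → 0ℤ ≤ Kq n
      Kq-nonNeg (suc zero) _ h1 = subst (0ℤ ≤_) (sym (Kq-base A K (s 1) (E 1) ΣE))
        (0≤* 0≤A (0≤* (proj₁ (s-bounds 1 (ℕ.s≤s ℕ.z≤n) h1)) (i≤j⇒0≤j-i (proj₂ (s-bounds 1 (ℕ.s≤s ℕ.z≤n) h1)))))
      Kq-nonNeg (suc (suc m)) _ h = subst (0ℤ ≤_) (sym eq)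
        (+-mono-≤ (Kq-nonNeg (suc m) (ℕ.s≤s ℕ.z≤n) (ℕP.≤-trans (ℕP.n≤1+n _) h))
          (+-mono-≤ (0≤* 0≤A (0≤* (proj₁ sy) (i≤j⇒0≤j-i (proj₂ sy))))
               (crossTerm-nonNeg (Ψ (suc m)) (s (suc m)) (s (suc (suc m))) (Ψ-bounded (suc m) (ℕ.s≤s ℕ.z≤n) h) sx sy)))
        where
        sx = s-bounds (suc m) (ℕ.s≤s ℕ.z≤n) (ℕP.≤-trans (ℕP.n≤1+n _) h)
        sy = s-bounds (suc (suc m)) (ℕ.s≤s ℕ.z≤n) h
        eq : Kq (suc (suc m)) ≡ _
        eq = trans (cong (λ t → A * Zp (suc (suc m)) - ΣE * Σs (suc (suc m)) - (A * (Σℤ (suc m) E + E (suc (suc m))) - t * ΣE) * s (suc (suc m)))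
                   (pos-+ 1 (suc m)))
             (Kq-step A K (Zp (suc m)) ΣE (Σs (suc m)) (Σℤ (suc m) E) (+ (suc m)) (E (suc (suc m))) (s (suc m)) (s (suc (suc m))))

      AZ≥ΣE*Σs : 1 ℕ.≤ a → 0ℤ ≤ A * Zp a - ΣE * Σs a
      AZ≥ΣE*Σs h = subst (0ℤ ≤_) (trans (cong (λ t → A * Zp a - ΣE * Σs a - t * s a) Ψa≡0) (lem (A * Zp a) (ΣE * Σs a) (s a))) (Kq-nonNeg a h ℕP.≤-refl)
        where
        Ψa≡0 : Ψ a ≡ 0ℤ
        Ψa≡0 = lem2 A ΣE
          where
          lem2 : ∀ u w → u * w - u * w ≡ 0ℤ
          lem2 = solve-∀
        lem : ∀ u w v → u - w - 0ℤ * v ≡ u - w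
        lem = solve-∀

    module ZpAsXp
      (a≥2 : 2 ℕ.≤ a)
      (E-first-degree : E 1 ≡ + 2 * D 1 + + 1 - + 2 * K)
      (E-middle-degree : ∀ i → 1 ℕ.< i → i ℕ.< a → E i ≡ + 2 * D i + + 1 - + 3 * K)
      (E-last-degree : E a ≡ + 2 * D a + + 1 - + 2 * K)
      (s-beyond : s (suc a) ≡ 0ℤ) where

      Zp-Xp-first : ∀ s1 s2 D1 K' → s1 * (+ 2 * D1 + + 1 - + 2 * K') + s1 * (K' - s1) + K' * s1
                           ≡ 0ℤ + (s1 * (+ 2 * D1 + + 1) - s1 * s1 - + 2 * s1 * s2) + + 2 * s1 * s2
      Zp-Xp-first = solve-∀
      Zp-Xp-step : ∀ Xm x y y3 D2 K' → (Xm + + 2 * x * y - K' * x) + (y * (+ 2 * D2 + + 1 - + 3 * K') + y * (K' - y) + (x * (K' - y) + (K' - x) * y)) + K' * y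
                           ≡ Xm + (y * (+ 2 * D2 + + 1) - y * y - + 2 * y * y3) + + 2 * y * y3
      Zp-Xp-step = solve-∀
      Zp-Xp-last : ∀ Xm x y D2 K' → (Xm + + 2 * x * y - K' * x) + (y * (+ 2 * D2 + + 1 - + 2 * K') + y * (K' - y) + (x * (K' - y) + (K' - x) * y))
                           ≡ Xm + (y * (+ 2 * D2 + + 1) - y * y - + 2 * y * 0ℤ)
      Zp-Xp-last = solve-∀
      +-moveʳ : ∀ Z X x y K' → Z + K' * x ≡ X + + 2 * x * y → Z ≡ X + + 2 * x * y - K' * x
      +-moveʳ Z X x y K' h = trans (sym (l1 Z (K' * x))) (cong (_- K' * x) h)
        where
        l1 : ∀ u v → u + v - v ≡ u
        l1 = solve-∀

      Zp≡Xp-prefix : ∀ n → 1 ℕ.≤ n → n ℕ.< a → Zp n + K * s n ≡ Xp n + + 2 * s n * s (suc n)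
      Zp≡Xp-prefix (suc zero) _ _ = trans (cong (λ t → s 1 * t + s 1 * (K - s 1) + K * s 1) E-first-degree) (Zp-Xp-first (s 1) (s 2) (D 1) K)
      Zp≡Xp-prefix (suc (suc m)) _ h = trans (cong₂ (λ t1 t2 → (t1 + (s (suc (suc m)) * t2 + s (suc (suc m)) * (K - s (suc (suc m))) + crossTerm (suc m))) + K * s (suc (suc m)))
                                        (+-moveʳ (Zp (suc m)) (Xp (suc m)) (s (suc m)) (s (suc (suc m))) K (Zp≡Xp-prefix (suc m) (ℕ.s≤s ℕ.z≤n) (ℕP.≤-trans (ℕP.n≤1+n _) h)))
                                        (E-middle-degree (suc (suc m)) (ℕ.s≤s (ℕ.s≤s ℕ.z≤n)) h))
        (Zp-Xp-step (Xp (suc m)) (s (suc m)) (s (suc (suc m))) (s (suc (suc (suc m)))) (D (suc (suc m))) K)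

      Zp≡Xp : Zp a ≡ Xp a
      Zp≡Xp = go a a≥2 refl E-last-degree s-beyond
        where
        go : ∀ n → 2 ℕ.≤ n → n ≡ a → E n ≡ + 2 * D n + + 1 - + 2 * K → s (suc n) ≡ 0ℤ → Zp n ≡ Xp n
        go (suc zero) (ℕ.s≤s ()) _ _ _
        go (suc (suc m)) _ eqn hE s0 =
          trans (cong₂ (λ t1 t2 → t1 + (s (suc (suc m)) * t2 + s (suc (suc m)) * (K - s (suc (suc m))) + crossTerm (suc m)))
                  (+-moveʳ (Zp (suc m)) (Xp (suc m)) (s (suc m)) (s (suc (suc m))) K (Zp≡Xp-prefix (suc m) (ℕ.s≤s ℕ.z≤n) (subst (suc m ℕ.<_) eqn ℕP.≤-refl))) hE)
          (trans (Zp-Xp-last (Xp (suc m)) (s (suc m)) (s (suc (suc m))) (D (suc (suc m))) K)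
            (cong (λ t → Xp (suc m) + (s (suc (suc m)) * (+ 2 * D (suc (suc m)) + + 1) - s (suc (suc m)) * s (suc (suc m)) - + 2 * s (suc (suc m)) * t)) (sym s0)))

module FinalArithmetic where

  open import Data.Integer using (ℤ; +_; -[1+_]; _+_; _*_; _-_; -_; _≤_; 0ℤ; +≤+)
  open import Data.Integer.Properties
  open import Data.Integer.Tactic.RingSolver using (solve-∀)
  import Data.Nat as ℕ
  open ℕ using (ℕ; zero; suc)
  import Data.Nat.Properties as ℕP
  open import Data.Product using (_×_; _,_)
  open import Relation.Binary.PropositionalEquality
  open import Defs using (range1)
  open DoubleCounting using (ΣL)
  open Vertices using (ΣL-range1-suc)
  open PathInequality

  Σℤ-cong : ∀ n {f g : ℕ → ℤ} → (∀ i → f i ≡ g i) → Σℤ n f ≡ Σℤ n g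
  Σℤ-cong zero h = refl
  Σℤ-cong (suc n) h = cong₂ _+_ (Σℤ-cong n h) (h (suc n))

  Σℤ-linear : ∀ n (p q r w : ℤ) (f g h u : ℕ → ℤ) →
    Σℤ n (λ i → p * f i + q * g i + r * h i + w * u i) ≡ p * Σℤ n f + q * Σℤ n g + r * Σℤ n h + w * Σℤ n u
  Σℤ-linear zero p q r w f g h u = zeros p q r w
    where
    zeros : ∀ p q r w → 0ℤ ≡ p * 0ℤ + q * 0ℤ + r * 0ℤ + w * 0ℤ
    zeros = solve-∀
  Σℤ-linear (suc n) p q r w f g h u rewrite Σℤ-linear n p q r w f g h u =
    step p q r w (Σℤ n f) (Σℤ n g) (Σℤ n h) (Σℤ n u) (f (suc n)) (g (suc n)) (h (suc n)) (u (suc n))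
    where
    step : ∀ p q r w F G H U f1 g1 h1 u1 → p * F + q * G + r * H + w * U + (p * f1 + q * g1 + r * h1 + w * u1)
                                          ≡ p * (F + f1) + q * (G + g1) + r * (H + h1) + w * (U + u1)
    step = solve-∀

  ΣL-range1-toℤ : (f : ℕ → ℕ) (n : ℕ) → + ΣL f (range1 n) ≡ Σℤ n (λ i → + f i)
  ΣL-range1-toℤ f zero = refl
  ΣL-range1-toℤ f (suc n) = trans (cong +_ (ΣL-range1-suc f n)) (trans (pos-+ (ΣL f (range1 n)) (f (suc n))) (cong (_+ + f (suc n)) (ΣL-range1-toℤ f n)))

  Σℤ-const : ∀ n (cc : ℤ) → Σℤ n (λ _ → cc) ≡ + n * cc
  Σℤ-const zero cc = sym (*-zeroˡ cc)
  Σℤ-const (suc n) cc = trans (cong (_+ cc) (Σℤ-const n cc)) (trans (*-suc′ (+ n) cc) (cong (_* cc) (sym (pos-+ 1 n))))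
    where
    *-suc′ : ∀ m cc → m * cc + cc ≡ (+ 1 + m) * cc
    *-suc′ = solve-∀

  Σℤ-*ʳ : ∀ n (f : ℕ → ℤ) (cc : ℤ) → Σℤ n (λ i → f i * cc) ≡ Σℤ n f * cc
  Σℤ-*ʳ zero f cc = sym (*-zeroˡ cc)
  Σℤ-*ʳ (suc n) f cc rewrite Σℤ-*ʳ n f cc = sym (*-distribʳ-+ cc (Σℤ n f) (f (suc n)))

  0≤2*⇒0≤ : ∀ d → 0ℤ ≤ + 2 * d → 0ℤ ≤ d
  0≤2*⇒0≤ (+ n) _ = +≤+ ℕ.z≤n
  0≤2*⇒0≤ -[1+ n ] ()

  module Assembly (a k L gap : ℕ) (a≥2 : 2 ℕ.≤ a) (k≥1 : 1 ℕ.≤ k)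
    (sI wdeg pathDeg c : ℕ → ℕ)
    (pathDeg-first : pathDeg 1 ≡ 1) (pathDeg-last : pathDeg a ≡ 1) (pathDeg-middle : ∀ i → 1 ℕ.< i → i ℕ.< a → pathDeg i ≡ 2)
    (wdeg-first : wdeg 1 ℕ.+ 1 ≡ 2 ℕ.* k ℕ.+ c 1 ℕ.+ L) (wdeg-last : wdeg a ℕ.+ 1 ≡ 2 ℕ.* k ℕ.+ c a ℕ.+ L)
    (wdeg-middle : ∀ i → 1 ℕ.< i → i ℕ.< a → wdeg i ≡ 2 ℕ.* k ℕ.+ c i ℕ.+ L)
    (leaves-bounds : ∀ n → 1 ℕ.≤ n → n ℕ.< a → (n ℕ.* gap ℕ.≤ a ℕ.* ΣL c (range1 n)) × (a ℕ.* ΣL c (range1 n) ℕ.< n ℕ.* gap ℕ.+ a))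
    (leaves-total : ΣL c (range1 a) ≡ gap ℕ.+ 1)
    (sI-bound : ∀ i → 1 ℕ.≤ i → i ℕ.≤ a → sI i ℕ.≤ k) (sI-beyond : sI (suc a) ≡ 0) where

    K A : ℤ
    K = + k
    A = + a
    s : ℕ → ℤ
    s i = + sI i
    Dz : ℕ → ℤ
    Dz i = + (k ℕ.∸ 1 ℕ.+ wdeg i)
    X : ℕ → ℤ
    X i = + pathDeg i
    -- 2 e(N) = K · Σᵢ E i, so balancedness reduces to A · Xp a ≥ ΣE · Σs a.
    E : ℕ → ℤ
    E i = + 2 * Dz i + + 1 - K - K * X i
    Pz : ℕ → ℤ
    Pz n = + ΣL c (range1 n)

    open PathSums a k s E Dz hiding (K; A)

    K-1≡ : + (k ℕ.∸ 1) ≡ K - + 1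
    K-1≡ = trans (sym (l (+ (k ℕ.∸ 1)))) (cong (_- + 1) (trans (sym (pos-+ 1 (k ℕ.∸ 1))) (cong +_ (ℕP.m+[n∸m]≡n k≥1))))
      where
      l : ∀ z → + 1 + z - + 1 ≡ z
      l = solve-∀

    Dz≡ : ∀ i → Dz i ≡ K - + 1 + + wdeg i
    Dz≡ i = trans (pos-+ (k ℕ.∸ 1) (wdeg i)) (cong (_+ + wdeg i) K-1≡)

    wdeg-end-ℤ : ∀ i → wdeg i ℕ.+ 1 ≡ 2 ℕ.* k ℕ.+ c i ℕ.+ L → + wdeg i ≡ + 2 * K + + c i + + L - + 1
    wdeg-end-ℤ i h = trans (sym (l (+ wdeg i))) (cong (_- + 1) (trans (sym (pos-+ (wdeg i) 1)) (trans (cong +_ h)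
        (trans (pos-+ (2 ℕ.* k ℕ.+ c i) L) (cong (_+ + L) (trans (pos-+ (2 ℕ.* k) (c i)) (cong (_+ + c i) (pos-* 2 k))))))))
      where
      l : ∀ z → z + + 1 - + 1 ≡ z
      l = solve-∀
    wdeg-middle-ℤ : ∀ i → wdeg i ≡ 2 ℕ.* k ℕ.+ c i ℕ.+ L → + wdeg i ≡ + 2 * K + + c i + + L
    wdeg-middle-ℤ i h = trans (cong +_ h) (trans (pos-+ (2 ℕ.* k ℕ.+ c i) L) (cong (_+ + L) (trans (pos-+ (2 ℕ.* k) (c i)) (cong (_+ + c i) (pos-* 2 k)))))

    E₀ : ℤ
    E₀ = + 3 * K - + 1 + + 2 * + L

    E-first : E 1 ≡ E₀ + + 2 * + c 1 + (K - + 2)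
    E-first = trans (cong₂ (λ d z → + 2 * d + + 1 - K - K * z) (trans (Dz≡ 1) (cong (λ z → K - + 1 + z) (wdeg-end-ℤ 1 wdeg-first))) (cong +_ pathDeg-first)) (l K (+ c 1) (+ L))
      where
      l : ∀ K c L → + 2 * (K - + 1 + (+ 2 * K + c + L - + 1)) + + 1 - K - K * + 1 ≡ + 3 * K - + 1 + + 2 * L + + 2 * c + (K - + 2)
      l = solve-∀
    E-last : E a ≡ E₀ + + 2 * + c a + (K - + 2)
    E-last = trans (cong₂ (λ d z → + 2 * d + + 1 - K - K * z) (trans (Dz≡ a) (cong (λ z → K - + 1 + z) (wdeg-end-ℤ a wdeg-last))) (cong +_ pathDeg-last)) (l K (+ c a) (+ L))
      where
      l : ∀ K c L → + 2 * (K - + 1 + (+ 2 * K + c + L - + 1)) + + 1 - K - K * + 1 ≡ + 3 * K - + 1 + + 2 * L + + 2 * c + (K - + 2)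
      l = solve-∀
    E-middle : ∀ i → 1 ℕ.< i → i ℕ.< a → E i ≡ E₀ + + 2 * + c i
    E-middle i h1 h2 = trans (cong₂ (λ d z → + 2 * d + + 1 - K - K * z) (trans (Dz≡ i) (cong (λ z → K - + 1 + z) (wdeg-middle-ℤ i (wdeg-middle i h1 h2)))) (cong +_ (pathDeg-middle i h1 h2))) (l K (+ c i) (+ L))
      where
      l : ∀ K c L → + 2 * (K - + 1 + (+ 2 * K + c + L)) + + 1 - K - K * + 2 ≡ + 3 * K - + 1 + + 2 * L + + 2 * c
      l = solve-∀

    E-first-degree : E 1 ≡ + 2 * Dz 1 + + 1 - + 2 * K
    E-first-degree = trans (cong (λ z → + 2 * Dz 1 + + 1 - K - K * z) (cong +_ pathDeg-first)) (l (Dz 1) K)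
      where
      l : ∀ D K → + 2 * D + + 1 - K - K * + 1 ≡ + 2 * D + + 1 - + 2 * K
      l = solve-∀
    E-last-degree : E a ≡ + 2 * Dz a + + 1 - + 2 * K
    E-last-degree = trans (cong (λ z → + 2 * Dz a + + 1 - K - K * z) (cong +_ pathDeg-last)) (l (Dz a) K)
      where
      l : ∀ D K → + 2 * D + + 1 - K - K * + 1 ≡ + 2 * D + + 1 - + 2 * K
      l = solve-∀
    E-middle-degree : ∀ i → 1 ℕ.< i → i ℕ.< a → E i ≡ + 2 * Dz i + + 1 - + 3 * K
    E-middle-degree i h1 h2 = trans (cong (λ z → + 2 * Dz i + + 1 - K - K * z) (cong +_ (pathDeg-middle i h1 h2))) (l (Dz i) K)
      where
      l : ∀ D K → + 2 * D + + 1 - K - K * + 2 ≡ + 2 * D + + 1 - + 3 * K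
      l = solve-∀

    Pz-suc : ∀ n → Pz (suc n) ≡ Pz n + + c (suc n)
    Pz-suc n = trans (cong +_ (ΣL-range1-suc c n)) (pos-+ (ΣL c (range1 n)) (c (suc n)))

    ΣE-prefix : ∀ n → 1 ℕ.≤ n → n ℕ.< a → Σℤ n E ≡ + n * E₀ + + 2 * Pz n + (K - + 2)
    ΣE-prefix (suc zero) _ _ = trans (cong (λ z → 0ℤ + z) E-first) (trans (l E₀ (+ c 1) K) (cong (λ z → + 1 * E₀ + + 2 * z + (K - + 2)) (sym (Pz-suc 0))))
      where
      l : ∀ e c K → 0ℤ + (e + + 2 * c + (K - + 2)) ≡ + 1 * e + + 2 * (0ℤ + c) + (K - + 2)
      l = solve-∀
    ΣE-prefix (suc (suc m)) _ h = trans (cong₂ _+_ (ΣE-prefix (suc m) (ℕ.s≤s ℕ.z≤n) (ℕP.≤-trans (ℕP.n≤1+n _) h)) (E-middle (suc (suc m)) (ℕ.s≤s (ℕ.s≤s ℕ.z≤n)) h))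
      (trans (l (+ suc m) E₀ (Pz (suc m)) (+ c (suc (suc m))) K)
        (cong₂ (λ z1 z2 → z1 * E₀ + + 2 * z2 + (K - + 2)) (sym (pos-+ 1 (suc m))) (sym (Pz-suc (suc m)))))
      where
      l : ∀ n e P c K → n * e + + 2 * P + (K - + 2) + (e + + 2 * c) ≡ (+ 1 + n) * e + + 2 * (P + c) + (K - + 2)
      l = solve-∀

    a-1 : ℕ
    a-1 = a ℕ.∸ 1
    1+[a-1]≡a : suc a-1 ≡ a
    1+[a-1]≡a = ℕP.m+[n∸m]≡n {1} {a} (ℕP.≤-trans (ℕ.s≤s ℕ.z≤n) a≥2)
    a-1≥1 : 1 ℕ.≤ a-1
    a-1≥1 = ℕP.≤-pred (subst (2 ℕ.≤_) (sym 1+[a-1]≡a) a≥2)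

    ΣE-total : Σℤ a E ≡ A * E₀ + + 2 * Pz a + + 2 * (K - + 2)
    ΣE-total = subst (λ z → Σℤ z E ≡ + z * E₀ + + 2 * Pz z + + 2 * (K - + 2)) 1+[a-1]≡a
      (trans (cong₂ _+_ (ΣE-prefix a-1 a-1≥1 (subst (a-1 ℕ.<_) 1+[a-1]≡a ℕP.≤-refl)) (subst (λ z → E z ≡ E₀ + + 2 * + c z + (K - + 2)) (sym 1+[a-1]≡a) E-last))
        (trans (l (+ a-1) E₀ (Pz a-1) (+ c (suc a-1)) K)
          (cong₂ (λ z1 z2 → z1 * E₀ + + 2 * z2 + + 2 * (K - + 2)) (sym (pos-+ 1 a-1)) (sym (Pz-suc a-1)))))
      where
      l : ∀ n e P c K → n * e + + 2 * P + (K - + 2) + (e + + 2 * c + (K - + 2)) ≡ (+ 1 + n) * e + + 2 * (P + c) + + 2 * (K - + 2)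
      l = solve-∀

    Pz-total : Pz a ≡ + gap + + 1
    Pz-total = trans (cong +_ leaves-total) (pos-+ gap 1)

    Φ : ℕ → ℤ
    Φ n = A * Pz n - + n * + gap

    -- The leaves of T₂(a,b′) are spread evenly, n·gap ≤ a·Pz n < n·gap + a, whence |Ψ n| ≤ A K.
    Ψ-formula : ∀ n → 1 ℕ.≤ n → n ℕ.< a → Ψ n ≡ + 2 * Φ n + A * (K - + 2) - + 2 * + n * (K - + 1)
    Ψ-formula n h1 h2 = trans (cong₂ (λ p q → A * p - + n * q) (ΣE-prefix n h1 h2) (trans ΣE-total (cong (λ z → A * E₀ + + 2 * z + + 2 * (K - + 2)) Pz-total)))
                      (l A (+ n) E₀ (Pz n) (+ gap) K)
      where
      l : ∀ A n e P D K → A * (n * e + + 2 * P + (K - + 2)) - n * (A * e + + 2 * (D + + 1) + + 2 * (K - + 2))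
                        ≡ + 2 * (A * P - n * D) + A * (K - + 2) - + 2 * n * (K - + 1)
      l = solve-∀

    Ψ-bounds : ∀ n → 1 ℕ.≤ n → n ℕ.< a → (- (A * K) ≤ Ψ n) × (Ψ n ≤ A * K)
    Ψ-bounds n h1 h2 with leaves-bounds n h1 h2
    ... | (lo , up) = 0≤i-j⇒j≤i (subst (0ℤ ≤_) (sym Ψ+AK) (+-mono-≤ (0≤* 0≤2 0≤Φ) (0≤* 0≤2 (0≤* 0≤K-1 0≤A-n))))
                     , 0≤i-j⇒j≤i (subst (0ℤ ≤_) (sym AK-Ψ) (+-mono-≤ (0≤* 0≤2 0≤A-Φ) (0≤* 0≤2 (0≤* (+≤+ {0} {n} ℕ.z≤n) 0≤K-1))))
      where
      0≤2 : 0ℤ ≤ + 2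
      0≤2 = +≤+ ℕ.z≤n
      0≤K-1 : 0ℤ ≤ K - + 1
      0≤K-1 = i≤j⇒0≤j-i (+≤+ k≥1)
      0≤A-n : 0ℤ ≤ A - + n
      0≤A-n = i≤j⇒0≤j-i (+≤+ (ℕP.<⇒≤ h2))
      0≤Φ : 0ℤ ≤ Φ n
      0≤Φ = i≤j⇒0≤j-i (subst₂ _≤_ (pos-* n gap) (pos-* a (ΣL c (range1 n))) (+≤+ lo))
      0≤A-Φ : 0ℤ ≤ A - Φ n
      0≤A-Φ = subst (0ℤ ≤_) (l A (Pz n) (+ n) (+ gap)) (i≤j⇒0≤j-i (subst₂ _≤_ (pos-* a (ΣL c (range1 n))) (trans (pos-+ (n ℕ.* gap) a) (cong (_+ A) (pos-* n gap))) (+≤+ (ℕP.<⇒≤ up))))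
        where
        l : ∀ A P n D → n * D + A - A * P ≡ A - (A * P - n * D)
        l = solve-∀
      Ψ+AK : Ψ n - - (A * K) ≡ + 2 * Φ n + + 2 * ((K - + 1) * (A - + n))
      Ψ+AK = trans (cong (_- - (A * K)) (Ψ-formula n h1 h2)) (l A (+ n) K (Φ n))
        where
        l : ∀ A n K F → + 2 * F + A * (K - + 2) - + 2 * n * (K - + 1) - - (A * K) ≡ + 2 * F + + 2 * ((K - + 1) * (A - n))
        l = solve-∀
      AK-Ψ : A * K - Ψ n ≡ + 2 * (A - Φ n) + + 2 * (+ n * (K - + 1))
      AK-Ψ = trans (cong (λ z → A * K - z) (Ψ-formula n h1 h2)) (l A (+ n) K (Φ n))
        where
        l : ∀ A n K F → A * K - (+ 2 * F + A * (K - + 2) - + 2 * n * (K - + 1)) ≡ + 2 * (A - F) + + 2 * (n * (K - + 1))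
        l = solve-∀

    s-bounds : ∀ i → 1 ℕ.≤ i → i ℕ.≤ a → (0ℤ ≤ s i) × (s i ≤ K)
    s-bounds i h1 h2 = +≤+ ℕ.z≤n , +≤+ (sI-bound i h1 h2)

    module PR = Positivity s-bounds Ψ-bounds
    module ZXm = ZpAsXp a≥2 E-first-degree E-middle-degree E-last-degree (cong +_ sI-beyond)

    core-inequality : 0ℤ ≤ A * Xp a - ΣE * Σs a
    core-inequality = subst (λ z → 0ℤ ≤ A * z - ΣE * Σs a) ZXm.Zp≡Xp (PR.AZ≥ΣE*Σs (ℕP.≤-trans (ℕ.s≤s ℕ.z≤n) a≥2))

    SD SS SQ SN TD TX : ℤ
    SD = Σℤ a (λ i → s i * Dz i)
    SS = Σℤ a s
    SQ = Σℤ a (λ i → s i * s i)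
    SN = Σℤ a (λ i → s i * s (suc i))
    TD = Σℤ a Dz
    TX = Σℤ a X

    one : ℕ → ℤ
    one _ = + 1

    Xp-expand : Xp a ≡ + 2 * SD + SS - SQ - + 2 * SN
    Xp-expand = trans (Σℤ-cong a (λ i → l (s i) (Dz i) (s (suc i))))
      (trans (Σℤ-linear a (+ 2) (+ 1) (- + 1) (- + 2) (λ i → s i * Dz i) s (λ i → s i * s i) (λ i → s i * s (suc i)))
        (l2 SD SS SQ SN))
      where
      l : ∀ s D s' → s * (+ 2 * D + + 1) - s * s - + 2 * s * s' ≡ + 2 * (s * D) + + 1 * s + - + 1 * (s * s) + - + 2 * (s * s')
      l = solve-∀
      l2 : ∀ a b c d → + 2 * a + + 1 * b + - + 1 * c + - + 2 * d ≡ + 2 * a + b - c - + 2 * d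
      l2 = solve-∀

    ΣE-expand : ΣE ≡ + 2 * TD + A - K * A - K * TX
    ΣE-expand = trans (Σℤ-cong a (λ i → l (Dz i) K (X i)))
      (trans (Σℤ-linear a (+ 2) (+ 1) (- K) (- K) Dz one one X)
        (trans (cong (λ z → + 2 * TD + + 1 * z + - K * z + - K * TX) (trans (Σℤ-const a (+ 1)) (*-identityʳ A)))
          (l2 TD A K TX)))
      where
      l : ∀ D K X → + 2 * D + + 1 - K - K * X ≡ + 2 * D + + 1 * + 1 + - K * + 1 + - K * X
      l = solve-∀
      l2 : ∀ T A K X → + 2 * T + + 1 * A + - K * A + - K * X ≡ + 2 * T + A - K * A - K * X
      l2 = solve-∀

    module Conclusion (eS eN QS cardS cardN : ℕ)
      (handshake-S : 2 ℕ.* eS ℕ.+ QS ≡ 2 ℕ.* ΣL (λ i → sI i ℕ.* ((k ℕ.∸ 1) ℕ.+ wdeg i)) (range1 a))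
      (inside-bound-S : QS ℕ.+ ΣL sI (range1 a) ℕ.≤ ΣL (λ i → sI i ℕ.* sI i) (range1 a) ℕ.+ ΣL (λ i → sI i ℕ.* sI (suc i)) (range1 a) ℕ.+ ΣL (λ i → sI i ℕ.* sI (suc i)) (range1 a))
      (card-S : cardS ≡ ΣL sI (range1 a))
      (handshake-N : 2 ℕ.* eN ℕ.+ ΣL (λ i → ((k ℕ.∸ 1) ℕ.+ k ℕ.* pathDeg i) ℕ.* k) (range1 a) ≡ 2 ℕ.* ΣL (λ i → ((k ℕ.∸ 1) ℕ.+ wdeg i) ℕ.* k) (range1 a))
      (card-N : cardN ≡ k ℕ.* a) where

      zSD : + ΣL (λ i → sI i ℕ.* ((k ℕ.∸ 1) ℕ.+ wdeg i)) (range1 a) ≡ SD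
      zSD = trans (ΣL-range1-toℤ _ a) (Σℤ-cong a (λ i → pos-* (sI i) _))
      zSS : + ΣL sI (range1 a) ≡ SS
      zSS = ΣL-range1-toℤ sI a
      zSQ : + ΣL (λ i → sI i ℕ.* sI i) (range1 a) ≡ SQ
      zSQ = trans (ΣL-range1-toℤ _ a) (Σℤ-cong a (λ i → pos-* (sI i) (sI i)))
      zSN : + ΣL (λ i → sI i ℕ.* sI (suc i)) (range1 a) ≡ SN
      zSN = trans (ΣL-range1-toℤ _ a) (Σℤ-cong a (λ i → pos-* (sI i) (sI (suc i))))
      zTDK : + ΣL (λ i → ((k ℕ.∸ 1) ℕ.+ wdeg i) ℕ.* k) (range1 a) ≡ TD * K
      zTDK = trans (ΣL-range1-toℤ _ a) (trans (Σℤ-cong a (λ i → pos-* ((k ℕ.∸ 1) ℕ.+ wdeg i) k)) (Σℤ-*ʳ a Dz K))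
      zQN : + ΣL (λ i → ((k ℕ.∸ 1) ℕ.+ k ℕ.* pathDeg i) ℕ.* k) (range1 a) ≡ K * K * TX + K * (K - + 1) * A
      zQN = trans (ΣL-range1-toℤ _ a) (trans (Σℤ-cong a pt)
        (trans (Σℤ-linear a (K * K) (K * (K - + 1)) 0ℤ 0ℤ X one one one)
          (trans (cong (λ z → K * K * TX + K * (K - + 1) * z + 0ℤ * z + 0ℤ * z) (trans (Σℤ-const a (+ 1)) (*-identityʳ A)))
            (l2 K TX A))))
        where
        pt : ∀ i → + (((k ℕ.∸ 1) ℕ.+ k ℕ.* pathDeg i) ℕ.* k) ≡ K * K * X i + K * (K - + 1) * + 1 + 0ℤ * + 1 + 0ℤ * + 1
        pt i = trans (pos-* ((k ℕ.∸ 1) ℕ.+ k ℕ.* pathDeg i) k) (trans (cong (_* K) (trans (pos-+ (k ℕ.∸ 1) (k ℕ.* pathDeg i)) (cong₂ _+_ K-1≡ (pos-* k (pathDeg i)))))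
          (l K (X i)))
          where
          l : ∀ K X → (K - + 1 + K * X) * K ≡ K * K * X + K * (K - + 1) * + 1 + 0ℤ * + 1 + 0ℤ * + 1
          l = solve-∀
        l2 : ∀ K T A → K * K * T + K * (K - + 1) * A + 0ℤ * A + 0ℤ * A ≡ K * K * T + K * (K - + 1) * A
        l2 = solve-∀

      hAz : + 2 * + eS + + QS ≡ + 2 * SD
      hAz = trans (cong (_+ + QS) (sym (pos-* 2 eS))) (trans (sym (pos-+ (2 ℕ.* eS) QS)) (trans (cong +_ handshake-S) (trans (pos-* 2 (ΣL (λ i → sI i ℕ.* ((k ℕ.∸ 1) ℕ.+ wdeg i)) (range1 a))) (cong (λ z → + 2 * z) zSD))))

      hBz : + QS + SS ≤ SQ + SN + SN
      hBz = subst₂ _≤_ (trans (pos-+ QS (ΣL sI (range1 a))) (cong (λ z → + QS + z) zSS))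
                       (trans (pos-+ (ΣL (λ i → sI i ℕ.* sI i) (range1 a) ℕ.+ ΣL (λ i → sI i ℕ.* sI (suc i)) (range1 a)) (ΣL (λ i → sI i ℕ.* sI (suc i)) (range1 a)))
                         (cong₂ _+_ (trans (pos-+ (ΣL (λ i → sI i ℕ.* sI i) (range1 a)) (ΣL (λ i → sI i ℕ.* sI (suc i)) (range1 a))) (cong₂ _+_ zSQ zSN)) zSN))
                       (+≤+ inside-bound-S)

      hDz : + 2 * + eN + (K * K * TX + K * (K - + 1) * A) ≡ + 2 * (TD * K)
      hDz = trans (cong₂ _+_ (sym (pos-* 2 eN)) (sym zQN)) (trans (sym (pos-+ (2 ℕ.* eN) (ΣL (λ i → ((k ℕ.∸ 1) ℕ.+ k ℕ.* pathDeg i) ℕ.* k) (range1 a)))) (trans (cong +_ handshake-N) (trans (pos-* 2 (ΣL (λ i → ((k ℕ.∸ 1) ℕ.+ wdeg i) ℕ.* k) (range1 a))) (cong (λ z → + 2 * z) zTDK))))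

      +-move : ∀ x q y → x + q ≡ y → x ≡ y - q
      +-move x q y h = trans (sym (l x q)) (cong (_- q) h)
        where
        l : ∀ x q → x + q - q ≡ x
        l = solve-∀

      2Δ-decomposition : + 2 * (+ eS * (K * A) - + eN * SS) ≡ K * A * (SQ + SN + SN - (+ QS + SS)) + K * (A * Xp a - ΣE * SS)
      2Δ-decomposition = trans (l1 (+ eS) (+ eN) K A SS)
        (trans (cong₂ (λ u w → K * A * u - w * SS) (+-move (+ 2 * + eS) (+ QS) (+ 2 * SD) hAz) (+-move (+ 2 * + eN) (K * K * TX + K * (K - + 1) * A) (+ 2 * (TD * K)) hDz))
          (trans (l2 K A SD (+ QS) TD TX SS SQ SN)
            (sym (cong₂ (λ u w → K * A * (SQ + SN + SN - (+ QS + SS)) + K * (A * u - w * SS)) Xp-expand ΣE-expand))))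
        where
        l1 : ∀ eS eN K A SS → + 2 * (eS * (K * A) - eN * SS) ≡ K * A * (+ 2 * eS) - (+ 2 * eN) * SS
        l1 = solve-∀
        l2 : ∀ K A SD QS TD TX SS SQ SN →
          K * A * (+ 2 * SD - QS) - (+ 2 * (TD * K) - (K * K * TX + K * (K - + 1) * A)) * SS
          ≡ K * A * (SQ + SN + SN - (QS + SS)) + K * (A * (+ 2 * SD + SS - SQ - + 2 * SN) - (+ 2 * TD + A - K * A - K * TX) * SS)
        l2 = solve-∀

      balanced-inequality : eN ℕ.* cardS ℕ.≤ eS ℕ.* cardN
      balanced-inequality = drop‿+≤+ (subst₂ _≤_ (trans (cong (λ z → + eN * z) (sym zSS)) (trans (cong (λ z → + eN * + z) (sym card-S)) (sym (pos-* eN cardS))))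
                                    (trans (cong (λ z → + eS * z) (trans (sym (pos-* k a)) (cong +_ (sym card-N)))) (sym (pos-* eS cardN)))
                 (0≤i-j⇒j≤i (0≤2*⇒0≤ _ (subst (0ℤ ≤_) (sym 2Δ-decomposition)
                   (+-mono-≤ (0≤* (0≤* 0≤K-1 A0) (i≤j⇒0≤j-i hBz)) (0≤* 0≤K-1 core-inequality))))))
        where
        0≤K-1 : 0ℤ ≤ K
        0≤K-1 = +≤+ ℕ.z≤n
        A0 : 0ℤ ≤ A
        A0 = +≤+ ℕ.z≤n

module Balance where

  open import Data.Nat
  open import Data.Nat.Properties
  open import Data.Nat.DivMod using (_/_; _%_; m≡m%n+[m/n]*n; /-monoˡ-≤)
  open import Data.Bool using (true; false)
  open import Data.Product using (_×_; _,_; proj₁; proj₂; Σ)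
  open import Relation.Binary.PropositionalEquality
  open import Data.Nat.Tactic.RingSolver using (solve-∀)
  open import Data.Fin.Subset using (∣_∣)
  open import Defs
  open DoubleCounting
  open Vertices
  open BaseNeighbourhoods
  open Recursion
  open LeafDistribution
  open BlowUp
  open FinalArithmetic
  open BaseDegrees

  even⇒2≤ : ∀ a → 1 ≤ a → a % 2 ≡ 0 → 2 ≤ a
  even⇒2≤ (suc zero) _ ()
  even⇒2≤ (suc (suc _)) _ _ = s≤s (s≤s z≤n)

  even⇒≡2*half : ∀ a → a % 2 ≡ 0 → a ≡ 2 * (a / 2)
  even⇒≡2*half a a%2≡0 = trans (m≡m%n+[m/n]*n a 2) (trans (cong (_+ a / 2 * 2) a%2≡0) (*-comm (a / 2) 2))

  -- b′ − a is the number of evenly spread leaves of T₂(a,b′) (Defs.leafIndices).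
  base-gap : ∀ a b′ → 2 * a + 2 ≤ b′ → b′ ≤ 3 * a + 1 →
    Σ ℕ λ d → (b′ ∸ a ≡ suc d) × (a + 2 ≤ suc d) × (suc d ≤ 2 * a + 1)
  base-gap a b′ lo hi = b′ ∸ a ∸ 1 , gap≡ , subst (a + 2 ≤_) gap≡ lower , subst (_≤ 2 * a + 1) gap≡ upper
    where
    lower : a + 2 ≤ b′ ∸ a
    lower = ≤-trans (≤-reflexive (sym (trans (cong (_∸ a) (lem a)) (m+n∸n≡m (a + 2) a)))) (∸-monoˡ-≤ a lo)
      where
      lem : ∀ a → 2 * a + 2 ≡ a + 2 + a
      lem = solve-∀
    upper : b′ ∸ a ≤ 2 * a + 1
    upper = ≤-trans (∸-monoˡ-≤ a hi) (≤-reflexive (trans (cong (_∸ a) (lem a)) (m+n∸n≡m (2 * a + 1) a)))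
      where
      lem : ∀ a → 3 * a + 1 ≡ 2 * a + 1 + a
      lem = solve-∀
    gap≡ : b′ ∸ a ≡ suc (b′ ∸ a ∸ 1)
    gap≡ = sym (m+[n∸m]≡n {1} {b′ ∸ a} (≤-trans (≤-trans (s≤s z≤n) (≤-reflexive (+-comm 2 a))) lower))

  module Tt2Balanced (t a b : ℕ) (t≥3 : 3 ≤ t) (a≥2 : 2 ≤ a) (a≡2*h : a ≡ 2 * (a / 2))
    (b′ L : ℕ) (fb : Layers.FromBase a (≤-trans (s≤s z≤n) a≥2) a≡2*h (T3 a b) b′ L b)
    (d : ℕ) (gap≡ : b′ ∸ a ≡ suc d) (gap-lo : a + 2 ≤ suc d) (gap-hi : suc d ≤ 2 * a + 1) where

    open Layers.FromBase fb
    open Tt2Con t a b using (k; size; adj3)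

    k≥1 : 1 ≤ k
    k≥1 = /-monoˡ-≤ 2 (∸-monoˡ-≤ 1 t≥3)

    module Leaves = LeafCounts.WithGap a b′ d gap≡
    module RootDegrees = Leaves.Degrees a≥2 gap-lo gap-hi
    module Base = Degrees a b′ k a≥2 RootDegrees.rootDeg-first RootDegrees.rootDeg-last RootDegrees.rootDeg-middle

    c : ℕ → ℕ
    c = rootDeg a b′

    inRange⇒bounds : ∀ {i} → inRange i a ≡ true → (1 ≤ i) × (i ≤ a)
    inRange⇒bounds {i} e = ≤ᵇ-sound 1 i (proj₁ (∧-true⁻ e)) , ≤ᵇ-sound i a (proj₂ (∧-true⁻ e))

    no-self-loops : ∀ i → inRange i a ≡ true → adj3 (x i) (x i) ≡ false
    no-self-loops i hi = trans (path-adjacency i i) (Base.base-irrefl i (proj₁ (inRange⇒bounds hi)) (proj₂ (inRange⇒bounds hi)))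

    path-bound : ∀ i i′ → inRange i a ≡ true → ind (adj3 (x i) (x i′)) ≤ ind (i′ ≡ᵇ suc i) + ind (i ≡ᵇ suc i′)
    path-bound i i′ hi = subst (_≤ _) (sym (cong ind (path-adjacency i i′)))
      (Base.base-path-bound i i′ (proj₁ (inRange⇒bounds hi)) (proj₂ (inRange⇒bounds hi)))

    module Sums = BlowUpSums t a b (proj₁ verts-split) (proj₁ (proj₂ verts-split)) (proj₂ (proj₂ verts-split)) no-self-loops path-bound

    size≡weight : ∀ u → size u ≡ Base.baseWeight u
    size≡weight u = cong₂ (λ s₁ sₐ → blowUpSize s₁ sₐ k u) spec₁-base specₐ-base

    size-layer : ∀ r j → size (v r j) ≡ 1
    size-layer r j = trans (size≡weight (v r j)) (layer (T3Base.three₁ a b′) (T3Base.threeₐ a b′))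
      where
      layer : ∀ b₁ bₐ → blowUpSize (special₁ b₁) (specialₐ bₐ (T3Base.m a b′)) k (v r j) ≡ 1
      layer true true = refl
      layer true false = refl
      layer false true = refl
      layer false false = refl

    wdeg≡base : ∀ i → 1 ≤ i → i ≤ a → Sums.wdeg i ≡ Base.baseDegree i + L
    wdeg≡base i i1 ia = trans (weightedDegree-base i size size-layer i1 ia)
      (cong (_+ L) (ΣL-cong (T3Data.verts (T3Base.data3 a b′)) (λ u → cong (ind (adjacentIn (T3Data.edges (T3Base.data3 a b′)) (x i) u) *_) (size≡weight u))))

    pathDeg≡base : ∀ i → Sums.pathDeg i ≡ Base.basePathDegree i
    pathDeg≡base i = ΣL-cong (range1 a) (λ i′ → cong ind (path-adjacency i i′))

    +-end : ∀ m n → m + n + 1 ≡ m + 1 + n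
    +-end = solve-∀

    wdeg-first : Sums.wdeg 1 + 1 ≡ 2 * k + c 1 + L
    wdeg-first = trans (cong (_+ 1) (wdeg≡base 1 ≤-refl (≤-trans (s≤s z≤n) a≥2)))
      (trans (+-end (Base.baseDegree 1) L) (cong (_+ L) Base.baseDegree-first))

    wdeg-last : Sums.wdeg a + 1 ≡ 2 * k + c a + L
    wdeg-last = trans (cong (_+ 1) (wdeg≡base a (≤-trans (s≤s z≤n) a≥2) ≤-refl))
      (trans (+-end (Base.baseDegree a) L) (cong (_+ L) Base.baseDegree-last))

    wdeg-middle : ∀ i → 1 < i → i < a → Sums.wdeg i ≡ 2 * k + c i + L
    wdeg-middle i i1 ia = trans (wdeg≡base i (<⇒≤ i1) (<⇒≤ ia)) (cong (_+ L) (Base.baseDegree-middle i i1 ia))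

    balanced : Balanced (Tt2 t a b)
    balanced S _ S⊆N = Final.balanced-inequality
      where
      open Sums.Subgraph S S⊆N
      cliqueSize-bound : ∀ i → 1 ≤ i → i ≤ a → cliqueSize i ≤ k
      cliqueSize-bound i _ _ = ≤-trans (cliqueSize≤k i) (≤-trans (*-monoˡ-≤ k (ind≤1 (inRange i a))) (≤-reflexive (*-identityˡ k)))
      cliqueSize-beyond : cliqueSize (suc a) ≡ 0
      cliqueSize-beyond = n≤0⇒n≡0 (≤-trans (cliqueSize≤k (suc a)) (≤-reflexive (cong (λ z → ind z * k) (inRange-beyond a))))
      module Arith = Assembly a k L (suc d) a≥2 k≥1 cliqueSize Sums.wdeg Sums.pathDeg c
        (trans (pathDeg≡base 1) Base.basePathDegree-first) (trans (pathDeg≡base a) Base.basePathDegree-last)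
        (λ i i1 ia → trans (pathDeg≡base i) (Base.basePathDegree-middle i i1 ia))
        wdeg-first wdeg-last wdeg-middle Leaves.leavesUpTo-bounds (Leaves.leavesUpTo-a (≤-trans (s≤s z≤n) a≥2))
        cliqueSize-bound cliqueSize-beyond
      module Final = Arith.Conclusion (e (Tt2 t a b) S) (e (Tt2 t a b) (NonRoots (Tt2 t a b))) _ ∣ S ∣ ∣ NonRoots (Tt2 t a b) ∣
        handshake-S inside-bound-S card-S Sums.handshake-NonRoots Sums.card-NonRoots

  Tt2-balanced : ∀ t a b → 3 ≤ t → 2 ≤ a → a ≡ 2 * (a / 2) → 2 * a + 2 ≤ b → Balanced (Tt2 t a b)
  Tt2-balanced t a b t≥3 a≥2 a≡2*h 2a+2≤b with Layers.T3aux-fromBase a (≤-trans (s≤s z≤n) a≥2) a≡2*h b b 2a+2≤b ≤-refl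
  ... | b′ , L , fb with base-gap a b′ (proj₁ (Layers.FromBase.base-range fb)) (proj₂ (Layers.FromBase.base-range fb))
  ... | d , gap≡ , gap-lo , gap-hi = Tt2Balanced.balanced t a b t≥3 a≥2 a≡2*h b′ L fb d gap≡ gap-lo gap-hi

open import Data.Nat using (ℕ; _≤_; _+_; _*_; _%_)
open import Relation.Binary.PropositionalEquality using (_≡_)
open import Defs
open Balance

proposition4p14 : (t a b : ℕ) → 3 ≤ t → t % 2 ≡ 1 → 1 ≤ a → a % 2 ≡ 0 →
    2 * a + 2 ≤ b → Balanced (Tt2 t a b)
proposition4p14 t a b t≥3 _ a≥1 a-even =
  Tt2-balanced t a b t≥3 (even⇒2≤ a a≥1 a-even) (even⇒≡2*half a a-even)
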